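{- Let $(W(n))_{n\ge0}$ be a Somos 4 sequence with $\tau_1\neq0$ and $W(0)\neq0$. Let $E/\mathbb{Q}$ be the associated elliptic curve and $\mathbf{P}=(P_1,P_2)\in E(\mathbb{Q})^2$ the associated rational point. Let $p$ be an odd prime, with $E$ given by a Weierstrass equation with $p$-integral coefficients, such that $P_1$ and $P_2$ modulo $p$ are nonsingular, $P_1,\ P_2,\ P_2\pm P_1\not\equiv\mathcal{O}\pmod p$, and the order of $P_1$ modulo $p$ is greater than $3$. Assume further that $\mathrm{ord}_p\left(\frac{W(1)}{W(0)}\right)\ge0$ and $\mathrm{ord}_p(W(0))\ge 0$. Then there is a power $q=p^N$ ($N\ge1$) such that for all $m\ge1$ the limit $\lim_{i\to\infty}W(mq^i)$ exists in $\mathbb{Z}_p$.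
   Context: A Somos 4 sequence is a sequence $(W(n))_{n\ge0}$ (here of rational numbers) satisfying $W(n)W(n-4)=\tau_1W(n-1)W(n-3)+\tau_2W(n-2)^2$ for all $n\ge4$, with constant parameters $\tau_1,\tau_2$. Associated curve and point. The elliptic curve $E/\mathbb{Q}$ and $\mathbf{P}=(P_1,P_2)\in E(\mathbb{Q})^2$ are associated to $(W(n))$ if they realize Hone's sigma-function solution: $P_1,P_2$ are the images of $z_1,z_2\in\mathbb{C}$ under a uniformization $\mathbb{C}/L\cong E(\mathbb{C})$, and $W(n)=\alpha^n\beta\,\Psi_n(\mathbf{P})$ for all $n\ge1$, with $\alpha=W(1)/W(0)$, $\beta=W(0)$, where $\Psi_n(\mathbf{P})=\dfrac{\sigma(nz_1+z_2)}{\sigma(z_1)^{n^2-n}\sigma(z_1+z_2)^n\sigma(z_2)^{1-n}}$ ($\sigma$ the Weierstrass sigma function of $L$) are the values of the translated division polynomials. Algebraically, for $E: y^2+a_1xy+a_3y=x^3+a_2x^2+a_4x+a_6$ and $P_i=(x_i,y_i)$ with $P_1,P_2,P_2\pm P_1\ne\mathcal{O}$, the $\Psi_n(\mathbf{P})$ are the specializations at $(E,\mathbf{P})$ of the universal expressions determined by $\Psi_{ -1}=x_1-x_2$, $\Psi_0=\Psi_1=1$, $\Psi_2=2x_1+x_2-\left(\frac{y_2-y_1}{x_2-x_1}\right)^2-a_1\frac{y_2-y_1}{x_2-x_1}+a_2$ and $\Psi_{m+2}\Psi_{m-2}=\beta_1^2\Psi_{m+1}\Psi_{m-1}-\beta_2\Psi_m^2$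 ($m\in\mathbb{Z}$), $\beta_1=2y_1+a_1x_1+a_3$, $\beta_2=3x_1^4+b_2x_1^3+3b_4x_1^2+3b_6x_1+b_8$ ($b_i$ the usual Weierstrass quantities); with $a_i,x_i,y_i$ generic these lie in $\mathbb{Z}[a_1,a_2,a_3,a_4,a_6][x_1,y_1,x_2,y_2][(x_1-x_2)^{ -1}]$ modulo the two Weierstrass equations. Reduction. $Q\in E(\mathbb{Q})$ is nonsingular modulo $p$ if it reduces to a nonsingular point of the reduced cubic over $\mathbb{F}_p$; its order modulo $p$ is its order in the group of nonsingular points; $Q\equiv\mathcal{O}\pmod p$ means that it reduces to $\mathcal{O}$. -}

module Defs where

open import Level using (Level; 0ℓ; _⊔_)
open import Algebra.Bundles using (RawRing; CommutativeRing)
open import Algebra.Apartness.Bundles using (HeytingCommutativeRing; HeytingField)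
open import Data.Empty using (⊥-elim)
open import Data.Unit.Polymorphic using (⊤; tt)
open import Data.Nat as ℕ using (ℕ; zero; suc)
import Data.Nat.Properties as ℕ
import Data.Nat.Divisibility as ℕ
open import Data.Nat.Primality using (Prime; euclidsLemma; prime⇒nonZero; prime⇒nonTrivial)
open import Data.Integer as ℤ using (ℤ; +_; 0ℤ; 1ℤ; -1ℤ; ∣_∣)
import Data.Integer.Properties as ℤ
import Data.Integer.Divisibility as ℤ
import Data.Integer.Divisibility.Signed as ℤₛ
import Data.Integer.GCD as ℤ
open import Data.Rational as ℚ using (ℚ; mkℚ; 0ℚ; 1ℚ; ↥_; ↧_; ↧ₙ_; NonZero)
import Data.Rational.Properties as ℚ
open import Data.Rational.Solver using (module +-*-Solver)
open import Data.Product using (∃-syntax; _×_; _,_; proj₁; proj₂)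
open import Data.Sum using (_⊎_; inj₁; inj₂)
open import Relation.Nullary.Decidable using (map′)
open import Relation.Nullary using (¬_; Dec; yes; no; ¬?; _×-dec_)
open import Relation.Binary using (Decidable; DecSetoid)
import Relation.Binary.Properties.DecSetoid as DecSetoidProperties
open import Relation.Binary.PropositionalEquality as ≡ using (_≡_; _≢_; refl; sym; trans; cong; subst)
import Algebra.Definitions.RawSemiring as RawSemiringDefinitions

private
  variable
    a c ℓ ℓ₁ ℓ₂ : Level

------------------------------------------------------------------------
-- Weierstrass equations

-- y² + a₁xy + a₃y = x³ + a₂x² + a₄x + a₆
record Weierstrass (A : Set a) : Set a where
  constructor weierstrass
  field
    a₁ a₂ a₃ a₄ a₆ : A

-- Points of the projective plane on a Weierstrass cubic: the point at infinity
-- or an affine point.  Lying on the cubic is the separate predicate OnCurve.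
data Point (A : Set a) : Set a where
  𝒪     : Point A
  ⟨_,_⟩ : A → A → Point A

module WeierstrassPolynomials (R : RawRing c ℓ) (E : Weierstrass (RawRing.Carrier R)) where

  open RawRing R
  open RawSemiringDefinitions rawSemiring using (_^_) renaming (_×_ to _·_)
  open Weierstrass E

  infixl 6 _-_
  _-_ : Carrier → Carrier → Carrier
  x - y = x + (- y)

  b₂ b₄ b₆ b₈ Δ : Carrier
  b₂ = a₁ ^ 2 + 4 · a₂
  b₄ = 2 · a₄ + a₁ * a₃
  b₆ = a₃ ^ 2 + 4 · a₆
  b₈ = a₁ ^ 2 * a₆ + 4 · (a₂ * a₆) - a₁ * a₃ * a₄ + a₂ * a₃ ^ 2 - a₄ ^ 2
  Δ  = 9 · (b₂ * b₄ * b₆) - b₂ ^ 2 * b₈ - 8 · (b₄ ^ 3) - 27 · (b₆ ^ 2)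

  lhs rhs : Carrier → Carrier → Carrier
  lhs x y = y ^ 2 + a₁ * x * y + a₃ * y
  rhs x y = x ^ 3 + a₂ * x ^ 2 + a₄ * x + a₆

  ∂x ∂y : Carrier → Carrier → Carrier
  ∂x x y = a₁ * y - (3 · (x ^ 2) + 2 · (a₂ * x) + a₄)
  ∂y x y = 2 · y + a₁ * x + a₃

  OnCurve : Point Carrier → Set ℓ
  OnCurve 𝒪         = ⊤
  OnCurve ⟨ x , y ⟩ = lhs x y ≈ rhs x y

  Nonsingular : Point Carrier → Set ℓ
  Nonsingular 𝒪         = ⊤
  Nonsingular ⟨ x , y ⟩ = ¬ (∂x x y ≈ 0# × ∂y x y ≈ 0#)

  β₁ β₂ : Carrier → Carrier → Carrier
  β₁ x y = 2 · y + a₁ * x + a₃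
  β₂ x y = 3 · (x ^ 4) + b₂ * x ^ 3 + 3 · (b₄ * x ^ 2) + 3 · (b₆ * x) + b₈

------------------------------------------------------------------------
-- The chord-tangent law over a field with decidable apartness

fieldRawRing : HeytingField c ℓ₁ ℓ₂ → RawRing c ℓ₁
fieldRawRing K = CommutativeRing.rawRing
  (HeytingCommutativeRing.commutativeRing (HeytingField.heytingCommutativeRing K))

module GroupLaw (K : HeytingField c ℓ₁ ℓ₂) (_#?_ : Decidable (HeytingField._#_ K)) where

  open HeytingField K using (Carrier; _≈_; _+_; _*_; -_; _-_; 0#; 1#; #⇒invertible)
  open RawSemiringDefinitions (RawRing.rawSemiring (fieldRawRing K)) using (_^_) renaming (_×_ to _·_)

  infix  8 _⁻¹
  infixl 7 _/_

  -- Total inverse, with 0⁻¹ = 0.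
  _⁻¹ : Carrier → Carrier
  x ⁻¹ with x #? 0#
  ... | yes x#0 = proj₁ (#⇒invertible x#0)
  ... | no  _   = 0#

  _/_ : Carrier → Carrier → Carrier
  x / y = x * y ⁻¹

  module _ (E : Weierstrass Carrier) where

    open Weierstrass E

    neg : Point Carrier → Point Carrier
    neg 𝒪         = 𝒪
    neg ⟨ x , y ⟩ = ⟨ x , - y - a₁ * x - a₃ ⟩

    -- Third intersection with the line of slope λ′ through (x₁ , y₁) and a
    -- point with abscissa x₂, reflected by neg.
    third : (λ′ x₁ y₁ x₂ : Carrier) → Point Carrier
    third λ′ x₁ y₁ x₂ = neg ⟨ x₃ , λ′ * (x₃ - x₁) + y₁ ⟩
      where
      x₃ = λ′ ^ 2 + a₁ * λ′ - a₂ - x₁ - x₂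

    -- This is the group law on the nonsingular points of E; the formulas are
    -- given on all pairs of coordinates, but are only meant to be used there.
    add : Point Carrier → Point Carrier → Point Carrier
    add 𝒪           Q           = Q
    add P           𝒪           = P
    add ⟨ x₁ , y₁ ⟩ ⟨ x₂ , y₂ ⟩ with x₁ #? x₂ | (y₁ + y₂ + a₁ * x₂ + a₃) #? 0#
    ... | yes _ | _     = third ((y₂ - y₁) / (x₂ - x₁)) x₁ y₁ x₂
    ... | no  _ | no  _ = 𝒪
    ... | no  _ | yes _ =
      third ((3 · (x₁ ^ 2) + 2 · (a₂ * x₁) + a₄ - a₁ * y₁) / (2 · y₁ + a₁ * x₁ + a₃)) x₁ y₁ x₂

    multiple : ℕ → Point Carrier → Point Carrier
    multiple zero    P = 𝒪
    multiple (suc n) P = add P (multiple n P)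

    HasOrder : Point Carrier → ℕ → Set _
    HasOrder P r = r ℕ.> 0 × multiple r P ≡ 𝒪 ×
                   (∀ k → 0 ℕ.< k → k ℕ.< r → multiple k P ≢ 𝒪)

------------------------------------------------------------------------
-- The universal ring ℤ[a₁,a₂,a₃,a₄,a₆][x₁,y₁,x₂,y₂][(x₁-x₂)⁻¹] modulo the two
-- Weierstrass equations, presented by generators and relations

data Generator : Set where
  A₁ A₂ A₃ A₄ A₆ X₁ Y₁ X₂ Y₂ [X₁-X₂]⁻¹ : Generator

module Universal where

  infixl 7 _*_
  infixl 6 _+_
  infix  8 -_
  infix  4 _≈_

  data Expr : Set where
    gen     : Generator → Expr
    0# 1#   : Expr
    _+_ _*_ : Expr → Expr → Expr
    -_      : Expr → Expr

  E : Weierstrass Expr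
  E = weierstrass (gen A₁) (gen A₂) (gen A₃) (gen A₄) (gen A₆)

  x₁ y₁ x₂ y₂ [x₁-x₂]⁻¹ : Expr
  x₁        = gen X₁
  y₁        = gen Y₁
  x₂        = gen X₂
  y₂        = gen Y₂
  [x₁-x₂]⁻¹ = gen [X₁-X₂]⁻¹

  syntacticRing : RawRing 0ℓ 0ℓ
  syntacticRing = record
    { Carrier = Expr ; _≈_ = _≡_ ; _+_ = _+_ ; _*_ = _*_ ; -_ = -_ ; 0# = 0# ; 1# = 1# }

  open WeierstrassPolynomials syntacticRing E using (lhs; rhs; β₁; β₂; _-_) public
  open RawSemiringDefinitions (RawRing.rawSemiring syntacticRing) using (_^_) renaming (_×_ to _·_) public

  data _≈_ : Expr → Expr → Set where
    ≈-refl      : ∀ {x} → x ≈ x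
    ≈-sym       : ∀ {x y} → x ≈ y → y ≈ x
    ≈-trans     : ∀ {x y z} → x ≈ y → y ≈ z → x ≈ z
    +-cong      : ∀ {x y u v} → x ≈ y → u ≈ v → x + u ≈ y + v
    *-cong      : ∀ {x y u v} → x ≈ y → u ≈ v → x * u ≈ y * v
    -‿cong      : ∀ {x y} → x ≈ y → - x ≈ - y
    +-assoc     : ∀ x y z → (x + y) + z ≈ x + (y + z)
    +-comm      : ∀ x y → x + y ≈ y + x
    +-identityˡ : ∀ x → 0# + x ≈ x
    -‿inverseˡ  : ∀ x → - x + x ≈ 0#
    *-assoc     : ∀ x y z → (x * y) * z ≈ x * (y * z)
    *-comm      : ∀ x y → x * y ≈ y * x
    *-identityˡ : ∀ x → 1# * x ≈ x
    distribʳ    : ∀ x y z → (y + z) * x ≈ y * x + z * x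
    equation₁   : lhs x₁ y₁ ≈ rhs x₁ y₁
    equation₂   : lhs x₂ y₂ ≈ rhs x₂ y₂
    inverse     : (x₁ - x₂) * [x₁-x₂]⁻¹ ≈ 1#

  commutativeRing : CommutativeRing 0ℓ 0ℓ
  commutativeRing = record
    { Carrier = Expr ; _≈_ = _≈_ ; _+_ = _+_ ; _*_ = _*_ ; -_ = -_ ; 0# = 0# ; 1# = 1#
    ; isCommutativeRing = record
      { isRing = record
        { +-isAbelianGroup = record
          { isGroup = record
            { isMonoid = record
              { isSemigroup = record
                { isMagma = record { isEquivalence = isEquivalence ; ∙-cong = +-cong }
                ; assoc = +-assoc }
              ; identity = +-identityˡ , λ x → ≈-trans (+-comm x 0#) (+-identityˡ x) }
            ; inverse = -‿inverseˡ , λ x → ≈-trans (+-comm x (- x)) (-‿inverseˡ x)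
            ; ⁻¹-cong = -‿cong }
          ; comm = +-comm }
        ; *-cong = *-cong
        ; *-assoc = *-assoc
        ; *-identity = *-identityˡ , λ x → ≈-trans (*-comm x 1#) (*-identityˡ x)
        ; distrib = distribˡ , distribʳ }
      ; *-comm = *-comm } }
    where
    isEquivalence = record { refl = ≈-refl ; sym = ≈-sym ; trans = ≈-trans }
    distribˡ : ∀ x y z → x * (y + z) ≈ x * y + x * z
    distribˡ x y z = ≈-trans (*-comm x (y + z))
      (≈-trans (distribʳ x y z) (+-cong (*-comm y x) (*-comm z x)))

-- The universal translated division polynomials Ψₘ, m ∈ ℤ.  The universal ring
-- is a domain and no Ψₘ vanishes in it, so the sequence is determined up to ≈;
-- it is Stange's elliptic net n ↦ W(n , 1).
record IsTranslatedDivision (Ψ : ℤ → Universal.Expr) : Set where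
  open Universal
  slope : Expr
  slope = (y₁ - y₂) * [x₁-x₂]⁻¹
  field
    Ψ₋₁        : Ψ -1ℤ ≈ x₁ - x₂
    Ψ₀         : Ψ 0ℤ ≈ 1#
    Ψ₁         : Ψ 1ℤ ≈ 1#
    Ψ₂         : Ψ (+ 2) ≈ 2 · x₁ + x₂ - slope ^ 2 - gen A₁ * slope + gen A₂
    recurrence : ∀ m → Ψ (m ℤ.+ + 2) * Ψ (m ℤ.- + 2) ≈
                       β₁ x₁ y₁ ^ 2 * (Ψ (m ℤ.+ + 1) * Ψ (m ℤ.- + 1)) - β₂ x₁ y₁ * Ψ m ^ 2

module _ (R : RawRing c ℓ) where

  open RawRing R

  evaluate : (Generator → Carrier) → Universal.Expr → Carrier
  evaluate ρ (Universal.gen g) = ρ g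
  evaluate ρ Universal.0#      = 0#
  evaluate ρ Universal.1#      = 1#
  evaluate ρ (s Universal.+ t) = evaluate ρ s + evaluate ρ t
  evaluate ρ (s Universal.* t) = evaluate ρ s * evaluate ρ t
  evaluate ρ (Universal.- t)   = - evaluate ρ t

  assignment : Weierstrass Carrier → (x₁ y₁ x₂ y₂ i : Carrier) → Generator → Carrier
  assignment E x₁ y₁ x₂ y₂ i = λ where
      A₁        → a₁
      A₂        → a₂
      A₃        → a₃
      A₄        → a₄
      A₆        → a₆
      X₁        → x₁
      Y₁        → y₁
      X₂        → x₂
      Y₂        → y₂
      [X₁-X₂]⁻¹ → i
    where open Weierstrass E

module _ (R : CommutativeRing c ℓ) where

  open CommutativeRing R
  open WeierstrassPolynomials rawRing using (OnCurve)

  evaluate-cong : ∀ E {x₁ y₁ x₂ y₂ i} →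
                  OnCurve E ⟨ x₁ , y₁ ⟩ → OnCurve E ⟨ x₂ , y₂ ⟩ → (x₁ - x₂) * i ≈ 1# →
                  ∀ {s t} → s Universal.≈ t →
                  evaluate rawRing (assignment rawRing E x₁ y₁ x₂ y₂ i) s ≈
                  evaluate rawRing (assignment rawRing E x₁ y₁ x₂ y₂ i) t
  evaluate-cong E {x₁} {y₁} {x₂} {y₂} {i} e₁ e₂ inv = go
    where
    ⟦_⟧ = evaluate rawRing (assignment rawRing E x₁ y₁ x₂ y₂ i)
    go : ∀ {s t} → s Universal.≈ t → ⟦ s ⟧ ≈ ⟦ t ⟧
    go Universal.≈-refl            = CommutativeRing.refl R
    go (Universal.≈-sym p)         = CommutativeRing.sym R (go p)
    go (Universal.≈-trans p q)     = CommutativeRing.trans R (go p) (go q)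
    go (Universal.+-cong p q)      = +-cong (go p) (go q)
    go (Universal.*-cong p q)      = *-cong (go p) (go q)
    go (Universal.-‿cong p)        = -‿cong (go p)
    go (Universal.+-assoc x y z)   = +-assoc ⟦ x ⟧ ⟦ y ⟧ ⟦ z ⟧
    go (Universal.+-comm x y)      = +-comm ⟦ x ⟧ ⟦ y ⟧
    go (Universal.+-identityˡ x)   = +-identityˡ ⟦ x ⟧
    go (Universal.-‿inverseˡ x)    = -‿inverseˡ ⟦ x ⟧
    go (Universal.*-assoc x y z)   = *-assoc ⟦ x ⟧ ⟦ y ⟧ ⟦ z ⟧
    go (Universal.*-comm x y)      = *-comm ⟦ x ⟧ ⟦ y ⟧
    go (Universal.*-identityˡ x)   = *-identityˡ ⟦ x ⟧
    go (Universal.distribʳ x y z)  = distribʳ ⟦ x ⟧ ⟦ y ⟧ ⟦ z ⟧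
    go Universal.equation₁         = e₁
    go Universal.equation₂         = e₂
    go Universal.inverse           = inv

------------------------------------------------------------------------
-- Elliptic curves over ℚ and their Somos 4 sequences

ℚ-rawRing : RawRing 0ℓ 0ℓ
ℚ-rawRing = fieldRawRing ℚ.heytingField

open GroupLaw ℚ.heytingField (λ x y → ¬? (x ℚ.≟ y)) public
  using () renaming (_⁻¹ to _⁻¹ℚ; neg to negℚ; add to addℚ)

open WeierstrassPolynomials ℚ-rawRing public
  using () renaming (Δ to Δℚ; OnCurve to OnCurveℚ)

open RawSemiringDefinitions ℚ.+-*-rawSemiring public
  using () renaming (_^_ to _^ℚ_)

IsElliptic : Weierstrass ℚ → Set
IsElliptic E = Δℚ E ≢ 0ℚ

IsSomos4 : (W : ℕ → ℚ) (τ₁ τ₂ : ℚ) → Set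
IsSomos4 W τ₁ τ₂ = ∀ n → n ℕ.≥ 4 →
  W n ℚ.* W (n ℕ.∸ 4) ≡
    τ₁ ℚ.* W (n ℕ.∸ 1) ℚ.* W (n ℕ.∸ 3) ℚ.+ τ₂ ℚ.* (W (n ℕ.∸ 2) ^ℚ 2)

-- Meaningful when x₁ ≢ x₂; see evaluate-cong.
specialize : Weierstrass ℚ → (x₁ y₁ x₂ y₂ : ℚ) → Universal.Expr → ℚ
specialize E x₁ y₁ x₂ y₂ =
  evaluate ℚ-rawRing (assignment ℚ-rawRing E x₁ y₁ x₂ y₂ ((x₁ ℚ.- x₂) ⁻¹ℚ))

-- The model E matters: Ψₙ(P₁ , P₂) = σ(nz₁+z₂) σ(z₁)^(n-n²) σ(z₁+z₂)^(-n) σ(z₂)^(n-1)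
-- is taken with respect to the period lattice of dx/(2y+a₁x+a₃) on this equation.
record IsAssociated (Ψ : ℤ → Universal.Expr) (W : ℕ → ℚ) .{{_ : NonZero (W 0)}}
                    (E : Weierstrass ℚ) (P₁ P₂ : Point ℚ) : Set where
  field
    elliptic : IsElliptic E
    P₁∈E     : OnCurveℚ E P₁
    P₂∈E     : OnCurveℚ E P₂
    P₂+P₁≢𝒪  : addℚ E P₂ P₁ ≢ 𝒪
    P₂-P₁≢𝒪  : addℚ E P₂ (negℚ E P₁) ≢ 𝒪
    x₁ y₁ x₂ y₂ : ℚ
    P₁-affine : P₁ ≡ ⟨ x₁ , y₁ ⟩
    P₂-affine : P₂ ≡ ⟨ x₂ , y₂ ⟩
    values    : ∀ n → n ℕ.≥ 1 →
                W n ≡ ((W 1 ℚ.÷ W 0) ^ℚ n) ℚ.* W 0 ℚ.* specialize E x₁ y₁ x₂ y₂ (Ψ (+ n))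

------------------------------------------------------------------------
-- The p-adic valuation on ℚ and the residue field 𝔽ₚ = ℤ₍ₚ₎ / pℤ₍ₚ₎

-- ordₚ(x) ≥ k, where k ≥ 0 and ordₚ(0) = ∞; ↥ x / ↧ x is in lowest terms.
record Ord≥ (p k : ℕ) (x : ℚ) : Set where
  constructor _,_
  field
    pᵏ∣numerator  : p ℕ.^ k ℕ.∣ ∣ ↥ x ∣
    p∤denominator : ¬ (p ℕ.∣ ↧ₙ x)

ord≥? : ∀ p k x → Dec (Ord≥ p k x)
ord≥? p k x = map′ (λ (n , d) → n , d) (λ (n , d) → n , d)
  (((p ℕ.^ k) ℕ.∣? ∣ ↥ x ∣) ×-dec ¬? (p ℕ.∣? ↧ₙ x))

prime∤1 : ∀ {p} → Prime p → ¬ p ℕ.∣ 1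
prime∤1 {p} p-prime p∣1 = ℕ.nonTrivial⇒≢1 {{prime⇒nonTrivial p-prime}} (ℕ.∣1⇒≡1 p∣1)

-- p-integral rationals
record ℤ₍_₎ (p : ℕ) : Set where
  constructor _,_
  field
    value    : ℚ
    integral : Ord≥ p 0 value
open ℤ₍_₎ public

Ord≥-0ℚ : ∀ {p} → Prime p → ∀ k → Ord≥ p k 0ℚ
Ord≥-0ℚ {p} p-prime k = (p ℕ.^ k) ℕ.∣0 , prime∤1 p-prime

Ord≥-weaken : ∀ {p k x} → Ord≥ p k x → Ord≥ p 0 x
Ord≥-weaken {x = x} (_ , p∤↧x) = ℕ.1∣ ∣ ↥ x ∣ , p∤↧x

module _ {p : ℕ} (p-prime : Prime p) where

  private

    instance
      p≢0 : ℕ.NonZero p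
      p≢0 = prime⇒nonZero p-prime

    cancel-coprime : ∀ k {m d} → ¬ p ℕ.∣ d → p ℕ.^ k ℕ.∣ m ℕ.* d → p ℕ.^ k ℕ.∣ m
    cancel-coprime zero    p∤d _ = ℕ.1∣ _
    cancel-coprime (suc k) {m} {d} p∤d pᵏ∣md
      with euclidsLemma m d p-prime (ℕ.∣-trans (ℕ.m∣m*n (p ℕ.^ k)) pᵏ∣md)
    ... | inj₂ p∣d = ⊥-elim (p∤d p∣d)
    ... | inj₁ (ℕ.divides m′ refl) =
      subst (p ℕ.^ suc k ℕ.∣_) (ℕ.*-comm p m′)
        (ℕ.*-monoʳ-∣ p (cancel-coprime k p∤d (ℕ.*-cancelˡ-∣ p
          (subst (p ℕ.^ suc k ℕ.∣_)
            (trans (cong (ℕ._* d) (ℕ.*-comm m′ p)) (ℕ.*-assoc p m′ d)) pᵏ∣md))))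

    Ord≥-/ : ∀ k i n .{{_ : ℕ.NonZero n}} →
             p ℕ.^ k ℕ.∣ ∣ i ∣ → ¬ p ℕ.∣ n → Ord≥ p k (i ℚ./ n)
    Ord≥-/ k i n pᵏ∣i p∤n = cancel-coprime k p∤g (subst (p ℕ.^ k ℕ.∣_) eq↥ pᵏ∣i)
                          , λ p∣↧ → p∤n (subst (p ℕ.∣_) (sym eq↧) (ℕ.∣m⇒∣m*n g p∣↧))
      where
      g = ∣ ℤ.gcd i (+ n) ∣
      eq↥ : ∣ i ∣ ≡ ∣ ↥ (i ℚ./ n) ∣ ℕ.* g
      eq↥ = trans (sym (cong ∣_∣ (ℚ.↥-/ i n))) (ℤ.abs-* (↥ (i ℚ./ n)) (ℤ.gcd i (+ n)))
      eq↧ : n ≡ ↧ₙ (i ℚ./ n) ℕ.* g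
      eq↧ = trans (sym (cong ∣_∣ (ℚ.↧-/ i n))) (ℤ.abs-* (↧ (i ℚ./ n)) (ℤ.gcd i (+ n)))
      p∤g : ¬ p ℕ.∣ g
      p∤g p∣g = p∤n (subst (p ℕ.∣_) (sym eq↧) (ℕ.∣n⇒∣m*n (↧ₙ (i ℚ./ n)) p∣g))

    p∤* : ∀ {m n} → ¬ p ℕ.∣ m → ¬ p ℕ.∣ n → ¬ p ℕ.∣ m ℕ.* n
    p∤* {m} {n} p∤m p∤n p∣mn with euclidsLemma m n p-prime p∣mn
    ... | inj₁ p∣m = p∤m p∣m
    ... | inj₂ p∣n = p∤n p∣n

  Ord≥-+ : ∀ k x y → Ord≥ p k x → Ord≥ p k y → Ord≥ p k (x ℚ.+ y)
  Ord≥-+ k x@record{} y@record{} (pᵏ∣x , p∤x) (pᵏ∣y , p∤y) =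
    Ord≥-/ k (↥ x ℤ.* ↧ y ℤ.+ ↥ y ℤ.* ↧ x) (↧ₙ x ℕ.* ↧ₙ y)
      (ℤₛ.∣⇒∣ᵤ {+ (p ℕ.^ k)} (ℤₛ.∣m∣n⇒∣m+n {m = ↥ x ℤ.* ↧ y} {n = ↥ y ℤ.* ↧ x} (ℤₛ.∣ᵤ⇒∣ {+ (p ℕ.^ k)} (scale x y pᵏ∣x))
                                         (ℤₛ.∣ᵤ⇒∣ {+ (p ℕ.^ k)} (scale y x pᵏ∣y))))
      (p∤* p∤x p∤y)
    where
    scale : ∀ u v → p ℕ.^ k ℕ.∣ ∣ ↥ u ∣ → p ℕ.^ k ℕ.∣ ∣ ↥ u ℤ.* ↧ v ∣
    scale u v pᵏ∣u = subst (p ℕ.^ k ℕ.∣_) (sym (ℤ.abs-* (↥ u) (↧ v))) (ℕ.∣m⇒∣m*n (↧ₙ v) pᵏ∣u)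

  Ord≥-* : ∀ k x y → Ord≥ p k x → Ord≥ p 0 y → Ord≥ p k (x ℚ.* y)
  Ord≥-* k x@record{} y@record{} (pᵏ∣x , p∤x) (_ , p∤y) =
    Ord≥-/ k (↥ x ℤ.* ↥ y) (↧ₙ x ℕ.* ↧ₙ y)
      (subst (p ℕ.^ k ℕ.∣_) (sym (ℤ.abs-* (↥ x) (↥ y))) (ℕ.∣m⇒∣m*n ∣ ↥ y ∣ pᵏ∣x))
      (p∤* p∤x p∤y)

  Ord≥-neg : ∀ k x → Ord≥ p k x → Ord≥ p k (ℚ.- x)
  Ord≥-neg k x (pᵏ∣x , p∤x) =
      subst (p ℕ.^ k ℕ.∣_) (sym (trans (cong ∣_∣ (ℚ.↥-neg x)) (ℤ.∣-i∣≡∣i∣ (↥ x)))) pᵏ∣x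
    , λ p∣ → p∤x (subst (p ℕ.∣_) (cong ∣_∣ (ℚ.↧-neg x)) p∣)

  private

    unit-≢0 : ∀ {x} → ¬ Ord≥ p 1 x → x ≢ 0ℚ
    unit-≢0 ¬ord refl = ¬ord (Ord≥-0ℚ p-prime 1)

    Ord≥-1/ : ∀ x .{{_ : NonZero x}} → Ord≥ p 0 x → ¬ Ord≥ p 1 x → Ord≥ p 0 (ℚ.1/ x)
    Ord≥-1/ x@(mkℚ (+ suc n) d _)  (_ , p∤x) ¬ord =
      ℕ.1∣ suc d , λ p∣n → ¬ord (subst (ℕ._∣ suc n) (sym (ℕ.*-identityʳ p)) p∣n , p∤x)
    Ord≥-1/ x@(mkℚ (ℤ.-[1+ n ]) d _) (_ , p∤x) ¬ord =
      ℕ.1∣ suc d , λ p∣n → ¬ord (subst (ℕ._∣ suc n) (sym (ℕ.*-identityʳ p)) p∣n , p∤x)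

  -- 𝔽ₚ with carrier ℤ₍ₚ₎ and equality x ≡ y (mod p): the reduction map on
  -- p-integral rationals is the identity on representatives.
  module 𝔽 where

    infix 4 _≈_ _#_

    _≈_ _#_ : ℤ₍ p ₎ → ℤ₍ p ₎ → Set
    x ≈ y = Ord≥ p 1 (value x ℚ.- value y)
    x # y = ¬ (x ≈ y)

    _#?_ : Decidable _#_
    x #? y = ¬? (ord≥? p 1 (value x ℚ.- value y))

    _+_ _*_ : ℤ₍ p ₎ → ℤ₍ p ₎ → ℤ₍ p ₎
    (x , x∈) + (y , y∈) = x ℚ.+ y , Ord≥-+ 0 x y x∈ y∈
    (x , x∈) * (y , y∈) = x ℚ.* y , Ord≥-* 0 x y x∈ y∈

    -_ : ℤ₍ p ₎ → ℤ₍ p ₎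
    - (x , x∈) = ℚ.- x , Ord≥-neg 0 x x∈

    0# 1# : ℤ₍ p ₎
    0# = 0ℚ , Ord≥-0ℚ p-prime 0
    1# = 1ℚ , (ℕ.1∣ 1 , prime∤1 p-prime)

    private

      open +-*-Solver using (solve; _:=_; _:+_; _:*_; _:-_; :-_)

      reflexive : ∀ {x y} → value x ≡ value y → x ≈ y
      reflexive {x} {y} x≡y = subst (Ord≥ p 1)
        (sym (trans (cong (ℚ._- value y) x≡y) (ℚ.+-inverseʳ (value y)))) (Ord≥-0ℚ p-prime 1)

      ≈-sym : ∀ {x y} → x ≈ y → y ≈ x
      ≈-sym {x , _} {y , _} x≈y = subst (Ord≥ p 1)
        (solve 2 (λ x y → :- (x :- y) := y :- x) refl x y) (Ord≥-neg 1 _ x≈y)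

      ≈-trans : ∀ {x y z} → x ≈ y → y ≈ z → x ≈ z
      ≈-trans {x , _} {y , _} {z , _} x≈y y≈z = subst (Ord≥ p 1)
        (solve 3 (λ x y z → (x :- y) :+ (y :- z) := x :- z) refl x y z)
        (Ord≥-+ 1 _ _ x≈y y≈z)

      +-cong : ∀ {x y u v} → x ≈ y → u ≈ v → x + u ≈ y + v
      +-cong {x , _} {y , _} {u , _} {v , _} x≈y u≈v = subst (Ord≥ p 1)
        (solve 4 (λ x y u v → (x :- y) :+ (u :- v) := (x :+ u) :- (y :+ v)) refl x y u v)
        (Ord≥-+ 1 _ _ x≈y u≈v)

      *-cong : ∀ {x y u v} → x ≈ y → u ≈ v → x * u ≈ y * v
      *-cong {x , _} {y , y∈} {u , u∈} {v , _} x≈y u≈v = subst (Ord≥ p 1)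
        (solve 4 (λ x y u v → (x :- y) :* u :+ (u :- v) :* y := x :* u :- y :* v) refl x y u v)
        (Ord≥-+ 1 _ _ (Ord≥-* 1 _ u x≈y u∈) (Ord≥-* 1 _ y u≈v y∈))

      -‿cong : ∀ {x y} → x ≈ y → - x ≈ - y
      -‿cong {x , _} {y , _} x≈y = subst (Ord≥ p 1)
        (solve 2 (λ x y → :- (x :- y) := (:- x) :- (:- y)) refl x y) (Ord≥-neg 1 _ x≈y)

      decSetoid : DecSetoid 0ℓ 0ℓ
      decSetoid = record
        { isDecEquivalence = record
          { isEquivalence = record
            { refl  = λ {x} → reflexive {x} {x} refl
            ; sym   = λ {x} {y} → ≈-sym {x} {y}
            ; trans = λ {x} {y} {z} → ≈-trans {x} {y} {z} }
          ; _≟_ = λ x y → ord≥? p 1 (value x ℚ.- value y) } }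

      1≉0 : ¬ (1# ≈ 0#)
      1≉0 (p∣1 , _) = prime∤1 p-prime (subst (ℕ._∣ 1) (ℕ.*-identityʳ p) p∣1)

      #⇒invertible : ∀ {x y} → x # y →
        ∃[ z ] (z * (x + (- y)) ≈ 1#) × ((x + (- y)) * z ≈ 1#)
      #⇒invertible {x} {y} x#y = z
        , reflexive {z * d} {1#} (ℚ.*-inverseˡ (value d))
        , reflexive {d * z} {1#} (ℚ.*-inverseʳ (value d))
        where
        d = x + (- y)
        instance _ = ℚ.≢-nonZero (unit-≢0 x#y)
        z = ℚ.1/ value d , Ord≥-1/ (value d) (integral d) x#y

      invertible⇒# : ∀ {x y} →
        (∃[ z ] (z * (x + (- y)) ≈ 1#) × ((x + (- y)) * z ≈ 1#)) → x # y
      invertible⇒# {x} {y} (z , _ , dz≈1) x≈y = 1≉0 (≈-trans {1#} {d * z} {0#}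
        (≈-sym {d * z} {1#} dz≈1)
        (≈-trans {d * z} {0# * z} {0#}
          (*-cong {d} {0#} {z} {z} d≈0 (reflexive {z} {z} refl))
          (reflexive {0# * z} {0#} (ℚ.*-zeroˡ (value z)))))
        where
        d = x + (- y)
        d≈0 : d ≈ 0#
        d≈0 = subst (Ord≥ p 1) (sym (ℚ.+-identityʳ (value d))) x≈y

    heytingField : HeytingField 0ℓ 0ℓ 0ℓ
    heytingField = record
      { Carrier = ℤ₍ p ₎ ; _≈_ = _≈_ ; _#_ = _#_ ; _+_ = _+_ ; _*_ = _*_ ; -_ = -_
      ; 0# = 0# ; 1# = 1#
      ; isHeytingField = record
        { isHeytingCommutativeRing = record
          { isCommutativeRing = record
            { isRing = record
              { +-isAbelianGroup = record
                { isGroup = record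
                  { isMonoid = record
                    { isSemigroup = record
                      { isMagma = record
                        { isEquivalence = DecSetoid.isEquivalence decSetoid
                        ; ∙-cong = λ {x} {y} {u} {v} → +-cong {x} {y} {u} {v} }
                      ; assoc = λ x y z → reflexive {(x + y) + z} {x + (y + z)}
                          (ℚ.+-assoc (value x) (value y) (value z)) }
                    ; identity =
                        (λ x → reflexive {0# + x} {x} (ℚ.+-identityˡ (value x)))
                      , (λ x → reflexive {x + 0#} {x} (ℚ.+-identityʳ (value x))) }
                  ; inverse =
                      (λ x → reflexive {(- x) + x} {0#} (ℚ.+-inverseˡ (value x)))
                    , (λ x → reflexive {x + (- x)} {0#} (ℚ.+-inverseʳ (value x)))
                  ; ⁻¹-cong = λ {x} {y} → -‿cong {x} {y} }
                ; comm = λ x y → reflexive {x + y} {y + x} (ℚ.+-comm (value x) (value y)) }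
              ; *-cong = λ {x} {y} {u} {v} → *-cong {x} {y} {u} {v}
              ; *-assoc = λ x y z → reflexive {(x * y) * z} {x * (y * z)}
                  (ℚ.*-assoc (value x) (value y) (value z))
              ; *-identity =
                  (λ x → reflexive {1# * x} {x} (ℚ.*-identityˡ (value x)))
                , (λ x → reflexive {x * 1#} {x} (ℚ.*-identityʳ (value x)))
              ; distrib =
                  (λ x y z → reflexive {x * (y + z)} {(x * y) + (x * z)}
                    (ℚ.*-distribˡ-+ (value x) (value y) (value z)))
                , (λ x y z → reflexive {(y + z) * x} {(y * x) + (z * x)}
                    (ℚ.*-distribʳ-+ (value x) (value y) (value z))) }
            ; *-comm = λ x y → reflexive {x * y} {y * x} (ℚ.*-comm (value x) (value y)) }
          ; isApartnessRelation = ≉-isApartnessRelation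
          ; #⇒invertible = λ {x} {y} → #⇒invertible {x} {y}
          ; invertible⇒# = λ {x} {y} → invertible⇒# {x} {y} }
        ; tight = ≉-tight } }
      where open DecSetoidProperties decSetoid

------------------------------------------------------------------------
-- Reduction modulo p

record IntegralCoefficients (p : ℕ) (E : Weierstrass ℚ) : Set where
  open Weierstrass E
  field
    a₁∈ : Ord≥ p 0 a₁
    a₂∈ : Ord≥ p 0 a₂
    a₃∈ : Ord≥ p 0 a₃
    a₄∈ : Ord≥ p 0 a₄
    a₆∈ : Ord≥ p 0 a₆

module Reduction {p : ℕ} (p-prime : Prime p)
                 (E : Weierstrass ℚ) (integral-E : IntegralCoefficients p E) where

  open Weierstrass E
  open IntegralCoefficients integral-E

  Ẽ : Weierstrass ℤ₍ p ₎
  Ẽ = weierstrass (a₁ , a₁∈) (a₂ , a₂∈) (a₃ , a₃∈) (a₄ , a₄∈) (a₆ , a₆∈)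

  -- For a point ⟨ x , y ⟩ of E, if x or y is not p-integral then neither is,
  -- ordₚ(y) < ordₚ(x) < 0, and (x : y : 1) reduces to (0 : 1 : 0) = 𝒪.
  reduce : Point ℚ → Point ℤ₍ p ₎
  reduce 𝒪         = 𝒪
  reduce ⟨ x , y ⟩ with ord≥? p 0 x | ord≥? p 0 y
  ... | yes x∈ | yes y∈ = ⟨ (x , x∈) , (y , y∈) ⟩
  ... | _      | _      = 𝒪

  NonsingularMod : Point ℚ → Set
  NonsingularMod Q =
    WeierstrassPolynomials.Nonsingular (fieldRawRing (𝔽.heytingField p-prime)) Ẽ (reduce Q)

  NonzeroMod : Point ℚ → Set
  NonzeroMod Q = reduce Q ≢ 𝒪

  HasOrderMod : Point ℚ → ℕ → Set
  HasOrderMod Q = GroupLaw.HasOrder (𝔽.heytingField p-prime) (𝔽._#?_ p-prime) Ẽ (reduce Q)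

------------------------------------------------------------------------
-- p-adic integers

-- ℤₚ = lim ℤ/pᵏ: residue k represents the class modulo pᵏ.
record ℤₚ (p : ℕ) : Set where
  field
    residue  : ℕ → ℤ
    coherent : ∀ k → + (p ℕ.^ k) ℤ.∣ residue (suc k) ℤ.- residue k
open ℤₚ public

-- w converges p-adically to ℓ: for every k, ordₚ(w(i) - ℓ) ≥ k for all large i,
-- where ℓ may be replaced by residue ℓ k since they agree modulo pᵏ.
Converges : (p : ℕ) → (ℕ → ℚ) → ℤₚ p → Set
Converges p w ℓ = ∀ k → ∃[ i₀ ] ∀ i → i ℕ.≥ i₀ → Ord≥ p k (w i ℚ.- residue ℓ k ℚ./ 1)

{-# OPTIONS --safe #-}
-- On an integral model with x₁ - x₂ a p-unit, all Ψₘ specialize to p-integers, and β₂ is a p-unit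
-- because 3 P₁ ≢ 𝒪.  The Somos 4 recurrence alone cannot be continued past a zero modulo p, but it
-- implies a Somos 5 recurrence with the same β₂ and a p-integral second coefficient; together they
-- can, since β₂ ∈ ℤ₍ₚ₎ˣ excludes adjacent zeros.  (To divide by Ψₘ in the derivation, the curve and
-- the points are first moved p-adically little to ones where every Ψₘ is a 2-adic unit.)
--
-- So windows of length 5 modulo p are determined by their predecessors and are eventually periodic.
-- If T is a period modulo pᵏ, the quotients δ n = (Ψ (n + T) - Ψ n) / pᵏ satisfy the linearised
-- recurrences modulo p, so that the windows of (Ψ , δ) are periodic as well; by pigeonhole a single
-- T₀ serves all k, and T₀ pᵏ is a period modulo pᵏ⁺¹.  If q = pᴺ with T₀ ∣ pᵃ (q - 1), then
-- m qⁱ⁺¹ - m qⁱ is a multiple of T₀ pᵏ for large i.  The factor αⁿ is absorbed into the Somos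
-- sequence if α is a p-unit, and tends to 0 otherwise.

module Submission where

open import Defs
open import Level using (0ℓ)
open import Algebra.Apartness.Bundles using (HeytingField)
open import Algebra.Bundles using (RawRing; CommutativeRing)
import Algebra.Definitions.RawSemiring
import Algebra.Solver.Ring
import Algebra.Solver.Ring.AlmostCommutativeRing as ACR
open import Algebra.Structures using (IsCommutativeRing)
open import Data.Empty using (⊥; ⊥-elim; ⊥-elim-irr)
open import Data.Fin using (Fin; toℕ; fromℕ<; combine; funToFin; finToFun; #_)
import Data.Fin.Properties as Fin
open import Data.Integer as ℤ using (ℤ; +_; -[1+_]; 0ℤ; 1ℤ; -1ℤ)
import Data.Integer.DivMod as ℤ
import Data.Integer.Divisibility.Signed as Signed
open import Data.Integer.GCD using (gcd)
import Data.Integer.Properties as ℤ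
open import Data.Nat as ℕ using (ℕ; zero; suc; _!)
import Data.Nat.Coprimality as Coprimality
import Data.Nat.DivMod as ℕ
import Data.Nat.Divisibility as ℕ
import Data.Nat.GCD as GCD
open import Data.Nat.Primality
  using (Prime; prime[2]; prime⇒nonZero; prime⇒nonTrivial; prime⇒irreducible; euclidsLemma)
import Data.Nat.Properties as ℕ
import Data.Nat.Solver
open import Data.Product using (∃-syntax; _×_; _,_; proj₁; proj₂)
open import Data.Rational as ℚ using (ℚ; mkℚ; 0ℚ; 1ℚ; ↥_; ↧_; ↧ₙ_)
import Data.Rational.Properties as ℚ
import Data.Rational.Unnormalised as ℚᵘ
import Data.Rational.Unnormalised.Properties as ℚᵘ
open import Data.Sum using (_⊎_; inj₁; inj₂)
open import Relation.Binary using (Decidable)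
open import Relation.Binary.PropositionalEquality
  using (_≡_; _≢_; refl; sym; trans; cong; cong₂; subst; subst₂; module ≡-Reasoning)
open import Relation.Nullary using (¬_; Dec; yes; no; ¬?)
open import Relation.Nullary.Decidable using (dec⇒maybe)

-- The given points may satisfy m P₁ + P₂ = 𝒪 for some m, so division by Ψₘ can fail at the
-- specialization itself, while arguing in the universal ring would require showing that it is a
-- domain. Solving the two Weierstrass equations for a₄ and a₆ leaves the other coefficients and
-- coordinates free, so they can be approximated independently at p and at 2, which differ because p
-- is odd. An integral example with all Ψₘ² = 1 is the target at 2. The Somos 5 identity then holds
-- at specializations arbitrarily close to the given one and passes to the limit.
--
-- A single T₀ serves all k because the pigeonhole bound counts pairs of windows over 𝔽ₚ: δ changes
-- with k, but the number of such pairs depends on p alone, and T₀ is the factorial of that number.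
-- Along steps of length T the quotient δ is constant modulo p, so each further power of p costs
-- exactly one factor p in the period.

-- Cases of the chord-tangent law

module GroupLawProperties {c ℓ₁ ℓ₂} (K : HeytingField c ℓ₁ ℓ₂) (_#?_ : Decidable (HeytingField._#_ K)) where

  open HeytingField K using (Carrier; _≈_; _#_; _+_; _*_; -_; _-_; 0#; 1#; #⇒invertible; #-irrefl)
  open GroupLaw K _#?_ public
  import Algebra.Definitions.RawSemiring
  open Algebra.Definitions.RawSemiring (RawRing.rawSemiring (fieldRawRing K)) using (_^_) renaming (_×_ to _·_)

  -- The first factor is `x - 0#` because `#⇒invertible` inverts the difference of two apart
  -- elements.
  inverseʳ : ∀ {x} → x # 0# → (x - 0#) * x ⁻¹ ≈ 1#
  inverseʳ {x} x#0 with x #? 0#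
  ... | yes x#0′ = proj₂ (proj₂ (#⇒invertible x#0′))
  ... | no ¬x#0  = ⊥-elim (¬x#0 x#0)

  module _ (E : Weierstrass Carrier) where

    open Weierstrass E

    x-third : (s x₁ x₂ : Carrier) → Carrier
    x-third s x₁ x₂ = s ^ 2 + a₁ * s - a₂ - x₁ - x₂

    y-third : (s x₁ y₁ x₂ : Carrier) → Carrier
    y-third s x₁ y₁ x₂ = - (s * (x-third s x₁ x₂ - x₁) + y₁) - a₁ * x-third s x₁ x₂ - a₃

    tangent : (x y : Carrier) → Carrier
    tangent x y = (3 · (x ^ 2) + 2 · (a₂ * x) + a₄ - a₁ * y) / (2 · y + a₁ * x + a₃)

    add-opposite : ∀ {x₁ y₁ x₂ y₂} → x₁ ≈ x₂ → (y₁ + y₂ + a₁ * x₂ + a₃) ≈ 0# →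
                   add E ⟨ x₁ , y₁ ⟩ ⟨ x₂ , y₂ ⟩ ≡ 𝒪
    add-opposite {x₁} {y₁} {x₂} {y₂} x≈ s≈0 with x₁ #? x₂ | (y₁ + y₂ + a₁ * x₂ + a₃) #? 0#
    ... | yes x# | _      = ⊥-elim (#-irrefl x≈ x#)
    ... | no _   | yes s# = ⊥-elim (#-irrefl s≈0 s#)
    ... | no _   | no _   = refl

    add-chord : ∀ {x₁ y₁ x₂ y₂} → x₁ # x₂ → let s = (y₂ - y₁) / (x₂ - x₁) in
                add E ⟨ x₁ , y₁ ⟩ ⟨ x₂ , y₂ ⟩ ≡ ⟨ x-third s x₁ x₂ , y-third s x₁ y₁ x₂ ⟩
    add-chord {x₁} {y₁} {x₂} {y₂} x# with x₁ #? x₂ | (y₁ + y₂ + a₁ * x₂ + a₃) #? 0#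
    ... | yes _ | _ = refl
    ... | no ¬x# | _ = ⊥-elim (¬x# x#)

    double-tangent : ∀ {x y} → x ≈ x → (y + y + a₁ * x + a₃) # 0# → let s = tangent x y in
                     add E ⟨ x , y ⟩ ⟨ x , y ⟩ ≡ ⟨ x-third s x x , y-third s x y x ⟩
    double-tangent {x} {y} x≈ s# with x #? x | (y + y + a₁ * x + a₃) #? 0#
    ... | yes x# | _      = ⊥-elim (#-irrefl x≈ x#)
    ... | no _   | yes _  = refl
    ... | no _   | no ¬s# = ⊥-elim (¬s# s#)

-- Over a raw ring, so that one formula can be read in ℚ, in the residue field and in the syntax of
-- the ring solver.
module TangentNumerator (R : RawRing 0ℓ 0ℓ) (E : Weierstrass (RawRing.Carrier R)) where
  open RawRing R
  open WeierstrassPolynomials R E using (_-_)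
  open Weierstrass E
  import Algebra.Definitions.RawSemiring
  open Algebra.Definitions.RawSemiring rawSemiring using (_^_) renaming (_×_ to _·_)

  numerator : Carrier → Carrier → Carrier
  numerator x y = 3 · (x ^ 2) + 2 · (a₂ * x) + a₄ - a₁ * y

-- Sealed arithmetic of rationals

module SomosConvergence where

  infixl 7 _*_
  infixl 6 _+_ _-_
  infix  8 -_

  -- The operations of ℚ, sealed so that unification does not unfold them to
  -- normalised fractions.
  opaque
    _+_ _*_ : ℚ → ℚ → ℚ
    _+_ = ℚ._+_
    _*_ = ℚ._*_

    -_ : ℚ → ℚ
    -_ = ℚ.-_

    +-*-isCommutativeRing : IsCommutativeRing _≡_ _+_ _*_ -_ 0ℚ 1ℚ
    +-*-isCommutativeRing = ℚ.+-*-isCommutativeRing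

  _-_ : ℚ → ℚ → ℚ
  x - y = x + (- y)

  +-*-commutativeRing : CommutativeRing 0ℓ 0ℓ
  +-*-commutativeRing = record { isCommutativeRing = +-*-isCommutativeRing }

  open CommutativeRing +-*-commutativeRing
    using (rawRing; +-identityˡ; -‿inverseʳ; *-comm; *-assoc; *-identityˡ; *-identityʳ; zeroʳ)

  opaque
    unfolding _+_

    +-unseal : ∀ x y → x ℚ.+ y ≡ x + y
    +-unseal _ _ = refl

    *-unseal : ∀ x y → x ℚ.* y ≡ x * y
    *-unseal _ _ = refl

    neg-unseal : ∀ x → ℚ.- x ≡ - x
    neg-unseal _ = refl

  infixr 8 _^_
  _^_ : ℚ → ℕ → ℚ
  x ^ zero  = 1ℚ
  x ^ suc n = x * x ^ n

  ^-unseal : ∀ x n → x ^ℚ n ≡ x ^ n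
  ^-unseal x zero    = refl
  ^-unseal x (suc n) = trans (*-unseal x (x ^ℚ n)) (cong (x *_) (^-unseal x n))

  private
    -- The identity map as coefficient homomorphism: the solver computes constants with the
    -- transparent operations, while the identities it proves mention only the sealed ones.
    unseal : ℚ.+-*-rawRing ACR.-Raw-AlmostCommutative⟶ ACR.fromCommutativeRing +-*-commutativeRing
    unseal = record
      { ⟦_⟧ = λ x → x ; +-homo = +-unseal ; *-homo = *-unseal ; -‿homo = neg-unseal
      ; 0-homo = refl ; 1-homo = refl }

  open Algebra.Solver.Ring ℚ.+-*-rawRing (ACR.fromCommutativeRing +-*-commutativeRing) unseal
    (λ x y → dec⇒maybe (x ℚ.≟ y))
    using (Polynomial; solve; _:=_; _:+_; _:*_; _:-_; :-_; con) public

  private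
    -- `z / 1` does not reduce for a variable `z`; this form has visible numerator and denominator.
    integer : ℤ → ℚ
    integer z = mkℚ z 0 (Coprimality.sym (Coprimality.1-coprimeTo ℤ.∣ z ∣))

  opaque
    unfolding _+_

    ι : ℤ → ℚ
    ι z = z ℚ./ 1

    ι-/1 : ∀ z → ι z ≡ z ℚ./ 1
    ι-/1 z = refl

    ι-0 : ι 0ℤ ≡ 0ℚ
    ι-0 = refl

    ι-1 : ι 1ℤ ≡ 1ℚ
    ι-1 = refl

    ι-integer : ∀ z → ι z ≡ integer z
    ι-integer z = ℚ.↥p/↧p≡p (integer z)

    ↥-ι : ∀ z → ↥ (ι z) ≡ z
    ↥-ι z = cong ↥_ (ι-integer z)

    ↧-ι : ∀ z → ↧ₙ (ι z) ≡ 1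
    ↧-ι z = cong ↧ₙ_ (ι-integer z)

    ι-+ : ∀ x y → ι (x ℤ.+ y) ≡ ι x + ι y
    ι-+ x y = sym (trans (cong₂ _+_ (ι-integer x) (ι-integer y))
      (cong₂ (λ u v → ι (u ℤ.+ v)) (ℤ.*-identityʳ x) (ℤ.*-identityʳ y)))

    ι-* : ∀ x y → ι (x ℤ.* y) ≡ ι x * ι y
    ι-* x y = sym (cong₂ _*_ (ι-integer x) (ι-integer y))

    ι-neg : ∀ x → ι (ℤ.- x) ≡ - ι x
    ι-neg x = trans (ι-integer (ℤ.- x)) (sym (trans (cong -_ (ι-integer x)) (lemma x)))
      where
      lemma : ∀ x → - integer x ≡ integer (ℤ.- x)
      lemma (+ zero)   = refl
      lemma ℤ.+[1+ n ] = refl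
      lemma -[1+ n ]   = refl

    ι-- : ∀ x y → ι (x ℤ.- y) ≡ ι x - ι y
    ι-- x y = trans (ι-+ x (ℤ.- y)) (cong (λ z → ι x + z) (ι-neg y))

    /-* : ∀ s d .{{_ : ℕ.NonZero d}} → (s ℚ./ d) * ι (+ d) ≡ ι s
    /-* s d@(suc d-1) = trans (cong (λ z → (s ℚ./ d) * z) (ι-integer (+ d))) (trans
      (ℚ.toℚᵘ-injective (ℚᵘ.≃-trans (ℚ.toℚᵘ-homo-* (s ℚ./ d) (integer (+ d))) (ℚᵘ.≃-trans
        (ℚᵘ.*-congʳ {ℚᵘ.mkℚᵘ (+ d) 0} (ℚ.toℚᵘ-fromℚᵘ (ℚᵘ.mkℚᵘ s d-1)))
        (ℚᵘ.*≡* (trans (ℤ.*-identityʳ (s ℤ.* (+ d))) (cong (λ m → s ℤ.* (+ m)) (sym (ℕ.*-identityʳ d))))))))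
      (sym (ι-integer s)))

    -- Reduction to lowest terms only shrinks the denominator, so one prime to p stays prime to p;
    -- `ord-quotient` relies on this.
    fraction : ∀ s d .{{_ : ℕ.NonZero d}} → ∃[ z ] z * ι (+ d) ≡ ι s × ↧ₙ z ℕ.∣ d
    fraction s d = s ℚ./ d , /-* s d , ℕ.divides ℤ.∣ gcd s (+ d) ∣
      (trans (sym (cong ℤ.∣_∣ (ℚ.↧-/ s d)))
        (trans (ℤ.abs-* (↧ (s ℚ./ d)) (gcd s (+ d))) (ℕ.*-comm (↧ₙ (s ℚ./ d)) ℤ.∣ gcd s (+ d) ∣)))

  ι-*ℕ : ∀ m n → ι (+ (m ℕ.* n)) ≡ ι (+ m) * ι (+ n)
  ι-*ℕ m n = trans (cong ι (ℤ.pos-* m n)) (ι-* (+ m) (+ n))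

  ι-1+* : ∀ m n → ι (+ (1 ℕ.+ m ℕ.* n)) ≡ 1ℚ + ι (+ m) * ι (+ n)
  ι-1+* m n = trans (ι-+ 1ℤ (+ (m ℕ.* n))) (cong₂ _+_ ι-1 (ι-*ℕ m n))

  *-↧ : ∀ x → x * ι (↧ x) ≡ ι (↥ x)
  *-↧ x = trans (cong (_* ι (↧ x)) (sym (ℚ.↥p/↧p≡p x))) (/-* (↥ x) (↧ₙ x))

  ι-≢0 : ∀ {z} → z ≢ 0ℤ → ι z ≢ 0ℚ
  ι-≢0 {z} z≢0 ιz≡0 = z≢0 (trans (sym (↥-ι z)) (cong ↥_ ιz≡0))

  *-cancelˡ : ∀ u {x y} → u ≢ 0ℚ → u * x ≡ u * y → x ≡ y
  *-cancelˡ u {x} {y} u≢0 ux≡uy =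
    trans (sym (unit x)) (trans (cong ((ℚ.1/ u) *_) ux≡uy) (unit y))
    where
    instance _ = ℚ.≢-nonZero u≢0
    unit : ∀ z → (ℚ.1/ u) * (u * z) ≡ z
    unit z = trans (sym (*-assoc (ℚ.1/ u) u z))
      (trans (cong (_* z) (trans (sym (*-unseal (ℚ.1/ u) u)) (ℚ.*-inverseˡ u))) (*-identityˡ z))

  -- Meant for p-integral x and y, although only x - y is required to be p-integral.
  infix 4 _≡_[mod_^_]
  _≡_[mod_^_] : ℚ → ℚ → ℕ → ℕ → Set
  x ≡ y [mod p ^ k ] = Ord≥ p k (x - y)

  n<m^n : ∀ {m} → 1 ℕ.< m → ∀ n → n ℕ.< m ℕ.^ n
  n<m^n 1<m zero    = ℕ.≤-refl
  n<m^n {m} 1<m (suc n) = ℕ.≤-trans (ℕ.s≤s (n<m^n 1<m n)) (ℕ.^-monoʳ-< m 1<m (ℕ.n<1+n n))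

  -- Rationals that are integral at p

  module Local {p : ℕ} (p-prime : Prime p) where

    instance
      p≢0 : ℕ.NonZero p
      p≢0 = prime⇒nonZero p-prime

    1<p : 1 ℕ.< p
    1<p = ℕ.nonTrivial⇒n>1 p {{prime⇒nonTrivial p-prime}}

    π : ℕ → ℚ
    π k = ι (+ (p ℕ.^ k))

    ι-ord : ∀ {k z} → p ℕ.^ k ℕ.∣ ℤ.∣ z ∣ → Ord≥ p k (ι z)
    ι-ord {k} {z} d =
        subst (λ w → p ℕ.^ k ℕ.∣ ℤ.∣ w ∣) (sym (↥-ι z)) d
      , λ p∣ → prime∤1 p-prime (subst (p ℕ.∣_) (↧-ι z) p∣)

    ord-ι : ∀ {k z} → Ord≥ p k (ι z) → p ℕ.^ k ℕ.∣ ℤ.∣ z ∣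
    ord-ι {k} {z} (d , _) = subst (λ w → p ℕ.^ k ℕ.∣ ℤ.∣ w ∣) (↥-ι z) d

    ι-integral : ∀ z → Ord≥ p 0 (ι z)
    ι-integral z = ι-ord {0} {z} (ℕ.1∣ _)

    π-ord : ∀ k → Ord≥ p k (π k)
    π-ord k = ι-ord {k} ℕ.∣-refl

    0-ord : ∀ k → Ord≥ p k 0ℚ
    0-ord = Ord≥-0ℚ p-prime

    1-integral : Ord≥ p 0 1ℚ
    1-integral = subst (Ord≥ p 0) ι-1 (ι-integral 1ℤ)

    ord-≤ : ∀ {j k x} → j ℕ.≤ k → Ord≥ p k x → Ord≥ p j x
    ord-≤ {j} {k} j≤k (d , i) = ℕ.∣-trans pʲ∣pᵏ d , i
      where
      pʲ∣pᵏ : p ℕ.^ j ℕ.∣ p ℕ.^ k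
      pʲ∣pᵏ = subst (p ℕ.^ j ℕ.∣_)
        (trans (sym (ℕ.^-distribˡ-+-* p j (k ℕ.∸ j))) (cong (p ℕ.^_) (ℕ.m+[n∸m]≡n j≤k))) (ℕ.m∣m*n _)

    ord⇒integral : ∀ {k x} → Ord≥ p k x → Ord≥ p 0 x
    ord⇒integral = Ord≥-weaken

    ord-+ : ∀ {k x y} → Ord≥ p k x → Ord≥ p k y → Ord≥ p k (x + y)
    ord-+ {k} {x} {y} ox oy = subst (Ord≥ p k) (+-unseal x y) (Ord≥-+ p-prime k x y ox oy)

    ord-neg : ∀ {k x} → Ord≥ p k x → Ord≥ p k (- x)
    ord-neg {k} {x} ox = subst (Ord≥ p k) (neg-unseal x) (Ord≥-neg p-prime k x ox)

    ord-- : ∀ {k x y} → Ord≥ p k x → Ord≥ p k y → Ord≥ p k (x - y)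
    ord-- ox oy = ord-+ ox (ord-neg oy)

    ord-*ʳ : ∀ {k x y} → Ord≥ p k x → Ord≥ p 0 y → Ord≥ p k (x * y)
    ord-*ʳ {k} {x} {y} ox oy = subst (Ord≥ p k) (*-unseal x y) (Ord≥-* p-prime k x y ox oy)

    ord-*ˡ : ∀ {k x y} → Ord≥ p 0 x → Ord≥ p k y → Ord≥ p k (x * y)
    ord-*ˡ {k} {x} {y} ox oy = subst (Ord≥ p k) (*-comm y x) (ord-*ʳ oy ox)

    ord-^ : ∀ {x} → Ord≥ p 0 x → ∀ n → Ord≥ p 0 (x ^ n)
    ord-^ ox zero    = 1-integral
    ord-^ ox (suc n) = ord-*ʳ ox (ord-^ ox n)

    π≢0 : ∀ k → π k ≢ 0ℚ
    π≢0 k = ι-≢0 λ eq → ℕ.≢-nonZero⁻¹ (p ℕ.^ k) {{ℕ.m^n≢0 p k}} (ℤ.+-injective eq)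

    π-suc : ∀ k → π (suc k) ≡ ι (+ p) * π k
    π-suc k = ι-*ℕ p (p ℕ.^ k)

    ord-quotient : ∀ {k x} → Ord≥ p k x → ∃[ z ] Ord≥ p 0 z × x ≡ π k * z
    ord-quotient {k} {x} (pᵏ∣ , p∤d) with Signed.∣ᵤ⇒∣ {+ (p ℕ.^ k)} pᵏ∣
    ... | Signed.divides s ↥x≡ with fraction s (↧ₙ x)
    ... | z , z*d≡s , ↧z∣d = z , (ℕ.1∣ _ , λ p∣↧z → p∤d (ℕ.∣-trans p∣↧z ↧z∣d))
                           , *-cancelˡ (ι (↧ x)) (ι-≢0 λ ()) (begin
        ι (↧ x) * x            ≡⟨ trans (*-comm (ι (↧ x)) x) (*-↧ x) ⟩
        ι (↥ x)                ≡⟨ trans (cong ι ↥x≡) (ι-* s (+ (p ℕ.^ k))) ⟩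
        ι s * π k              ≡⟨ cong (_* π k) z*d≡s ⟨
        z * ι (↧ x) * π k      ≡⟨ rearrange z (ι (↧ x)) (π k) ⟩
        ι (↧ x) * (π k * z)    ∎)
      where
      open ≡-Reasoning
      rearrange : ∀ z d π → z * d * π ≡ d * (π * z)
      rearrange = solve 3 (λ z d π → z :* d :* π := d :* (π :* z)) refl

    π-+ : ∀ k j → π (k ℕ.+ j) ≡ π k * π j
    π-+ k j = trans (cong (λ n → ι (+ n)) (ℕ.^-distribˡ-+-* p k j)) (ι-*ℕ (p ℕ.^ k) (p ℕ.^ j))

    ord-π* : ∀ {j k z} → Ord≥ p j z → Ord≥ p (k ℕ.+ j) (π k * z)
    ord-π* {j} {k} {z} oz =
      let w , ow , z≡ = ord-quotient oz in
      subst (Ord≥ p (k ℕ.+ j))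
        (trans (cong (_* w) (π-+ k j)) (trans (*-assoc (π k) (π j) w) (cong (λ t → π k * t) (sym z≡))))
        (ord-*ʳ (π-ord (k ℕ.+ j)) ow)

    private
      module 𝔽ₚ = HeytingField (𝔽.heytingField p-prime)

    opaque
      unfolding _+_

      unit-inverse : ∀ {x} → Ord≥ p 0 x → ¬ Ord≥ p 1 x →
                     ∃[ z ] Ord≥ p 0 z × Ord≥ p 1 (z * x - 1ℚ)
      unit-inverse {x} ox ¬ox
        with (z , oz) , zx≈1 , _ ← 𝔽ₚ.#⇒invertible {x , ox} {0ℚ , 0-ord 0}
               (λ x≈0 → ¬ox (subst (Ord≥ p 1) (ℚ.+-identityʳ x) x≈0))
        = z , oz , subst (λ t → Ord≥ p 1 (z ℚ.* t ℚ.- 1ℚ)) (ℚ.+-identityʳ x) zx≈1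

    unit-cancelˡ : ∀ {u x} → Ord≥ p 0 u → ¬ Ord≥ p 1 u → Ord≥ p 0 x → Ord≥ p 1 (u * x) → Ord≥ p 1 x
    unit-cancelˡ {u} {x} ou ¬ou ox oux =
      let z , oz , e = unit-inverse ou ¬ou in
      subst (Ord≥ p 1) (cancel u x z) (ord-- (ord-*ˡ oz oux) (ord-*ʳ e ox))
      where
      cancel : ∀ u x z → z * (u * x) - (z * u - 1ℚ) * x ≡ x
      cancel = solve 3 (λ u x z → z :* (u :* x) :- (z :* u :- con 1ℚ) :* x := x) refl

    unit-* : ∀ {x y} → Ord≥ p 0 x → ¬ Ord≥ p 1 x → Ord≥ p 0 y → ¬ Ord≥ p 1 y → ¬ Ord≥ p 1 (x * y)
    unit-* ox ¬ox oy ¬oy oxy = ¬oy (unit-cancelˡ ox ¬ox oy oxy)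

    1-unit : ¬ Ord≥ p 1 1ℚ
    1-unit (p∣1 , _) = prime∤1 p-prime (subst (ℕ._∣ 1) (ℕ.*-identityʳ p) p∣1)

    -- Clearing the denominator of z gives `x * ι (↥ z) ≡ ι (↧ z)`. If p divided the denominator it
    -- would divide the numerator as well, x being a unit, against lowest terms.
    reciprocal-integral : ∀ {x z} → Ord≥ p 0 x → ¬ Ord≥ p 1 x → x * z ≡ 1ℚ → Ord≥ p 0 z
    reciprocal-integral {x} {z} ox ¬ox xz≡1 = ℕ.1∣ _ , λ p∣↧z → coprime {z} (p∣↥z p∣↧z) p∣↧z
      where
      coprime : ∀ {z} → p ℕ.∣ ℤ.∣ ↥ z ∣ → ¬ p ℕ.∣ ↧ₙ z
      coprime {mkℚ _ _ c} p∣n p∣d = ⊥-elim-irr (ℕ.nonTrivial⇒≢1 {{prime⇒nonTrivial p-prime}} (c (p∣n , p∣d)))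
      p¹∣ : ∀ {n} → p ℕ.∣ n → p ℕ.^ 1 ℕ.∣ n
      p¹∣ = subst (ℕ._∣ _) (sym (ℕ.*-identityʳ p))
      p∣↥z : p ℕ.∣ ↧ₙ z → p ℕ.∣ ℤ.∣ ↥ z ∣
      p∣↥z p∣d = subst (ℕ._∣ _) (ℕ.*-identityʳ p) (ord-ι {1} (unit-cancelˡ ox ¬ox (ι-integral (↥ z))
        (subst (Ord≥ p 1) (begin
          ι (↧ z)            ≡⟨ *-identityˡ _ ⟨
          1ℚ * ι (↧ z)       ≡⟨ cong (_* ι (↧ z)) xz≡1 ⟨
          x * z * ι (↧ z)    ≡⟨ *-assoc x z _ ⟩
          x * (z * ι (↧ z))  ≡⟨ cong (λ w → x * w) (*-↧ z) ⟩
          x * ι (↥ z)        ∎)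
          (ι-ord {1} {↧ z} (p¹∣ p∣d)))))
        where open ≡-Reasoning

    -- A nonzero numerator of absolute value n is not divisible by pⁿ > n.
    ord-∞ : ∀ {x} → (∀ k → Ord≥ p k x) → x ≡ 0ℚ
    ord-∞ {x} ox with ℤ.∣ ↥ x ∣ ℕ.≟ 0
    ... | yes eq = ℚ.↥p≡0⇒p≡0 x (ℤ.∣i∣≡0⇒i≡0 eq)
    ... | no neq = ⊥-elim (ℕ.<⇒≱ (n<m^n 1<p n)
      (ℕ.∣⇒≤ {{ℕ.≢-nonZero neq}} (Ord≥.pᵏ∣numerator (ox n))))
      where n = ℤ.∣ ↥ x ∣

    ord-step : ∀ {x} → Ord≥ p 1 x → ∀ {k y} → Ord≥ p k y → Ord≥ p (suc k) (x * y)
    ord-step {x} ox {k} {y} oy =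
      let z , oz , x≡ = ord-quotient ox in
      subst (Ord≥ p (suc k)) (trans (rearrange (π 1) y z) (cong (_* y) (sym x≡)))
        (ord-π* {k} {1} (ord-*ʳ oy oz))
      where
      rearrange : ∀ π y z → π * (y * z) ≡ π * z * y
      rearrange = solve 3 (λ π y z → π :* (y :* z) := π :* z :* y) refl

    -- From one inverse w of d modulo p, the powers of the error 1 - dw give
    -- inverses modulo pᵏ.
    inverse-mod : ∀ {d} → ¬ p ℕ.∣ d → ∀ k → ∃[ w ] Ord≥ p k (1ℚ - ι (+ d) * ι w)
    inverse-mod {d} p∤d k = go k
      where
      D = ι (+ d)
      mod-p : ∃[ w ] Ord≥ p 1 (1ℚ - D * ι w)
      mod-p with Coprimality.coprime-Bézout {d} {p} coprime
        where
        coprime : Coprimality.Coprime d p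
        coprime (i∣d , i∣p) with prime⇒irreducible p-prime i∣p
        ... | inj₁ i≡1 = i≡1
        ... | inj₂ refl = ⊥-elim (p∤d i∣d)
      ... | GCD.Bézout.+- x y eq = + x , subst (Ord≥ p 1) lemma (ord-neg (ord-*ˡ (ι-integral (+ y)) (π-ord 1)))
        where
        open ≡-Reasoning
        lemma : - (ι (+ y) * π 1) ≡ 1ℚ - D * ι (+ x)
        lemma = begin
          - (ι (+ y) * π 1)               ≡⟨ solve 1 (λ t → :- t := con 1ℚ :- (con 1ℚ :+ t)) refl
            (ι (+ y) * π 1) ⟩
          1ℚ - (1ℚ + ι (+ y) * π 1)       ≡⟨ cong (λ n → 1ℚ - (1ℚ + ι (+ y) * ι (+ n))) (ℕ.*-identityʳ p) ⟩
          1ℚ - (1ℚ + ι (+ y) * ι (+ p))   ≡⟨ cong (λ t → 1ℚ - t) (ι-1+* y p) ⟨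
          1ℚ - ι (+ (1 ℕ.+ y ℕ.* p))      ≡⟨ cong (λ n → 1ℚ - ι (+ n)) (trans eq (ℕ.*-comm x d)) ⟩
          1ℚ - ι (+ (d ℕ.* x))            ≡⟨ cong (λ t → 1ℚ - t) (ι-*ℕ d x) ⟩
          1ℚ - D * ι (+ x)                ∎
      ... | GCD.Bézout.-+ x y eq = ℤ.- (+ x) , subst (Ord≥ p 1) lemma (ord-*ˡ (ι-integral (+ y)) (π-ord 1))
        where
        open ≡-Reasoning
        lemma : ι (+ y) * π 1 ≡ 1ℚ - D * ι (ℤ.- (+ x))
        lemma = begin
          ι (+ y) * π 1                ≡⟨ cong (λ n → ι (+ y) * ι (+ n)) (ℕ.*-identityʳ p) ⟩
          ι (+ y) * ι (+ p)            ≡⟨ ι-*ℕ y p ⟨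
          ι (+ (y ℕ.* p))              ≡⟨ cong (λ n → ι (+ n)) eq ⟨
          ι (+ (1 ℕ.+ x ℕ.* d))        ≡⟨ ι-1+* x d ⟩
          1ℚ + ι (+ x) * D             ≡⟨ solve 2 (λ x d → con 1ℚ :+ x :* d := con 1ℚ :- d :* (:- x)) refl
            (ι (+ x)) D ⟩
          1ℚ - D * - ι (+ x)           ≡⟨ cong (λ t → 1ℚ - D * t) (ι-neg (+ x)) ⟨
          1ℚ - D * ι (ℤ.- (+ x))       ∎
      go : ∀ k → ∃[ w ] Ord≥ p k (1ℚ - D * ι w)
      go zero = 0ℤ , ord-- 1-integral (ord-*ʳ (ι-integral (+ d)) (ι-integral 0ℤ))
      go (suc k) with mod-p | go k
      ... | w , ow | v , ov = w ℤ.+ v ℤ.- (+ d) ℤ.* (w ℤ.* v) ,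
        subst (Ord≥ p (suc k)) (sym lemma) (ord-step ow ov)
        where
        lemma : 1ℚ - D * ι (w ℤ.+ v ℤ.- (+ d) ℤ.* (w ℤ.* v)) ≡ (1ℚ - D * ι w) * (1ℚ - D * ι v)
        lemma = trans
          (cong (λ t → 1ℚ - D * t) (trans (ι-- (w ℤ.+ v) ((+ d) ℤ.* (w ℤ.* v)))
            (cong₂ _-_ (ι-+ w v) (trans (ι-* (+ d) (w ℤ.* v)) (cong (λ t → D * t) (ι-* w v))))))
          (solve 3 (λ d w v → con 1ℚ :- d :* (w :+ v :- d :* (w :* v)) :=
            (con 1ℚ :- d :* w) :* (con 1ℚ :- d :* v))
            refl D (ι w) (ι v))

    -- Division by the denominator is replaced by multiplication with an inverse of it modulo pᵏ.
    approximate : ∀ {x} → Ord≥ p 0 x → ∀ k → ∃[ z ] x ≡ ι z [mod p ^ k ]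
    approximate {x} ox k with inverse-mod (Ord≥.p∤denominator ox) k
    ... | w , ow = ↥ x ℤ.* w , subst (Ord≥ p k) lemma (ord-*ˡ ox ow)
      where
      lemma : x * (1ℚ - ι (↧ x) * ι w) ≡ x - ι (↥ x ℤ.* w)
      lemma = trans
        (solve 3 (λ x d w → x :* (con 1ℚ :- d :* w) := x :- x :* d :* w) refl x (ι (↧ x)) (ι w))
        (cong (λ t → x - t) (trans (cong (_* ι w) (*-↧ x)) (sym (ι-* (↥ x) w))))

  -- Congruences between values of universal expressions

  module U = Universal

  Valuation : Set
  Valuation = Generator → ℚ

  ev : Valuation → U.Expr → ℚ
  ev = evaluate rawRing

  module _ {p : ℕ} (p-prime : Prime p) where
    open Local p-prime

    ≡-refl : ∀ {k x} → x ≡ x [mod p ^ k ]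
    ≡-refl {k} {x} = subst (Ord≥ p k) (sym (-‿inverseʳ x)) (0-ord k)

    ≡-sym : ∀ {k x y} → x ≡ y [mod p ^ k ] → y ≡ x [mod p ^ k ]
    ≡-sym {k} {x} {y} e = subst (Ord≥ p k) (eq x y) (ord-neg e)
      where
      eq : ∀ x y → - (x - y) ≡ y - x
      eq = solve 2 (λ x y → :- (x :- y) := y :- x) refl

    ≡-trans : ∀ {k x y z} → x ≡ y [mod p ^ k ] → y ≡ z [mod p ^ k ] → x ≡ z [mod p ^ k ]
    ≡-trans {k} {x} {y} {z} e f = subst (Ord≥ p k) (eq x y z) (ord-+ e f)
      where
      eq : ∀ x y z → (x - y) + (y - z) ≡ x - z
      eq = solve 3 (λ x y z → (x :- y) :+ (y :- z) := x :- z) refl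

    ≡-+ : ∀ {k x x′ y y′} → x ≡ x′ [mod p ^ k ] → y ≡ y′ [mod p ^ k ] → x + y ≡ x′ + y′ [mod p ^ k ]
    ≡-+ {k} {x} {x′} {y} {y′} e f = subst (Ord≥ p k) (eq x x′ y y′) (ord-+ e f)
      where
      eq : ∀ x x′ y y′ → (x - x′) + (y - y′) ≡ (x + y) - (x′ + y′)
      eq = solve 4 (λ x x′ y y′ → (x :- x′) :+ (y :- y′) := (x :+ y) :- (x′ :+ y′)) refl

    ≡-neg : ∀ {k x x′} → x ≡ x′ [mod p ^ k ] → - x ≡ - x′ [mod p ^ k ]
    ≡-neg {k} {x} {x′} e = subst (Ord≥ p k) (eq x x′) (ord-neg e)
      where
      eq : ∀ x x′ → - (x - x′) ≡ - x - - x′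
      eq = solve 2 (λ x x′ → :- (x :- x′) := :- x :- :- x′) refl

    ≡-- : ∀ {k x x′ y y′} → x ≡ x′ [mod p ^ k ] → y ≡ y′ [mod p ^ k ] → x - y ≡ x′ - y′ [mod p ^ k ]
    ≡-- e f = ≡-+ e (≡-neg f)

    ≡-* : ∀ {k x x′ y y′} → Ord≥ p 0 x → Ord≥ p 0 y′ →
          x ≡ x′ [mod p ^ k ] → y ≡ y′ [mod p ^ k ] → x * y ≡ x′ * y′ [mod p ^ k ]
    ≡-* {k} {x} {x′} {y} {y′} ox oy′ e f = subst (Ord≥ p k) (eq x x′ y y′) (ord-+ (ord-*ˡ ox f) (ord-*ʳ e oy′))
      where
      eq : ∀ x x′ y y′ → x * (y - y′) + (x - x′) * y′ ≡ x * y - x′ * y′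
      eq = solve 4 (λ x x′ y y′ → x :* (y :- y′) :+ (x :- x′) :* y′ := x :* y :- x′ :* y′) refl

    ≡-integral : ∀ {k x y} → Ord≥ p 0 y → x ≡ y [mod p ^ k ] → Ord≥ p 0 x
    ≡-integral {k} {x} {y} oy e = subst (Ord≥ p 0) (eq x y) (ord-+ (ord⇒integral e) oy)
      where
      eq : ∀ x y → (x - y) + y ≡ x
      eq = solve 2 (λ x y → (x :- y) :+ y := x) refl

    ≡-ord : ∀ {k x y} → x ≡ y [mod p ^ k ] → Ord≥ p k y → Ord≥ p k x
    ≡-ord {k} {x} {y} e oy = subst (Ord≥ p k) (eq x y) (ord-+ e oy)
      where
      eq : ∀ x y → (x - y) + y ≡ x
      eq = solve 2 (λ x y → (x :- y) :+ y := x) refl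

    ev-integral : ∀ {ρ} → (∀ g → Ord≥ p 0 (ρ g)) → ∀ s → Ord≥ p 0 (ev ρ s)
    ev-integral oρ (U.gen g) = oρ g
    ev-integral oρ U.0#      = 0-ord 0
    ev-integral oρ U.1#      = 1-integral
    ev-integral oρ (s U.+ t) = ord-+ (ev-integral oρ s) (ev-integral oρ t)
    ev-integral oρ (s U.* t) = ord-*ʳ (ev-integral oρ s) (ev-integral oρ t)
    ev-integral oρ (U.- s)   = ord-neg (ev-integral oρ s)

    ev-≡ : ∀ {k ρ ρ′} → (∀ g → Ord≥ p 0 (ρ g)) → (∀ g → Ord≥ p 0 (ρ′ g)) →
           (∀ g → ρ g ≡ ρ′ g [mod p ^ k ]) → ∀ s → ev ρ s ≡ ev ρ′ s [mod p ^ k ]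
    ev-≡ oρ oρ′ e (U.gen g) = e g
    ev-≡ oρ oρ′ e U.0#      = ≡-refl
    ev-≡ oρ oρ′ e U.1#      = ≡-refl
    ev-≡ oρ oρ′ e (s U.+ t) = ≡-+ (ev-≡ oρ oρ′ e s) (ev-≡ oρ oρ′ e t)
    ev-≡ oρ oρ′ e (s U.* t) =
      ≡-* (ev-integral oρ s) (ev-integral oρ′ t) (ev-≡ oρ oρ′ e s) (ev-≡ oρ oρ′ e t)
    ev-≡ oρ oρ′ e (U.- s)   = ≡-neg (ev-≡ oρ oρ′ e s)

    -- Because i - i′ = i i′ (u′ - u).
    reciprocal-≡ : ∀ {k u u′ i i′} → Ord≥ p 0 i → Ord≥ p 0 i′ → u * i ≡ 1ℚ → u′ * i′ ≡ 1ℚ →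
                   u ≡ u′ [mod p ^ k ] → i ≡ i′ [mod p ^ k ]
    reciprocal-≡ {k} {u} {u′} {i} {i′} oi oi′ ui u′i′ e = subst (Ord≥ p k) (begin
        i * (i′ * - (u - u′))                   ≡⟨ eq u u′ i i′ ⟩
        i * (u′ * i′) - i′ * (u * i)            ≡⟨ cong₂ (λ s t → i * s - i′ * t) u′i′ ui ⟩
        i * 1ℚ - i′ * 1ℚ                        ≡⟨ cong₂ _-_ (*-identityʳ i) (*-identityʳ i′) ⟩
        i - i′                                  ∎)
      (ord-*ˡ oi (ord-*ˡ oi′ (ord-neg e)))
      where
      open ≡-Reasoning
      eq : ∀ u u′ i i′ → i * (i′ * - (u - u′)) ≡ i * (u′ * i′) - i′ * (u * i)
      eq = solve 4 (λ u u′ i i′ → i :* (i′ :* :- (u :- u′)) := i :* (u′ :* i′) :- i′ :* (u :* i)) refl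

    -- x′ - z = c (x - z), where c ≡ 1 modulo pᵏ and c clears the denominator of x - z and is even.
    opaque
      weak-approximation : p ≢ 2 → ∀ {x} → Ord≥ p 0 x → ∀ z k →
        ∃[ x′ ] x′ ≡ x [mod p ^ k ] × x′ ≡ ι z [mod 2 ^ 1 ]
      weak-approximation p≢2 {x} ox z k =
        let w , ow = inverse-mod p∤2d k
            c = ι (+ (2 ℕ.* d)) * ι w in
        ι z + c * u
        , subst (Ord≥ p k) (eq₁ (ι z) c x) (ord-neg (ord-*ˡ ou ow))
        , subst (Ord≥ 2 1) (begin
            ι (+ 2) * ι (w ℤ.* ↥ u)                ≡⟨ cong (λ t → ι (+ 2) * t)
              (trans (ι-* w (↥ u)) (cong (λ t → ι w * t) (sym (*-↧ u)))) ⟩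
            ι (+ 2) * (ι w * (u * ι (↧ u)))        ≡⟨ eq₂ (ι z) (ι (+ 2)) (ι (↧ u)) (ι w) u ⟩
            ι z + ι (+ 2) * ι (↧ u) * ι w * u - ι z  ≡⟨ cong (λ t → ι z + t * ι w * u - ι z) (ι-*ℕ 2 d) ⟨
            ι z + c * u - ι z                      ∎)
            (Local.ord-*ʳ prime[2] (Local.ι-ord prime[2] {1} {+ 2} ℕ.∣-refl)
              (Local.ι-integral prime[2] (w ℤ.* ↥ u)))
        where
        open ≡-Reasoning
        u : ℚ
        u = x - ι z
        ou : Ord≥ p 0 u
        ou = ord-- ox (ι-integral z)
        d : ℕ
        d = ↧ₙ u
        p∤2d : ¬ p ℕ.∣ 2 ℕ.* d
        p∤2d p∣2d with euclidsLemma 2 d p-prime p∣2d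
        ... | inj₁ p∣2 = p≢2 (ℕ.≤-antisym (ℕ.∣⇒≤ p∣2) 1<p)
        ... | inj₂ p∣d = Ord≥.p∤denominator ou p∣d
        eq₁ : ∀ z c x → - ((x - z) * (1ℚ - c)) ≡ z + c * (x - z) - x
        eq₁ = solve 3 (λ z c x → :- ((x :- z) :* (con 1ℚ :- c)) := z :+ c :* (x :- z) :- x) refl
        eq₂ : ∀ z t d w u → t * (w * (u * d)) ≡ z + t * d * w * u - z
        eq₂ = solve 5 (λ z t d w u → t :* (w :* (u :* d)) := z :+ t :* d :* w :* u :- z) refl

  -- Somos sequences

  -- With A = β₁² and B = β₂ this is the recurrence of the Ψₘ; the sign is such that the same B
  -- appears in the Somos 5 relation.
  IsSomos₄ : (A B : ℚ) → (ℕ → ℚ) → Set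
  IsSomos₄ A B g = ∀ n → g (4 ℕ.+ n) * g n ≡ A * (g (3 ℕ.+ n) * g (1 ℕ.+ n)) - B * (g (2 ℕ.+ n) * g (2 ℕ.+ n))

  IsSomos₅ : (B J : ℚ) → (ℕ → ℚ) → Set
  IsSomos₅ B J g = ∀ n → g (5 ℕ.+ n) * g n ≡ B * (g (4 ℕ.+ n) * g (1 ℕ.+ n)) + J * (g (3 ℕ.+ n) * g (2 ℕ.+ n))

  -- With X n = g (5 + n) g n - B g (4 + n) g (1 + n), two instances of the Somos 4
  -- relation give X n g (4 + n) = X (1 + n) g (2 + n), so X n / (g (3 + n) g (2 + n))
  -- is constant.
  somos₄⇒somos₅ : ∀ {A B J g} → IsSomos₄ A B g → (∀ n → g n ≢ 0ℚ) →
                  g 5 * g 0 ≡ B * (g 4 * g 1) + J * (g 3 * g 2) → IsSomos₅ B J g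
  somos₄⇒somos₅ _ _ e zero = e
  somos₄⇒somos₅ {A} {B} {J} {g} s₄ g≢0 e (suc n) = *-cancelˡ (g (2 ℕ.+ n)) (g≢0 (2 ℕ.+ n)) (begin
    g₂ * (g₆ * g₁)                                                    ≡⟨ eq₁ g₁ g₂ g₆ ⟩
    g₁ * (g₆ * g₂)                                                    ≡⟨ cong (g₁ *_) (s₄ (2 ℕ.+ n)) ⟩
    g₁ * (A * (g₅ * g₃) - B * (g₄ * g₄))                              ≡⟨ eq₂ A B g₁ g₂ g₃ g₄ g₅ ⟩
    g₅ * (A * (g₃ * g₁) - B * (g₂ * g₂)) - B * (g₄ * g₁) * g₄ + B * (g₅ * g₂) * g₂
      ≡⟨ cong (λ t → g₅ * t - B * (g₄ * g₁) * g₄ + B * (g₅ * g₂) * g₂) (s₄ n) ⟨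
    g₅ * (g₄ * g₀) - B * (g₄ * g₁) * g₄ + B * (g₅ * g₂) * g₂          ≡⟨ eq₃ B g₀ g₁ g₂ g₄ g₅ ⟩
    (g₅ * g₀) * g₄ - B * (g₄ * g₁) * g₄ + B * (g₅ * g₂) * g₂
      ≡⟨ cong (λ t → t * g₄ - B * (g₄ * g₁) * g₄ + B * (g₅ * g₂) * g₂)
        (somos₄⇒somos₅ {A} {B} {J} {g} s₄ g≢0 e n) ⟩
    (B * (g₄ * g₁) + J * (g₃ * g₂)) * g₄ - B * (g₄ * g₁) * g₄ + B * (g₅ * g₂) * g₂
      ≡⟨ eq₄ B J g₁ g₂ g₃ g₄ g₅ ⟩
    g₂ * (B * (g₅ * g₂) + J * (g₄ * g₃))                              ∎)
    where
    open ≡-Reasoning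
    g₀ = g n
    g₁ = g (1 ℕ.+ n)
    g₂ = g (2 ℕ.+ n)
    g₃ = g (3 ℕ.+ n)
    g₄ = g (4 ℕ.+ n)
    g₅ = g (5 ℕ.+ n)
    g₆ = g (6 ℕ.+ n)
    eq₁ : ∀ x y z → y * (z * x) ≡ x * (z * y)
    eq₁ = solve 3 (λ x y z → y :* (z :* x) := x :* (z :* y)) refl
    eq₂ : ∀ A B g₁ g₂ g₃ g₄ g₅ → g₁ * (A * (g₅ * g₃) - B * (g₄ * g₄)) ≡
          g₅ * (A * (g₃ * g₁) - B * (g₂ * g₂)) - B * (g₄ * g₁) * g₄ + B * (g₅ * g₂) * g₂
    eq₂ = solve 7 (λ A B g₁ g₂ g₃ g₄ g₅ → g₁ :* (A :* (g₅ :* g₃) :- B :* (g₄ :* g₄)) :=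
          g₅ :* (A :* (g₃ :* g₁) :- B :* (g₂ :* g₂)) :- B :* (g₄ :* g₁) :* g₄ :+ B :* (g₅ :* g₂) :* g₂) refl
    eq₃ : ∀ B g₀ g₁ g₂ g₄ g₅ → g₅ * (g₄ * g₀) - B * (g₄ * g₁) * g₄ + B * (g₅ * g₂) * g₂ ≡
          (g₅ * g₀) * g₄ - B * (g₄ * g₁) * g₄ + B * (g₅ * g₂) * g₂
    eq₃ = solve 6 (λ B g₀ g₁ g₂ g₄ g₅ → g₅ :* (g₄ :* g₀) :- B :* (g₄ :* g₁) :* g₄ :+ B :* (g₅ :* g₂) :* g₂ :=
          (g₅ :* g₀) :* g₄ :- B :* (g₄ :* g₁) :* g₄ :+ B :* (g₅ :* g₂) :* g₂) refl
    eq₄ : ∀ B J g₁ g₂ g₃ g₄ g₅ → (B * (g₄ * g₁) + J * (g₃ * g₂)) * g₄ - B * (g₄ * g₁) * g₄ + B * (g₅ * g₂) *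
      g₂ ≡
          g₂ * (B * (g₅ * g₂) + J * (g₄ * g₃))
    eq₄ = solve 7 (λ B J g₁ g₂ g₃ g₄ g₅ → (B :* (g₄ :* g₁) :+ J :* (g₃ :* g₂)) :* g₄ :- B :* (g₄ :* g₁) :* g₄
      :+ B :* (g₅ :* g₂) :* g₂ :=
          g₂ :* (B :* (g₅ :* g₂) :+ J :* (g₄ :* g₃))) refl

  -- Specializations of the universal ring

  module W = WeierstrassPolynomials rawRing

  -- A homomorphism from the universal ring to ℚ, given by its values on the generators together
  -- with the relations these must satisfy.
  record Specialization : Set where
    field
      E           : Weierstrass ℚ
      x₁ y₁ x₂ y₂ : ℚ
      i           : ℚ
      equation₁   : W.lhs E x₁ y₁ ≡ W.rhs E x₁ y₁
      equation₂   : W.lhs E x₂ y₂ ≡ W.rhs E x₂ y₂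
      inverse     : (x₁ - x₂) * i ≡ 1ℚ

    valuation : Valuation
    valuation = assignment rawRing E x₁ y₁ x₂ y₂ i

    ⟦_⟧ : U.Expr → ℚ
    ⟦_⟧ = ev valuation

    ⟦⟧-cong : ∀ {s t} → s U.≈ t → ⟦ s ⟧ ≡ ⟦ t ⟧
    ⟦⟧-cong = evaluate-cong +-*-commutativeRing E equation₁ equation₂ inverse

  open Specialization using (valuation; ⟦_⟧; ⟦⟧-cong)

  module Division {Ψ : ℤ → U.Expr} (isΨ : IsTranslatedDivision Ψ) where

    open IsTranslatedDivision isΨ

    -- Index n stands for Ψₙ₋₂. Starting at Ψ₋₂ makes Ψ₁ Ψ₀ = 1 the last product of the first Somos
    -- 5 relation.
    shifted : ℕ → U.Expr
    shifted 0             = Ψ -[1+ 1 ]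
    shifted 1             = Ψ -1ℤ
    shifted (suc (suc n)) = Ψ (+ n)

    module _ (c : Specialization) where

      A B : ℚ
      A = ⟦ c ⟧ (U.β₁ U.x₁ U.y₁ U.^ 2)
      B = ⟦ c ⟧ (U.β₂ U.x₁ U.y₁)

      h : ℕ → ℚ
      h n = ⟦ c ⟧ (shifted n)

      h₁ : h 1 ≡ ⟦ c ⟧ (U.x₁ U.- U.x₂)
      h₁ = ⟦⟧-cong c Ψ₋₁

      h₂ : h 2 ≡ 1ℚ
      h₂ = ⟦⟧-cong c Ψ₀

      h₃ : h 3 ≡ 1ℚ
      h₃ = ⟦⟧-cong c Ψ₁

      private
        shifted-+2 : ∀ n → Ψ (+ n ℤ.+ + 2) ≡ shifted (4 ℕ.+ n)
        shifted-+2 n = cong (λ k → Ψ (+ k)) (ℕ.+-comm n 2)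

        shifted-+1 : ∀ n → Ψ (+ n ℤ.+ + 1) ≡ shifted (3 ℕ.+ n)
        shifted-+1 n = cong (λ k → Ψ (+ k)) (ℕ.+-comm n 1)

        shifted--1 : ∀ n → Ψ (+ n ℤ.- + 1) ≡ shifted (1 ℕ.+ n)
        shifted--1 zero    = refl
        shifted--1 (suc n) = refl

        shifted--2 : ∀ n → Ψ (+ n ℤ.- + 2) ≡ shifted n
        shifted--2 zero          = refl
        shifted--2 (suc zero)    = refl
        shifted--2 (suc (suc n)) = refl

      h-somos₄ : IsSomos₄ A B h
      h-somos₄ n = trans
        (sym (cong₂ _*_ (cong ⟦ c ⟧ (shifted-+2 n)) (cong ⟦ c ⟧ (shifted--2 n))))
        (trans (⟦⟧-cong c (recurrence (+ n)))
        (cong₂ (λ s t → A * s - B * (h (2 ℕ.+ n) * t))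
          (cong₂ _*_ (cong ⟦ c ⟧ (shifted-+1 n)) (cong ⟦ c ⟧ (shifted--1 n)))
          (*-identityʳ _)))

  -- The point P₁ = (0, 0) of order 2 and P₂ = (1, 0) on y² = x³ - 2x² + x: here
  -- β₁ = 0 and β₂ = -1, so that the recurrence makes every Ψₘ a unit.
  opaque
    unfolding _+_ ι

    base : Specialization
    base = record
      { E = weierstrass (ι 0ℤ) (ι -[1+ 1 ]) (ι 0ℤ) (ι 1ℤ) (ι 0ℤ)
      ; x₁ = ι 0ℤ ; y₁ = ι 0ℤ ; x₂ = ι 1ℤ ; y₂ = ι 0ℤ ; i = ι -1ℤ
      ; equation₁ = refl ; equation₂ = refl ; inverse = refl }

    base-integer : ∀ g → ∃[ z ] valuation base g ≡ ι z
    base-integer A₁ = 0ℤ , refl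
    base-integer A₂ = -[1+ 1 ] , refl
    base-integer A₃ = 0ℤ , refl
    base-integer A₄ = 1ℤ , refl
    base-integer A₆ = 0ℤ , refl
    base-integer X₁ = 0ℤ , refl
    base-integer Y₁ = 0ℤ , refl
    base-integer X₂ = 1ℤ , refl
    base-integer Y₂ = 0ℤ , refl
    base-integer [X₁-X₂]⁻¹ = -1ℤ , refl

  module _ {Ψ : ℤ → U.Expr} (isΨ : IsTranslatedDivision Ψ) where

    open IsTranslatedDivision isΨ
    open Division isΨ

    private
      opaque
        unfolding _+_ ι base

        A≡0 : A base ≡ 0ℚ
        A≡0 = refl

        B≡-1 : B base ≡ - 1ℚ
        B≡-1 = refl

        h₁² : h base 1 * h base 1 ≡ 1ℚ
        h₁² = cong₂ _*_ (h₁ base) (h₁ base)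

        h₄² : h base 4 * h base 4 ≡ 1ℚ
        h₄² = cong₂ _*_ (⟦⟧-cong base Ψ₂) (⟦⟧-cong base Ψ₂)

      s₄ : ∀ n → h base (4 ℕ.+ n) * h base n ≡ h base (2 ℕ.+ n) * h base (2 ℕ.+ n)
      s₄ n = trans (h-somos₄ base n) (trans
        (cong₂ (λ s t → s * (h base (3 ℕ.+ n) * h base (1 ℕ.+ n)) - t * (h base (2 ℕ.+ n) * h base (2 ℕ.+ n)))
          A≡0 B≡-1)
        (eq (h base (3 ℕ.+ n) * h base (1 ℕ.+ n)) (h base (2 ℕ.+ n) * h base (2 ℕ.+ n))))
        where
        eq : ∀ x y → 0ℚ * x - - 1ℚ * y ≡ y
        eq = solve 2 (λ x y → con 0ℚ :* x :- :- con 1ℚ :* y := y) refl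

      swap : ∀ a b → (a * a) * (b * b) ≡ (a * b) * (a * b)
      swap = solve 2 (λ a b → (a :* a) :* (b :* b) := (a :* b) :* (a :* b)) refl

    -- At `base` the recurrence reads Ψₘ₊₂ Ψₘ₋₂ = Ψₘ², so units propagate upwards from Ψ₋₁, ..., Ψ₂,
    -- while Ψ₋₂ comes from Ψ₂ Ψ₋₂ = Ψ₀². Squares avoid keeping track of signs.
    base-unit : ∀ n → h base n * h base n ≡ 1ℚ
    base-unit 0 = begin
        h base 0 * h base 0                          ≡⟨ *-identityˡ _ ⟨
        1ℚ * (h base 0 * h base 0)                   ≡⟨ cong (_* (h base 0 * h base 0)) h₄² ⟨
        (h base 4 * h base 4) * (h base 0 * h base 0)  ≡⟨ swap (h base 4) (h base 0) ⟩
        (h base 4 * h base 0) * (h base 4 * h base 0)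
          ≡⟨ cong (λ t → t * t) (trans (s₄ 0) (cong (λ t → t * t) (h₂ base))) ⟩
        (1ℚ * 1ℚ) * (1ℚ * 1ℚ)
          ≡⟨ trans (cong (λ t → t * t) (*-identityˡ 1ℚ)) (*-identityˡ 1ℚ) ⟩
        1ℚ ∎
      where open ≡-Reasoning
    base-unit 1 = h₁²
    base-unit 2 = trans (cong (λ t → t * t) (h₂ base)) (*-identityˡ 1ℚ)
    base-unit 3 = trans (cong (λ t → t * t) (h₃ base)) (*-identityˡ 1ℚ)
    base-unit (suc (suc m@(suc (suc n)))) = begin
        h base (4 ℕ.+ n) * h base (4 ℕ.+ n)                              ≡⟨ *-identityʳ _ ⟨
        (h base (4 ℕ.+ n) * h base (4 ℕ.+ n)) * 1ℚ
          ≡⟨ cong (λ t → h base (4 ℕ.+ n) * h base (4 ℕ.+ n) * t) (base-unit n) ⟨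
        (h base (4 ℕ.+ n) * h base (4 ℕ.+ n)) * (h base n * h base n)    ≡⟨ swap (h base (4 ℕ.+ n)) (h base n) ⟩
        (h base (4 ℕ.+ n) * h base n) * (h base (4 ℕ.+ n) * h base n)
          ≡⟨ cong (λ t → t * t) (trans (s₄ n) (base-unit m)) ⟩
        1ℚ * 1ℚ                                                          ≡⟨ *-identityˡ 1ℚ ⟩
        1ℚ ∎
      where open ≡-Reasoning

  -- Perturbation of the curve and its points

  private
    -- On the curve this is a₄x + a₆, so that the equations of two points determine a₄ and a₆.
    a₄x+a₆ᵁ : U.Expr → U.Expr → U.Expr
    a₄x+a₆ᵁ x y = U.lhs x y U.- (x U.^ 3 U.+ U.gen A₂ U.* x U.^ 2)

  a₄ᵁ a₆ᵁ : U.Expr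
  a₄ᵁ = (a₄x+a₆ᵁ U.x₁ U.y₁ U.- a₄x+a₆ᵁ U.x₂ U.y₂) U.* U.[x₁-x₂]⁻¹
  a₆ᵁ = a₄x+a₆ᵁ U.x₁ U.y₁ U.- a₄ᵁ U.* U.x₁

  private
    quotient-eq : ∀ g₁ g₂ x₁ x₂ i {a₄ a₆} → g₁ ≡ a₄ * x₁ + a₆ → g₂ ≡ a₄ * x₂ + a₆ → (x₁ - x₂) * i ≡ 1ℚ →
                  (g₁ - g₂) * i ≡ a₄
    quotient-eq g₁ g₂ x₁ x₂ i {a₄} {a₆} e₁ e₂ inv = begin
      (g₁ - g₂) * i                              ≡⟨ cong₂ (λ s t → (s - t) * i) e₁ e₂ ⟩
      (a₄ * x₁ + a₆ - (a₄ * x₂ + a₆)) * i        ≡⟨ eq a₄ a₆ x₁ x₂ i ⟩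
      a₄ * ((x₁ - x₂) * i)                       ≡⟨ trans (cong (a₄ *_) inv) (*-identityʳ a₄) ⟩
      a₄                                         ∎
      where
      open ≡-Reasoning
      eq : ∀ a₄ a₆ x₁ x₂ i → (a₄ * x₁ + a₆ - (a₄ * x₂ + a₆)) * i ≡ a₄ * ((x₁ - x₂) * i)
      eq = solve 5 (λ a₄ a₆ x₁ x₂ i → (a₄ :* x₁ :+ a₆ :- (a₄ :* x₂ :+ a₆)) :* i := a₄ :* ((x₁ :- x₂) :* i)) refl

    drop-leading : ∀ l u a b → l ≡ u + a + b → l - u ≡ a + b
    drop-leading l u a b e = trans (cong (_- u) e) (eq u a b)
      where
      eq : ∀ u a b → u + a + b - u ≡ a + b
      eq = solve 3 (λ u a b → u :+ a :+ b :- u := a :+ b) refl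

  a₄-value : ∀ (c : Specialization) → ⟦ c ⟧ a₄ᵁ ≡ Weierstrass.a₄ (Specialization.E c)
  a₄-value c = quotient-eq _ _ x₁ x₂ i
      (drop-leading _ _ _ _ equation₁) (drop-leading _ _ _ _ equation₂) inverse
    where open Specialization c hiding (⟦_⟧)

  a₆-value : ∀ (c : Specialization) → ⟦ c ⟧ a₆ᵁ ≡ Weierstrass.a₆ (Specialization.E c)
  a₆-value c = trans (cong₂ (λ s t → s - t * x₁) (drop-leading _ _ _ _ equation₁) (a₄-value c))
      (cancel (Weierstrass.a₄ E * x₁) (Weierstrass.a₆ E))
    where
    open Specialization c hiding (⟦_⟧)
    cancel : ∀ a b → a + b - a ≡ b
    cancel = solve 2 (λ a b → a :+ b :- a := b) refl

  module _ (ρ : Valuation) (inverse : (ρ X₁ - ρ X₂) * ρ [X₁-X₂]⁻¹ ≡ 1ℚ) where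

    private
      restore : ∀ l u a b → a + b ≡ l - u → l ≡ u + a + b
      restore l u a b e = trans (eq₁ l u) (trans (cong (λ t → u + t) (sym e)) (eq₂ u a b))
        where
        eq₁ : ∀ l u → l ≡ u + (l - u)
        eq₁ = solve 2 (λ l u → l := u :+ (l :- u)) refl
        eq₂ : ∀ u a b → u + (a + b) ≡ u + a + b
        eq₂ = solve 3 (λ u a b → u :+ (a :+ b) := u :+ a :+ b) refl

      eq₁ : ∀ g t → t + (g - t) ≡ g
      eq₁ = solve 2 (λ g t → t :+ (g :- t) := g) refl

      eq₂ : ∀ g₁ g₂ x₁ x₂ i → (x₁ - x₂) * i ≡ 1ℚ → (g₁ - g₂) * i * x₂ + (g₁ - (g₁ - g₂) * i * x₁) ≡ g₂
      eq₂ g₁ g₂ x₁ x₂ i inv = trans (rearrange g₁ g₂ x₁ x₂ i)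
        (trans (cong (λ t → g₁ - (g₁ - g₂) * t) inv) (cancel g₁ g₂))
        where
        rearrange : ∀ g₁ g₂ x₁ x₂ i → (g₁ - g₂) * i * x₂ + (g₁ - (g₁ - g₂) * i * x₁)
          ≡ g₁ - (g₁ - g₂) * ((x₁ - x₂) * i)
        rearrange = solve 5 (λ g₁ g₂ x₁ x₂ i → (g₁ :- g₂) :* i :* x₂ :+ (g₁ :- (g₁ :- g₂) :* i :* x₁) :=
          g₁ :- (g₁ :- g₂) :* ((x₁ :- x₂) :* i)) refl
        cancel : ∀ g₁ g₂ → g₁ - (g₁ - g₂) * 1ℚ ≡ g₂
        cancel = solve 2 (λ g₁ g₂ → g₁ :- (g₁ :- g₂) :* con 1ℚ := g₂) refl

    -- The two Weierstrass equations are linear in a₄ and a₆ with determinant x₁ - x₂, so they can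
    -- be met by the choice of these two alone.
    complete : Specialization
    complete = record
      { E = weierstrass (ρ A₁) (ρ A₂) (ρ A₃) (ev ρ a₄ᵁ) (ev ρ a₆ᵁ)
      ; x₁ = ρ X₁ ; y₁ = ρ Y₁ ; x₂ = ρ X₂ ; y₂ = ρ Y₂ ; i = ρ [X₁-X₂]⁻¹
      ; equation₁ = restore _ _ _ _ (eq₁ _ _)
      ; equation₂ = restore _ _ _ _ (eq₂ _ _ _ _ _ inverse)
      ; inverse = inverse }

  IntegralAt : ℕ → Specialization → Set
  IntegralAt p c = ∀ g → Ord≥ p 0 (valuation c g)

  _≡_at_^_ : Specialization → Specialization → ℕ → ℕ → Set
  c′ ≡ c at p ^ k = ∀ g → valuation c′ g ≡ valuation c g [mod p ^ k ]

  base-integral : ∀ {p} → Prime p → IntegralAt p base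
  base-integral p-prime g = subst (Ord≥ _ 0) (sym (proj₂ (base-integer g)))
    (Local.ι-integral p-prime (proj₁ (base-integer g)))

  module _ {p : ℕ} (p-prime : Prime p) where
    open Local p-prime

    unit-from-inverse : ∀ {u i} → Ord≥ p 0 i → u * i ≡ 1ℚ → ¬ Ord≥ p 1 u
    unit-from-inverse oi ui ou = 1-unit (subst (Ord≥ p 1) ui (ord-*ʳ ou oi))

    abscissae-unit : ∀ {c} → IntegralAt p c → ¬ Ord≥ p 1 (valuation c X₁ - valuation c X₂)
    abscissae-unit {c} oc = unit-from-inverse (oc [X₁-X₂]⁻¹) (Specialization.inverse c)

    unit-≡ : ∀ {u v} → u ≡ v [mod p ^ 1 ] → ¬ Ord≥ p 1 v → ¬ Ord≥ p 1 u
    unit-≡ e ¬ov ou = ¬ov (≡-ord p-prime (≡-sym p-prime e) ou)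

    ⟦⟧-≡ : ∀ {k c′ c} → IntegralAt p c → c′ ≡ c at p ^ k → ∀ s → ⟦ c′ ⟧ s ≡ ⟦ c ⟧ s [mod p ^ k ]
    ⟦⟧-≡ oc e = ev-≡ p-prime (λ g → ≡-integral p-prime (oc g) (e g)) oc e

  withInverse : Valuation → ℚ → Valuation
  withInverse σ i A₁        = σ A₁
  withInverse σ i A₂        = σ A₂
  withInverse σ i A₃        = σ A₃
  withInverse σ i A₄        = σ A₄
  withInverse σ i A₆        = σ A₆
  withInverse σ i X₁        = σ X₁
  withInverse σ i Y₁        = σ Y₁
  withInverse σ i X₂        = σ X₂
  withInverse σ i Y₂        = σ Y₂
  withInverse σ i [X₁-X₂]⁻¹ = i

  -- Since a₄ and a₆ are universal expressions in the other generators, they move as little as the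
  -- free data do. The exponent is positive so that the new x₁ - x₂ is still a unit.
  complete-≡ : ∀ {p} (p-prime : Prime p) {k} {c : Specialization} → IntegralAt p c →
    ∀ σ i (inverse : (σ X₁ - σ X₂) * i ≡ 1ℚ) →
    (∀ g → σ g ≡ valuation c g [mod p ^ suc k ]) →
    complete (withInverse σ i) inverse ≡ c at p ^ suc k
  complete-≡ {p} p-prime {k} {c} oc σ i inverse e = close
    where
    open Local p-prime
    ρ = withInverse σ i
    u≡ : (σ X₁ - σ X₂) ≡ valuation c X₁ - valuation c X₂ [mod p ^ suc k ]
    u≡ = ≡-- p-prime (e X₁) (e X₂)
    oi : Ord≥ p 0 i
    oi = reciprocal-integral
      (ord-- (≡-integral p-prime (oc X₁) (e X₁)) (≡-integral p-prime (oc X₂) (e X₂)))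
      (unit-≡ p-prime (ord-≤ (ℕ.s≤s ℕ.z≤n) u≡) (abscissae-unit p-prime {c} oc)) inverse
    ρ≡ : ∀ g → ρ g ≡ valuation c g [mod p ^ suc k ]
    ρ≡ A₁ = e A₁
    ρ≡ A₂ = e A₂
    ρ≡ A₃ = e A₃
    ρ≡ A₄ = e A₄
    ρ≡ A₆ = e A₆
    ρ≡ X₁ = e X₁
    ρ≡ Y₁ = e Y₁
    ρ≡ X₂ = e X₂
    ρ≡ Y₂ = e Y₂
    ρ≡ [X₁-X₂]⁻¹ = reciprocal-≡ p-prime oi (oc [X₁-X₂]⁻¹) inverse (Specialization.inverse c) u≡
    ev≡ : ∀ s → ev ρ s ≡ ⟦ c ⟧ s [mod p ^ suc k ]
    ev≡ = ev-≡ p-prime (λ g → ≡-integral p-prime (oc g) (ρ≡ g)) oc ρ≡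
    close : complete ρ inverse ≡ c at p ^ suc k
    close A₁ = e A₁
    close A₂ = e A₂
    close A₃ = e A₃
    close A₄ = subst (λ t → ev ρ a₄ᵁ ≡ t [mod p ^ suc k ]) (a₄-value c) (ev≡ a₄ᵁ)
    close A₆ = subst (λ t → ev ρ a₆ᵁ ≡ t [mod p ^ suc k ]) (a₆-value c) (ev≡ a₆ᵁ)
    close X₁ = e X₁
    close Y₁ = e Y₁
    close X₂ = e X₂
    close Y₂ = e Y₂
    close [X₁-X₂]⁻¹ = ρ≡ [X₁-X₂]⁻¹

  -- c′ is p-adically close to c, but agrees with base modulo 2, so that no Ψₘ vanishes at c′.
  perturb : ∀ {p} → Prime p → p ≢ 2 → ∀ {c} → IntegralAt p c → ∀ k →
            ∃[ c′ ] c′ ≡ c at p ^ suc k × c′ ≡ base at 2 ^ 1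
  perturb {p} p-prime p≢2 {c} oc k =
      complete (withInverse σ i) inverse
    , complete-≡ p-prime {k} {c} oc σ i inverse (λ g → proj₁ (proj₂ (approximation g)))
    , complete-≡ prime[2] {0} {base} (base-integral prime[2]) σ i inverse σ≡base
    where
    approximation : ∀ g → ∃[ x ] x ≡ valuation c g [mod p ^ suc k ] × x
      ≡ ι (proj₁ (base-integer g)) [mod 2 ^ 1 ]
    approximation g = weak-approximation p-prime p≢2 (oc g) (proj₁ (base-integer g)) (suc k)
    σ : Valuation
    σ g = proj₁ (approximation g)
    σ≡base : ∀ g → σ g ≡ valuation base g [mod 2 ^ 1 ]
    σ≡base g = subst (λ t → σ g ≡ t [mod 2 ^ 1 ]) (sym (proj₂ (base-integer g)))
      (proj₂ (proj₂ (approximation g)))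
    u = σ X₁ - σ X₂
    u≢0 : u ≢ 0ℚ
    u≢0 u≡0 = unit-≡ prime[2] (≡-- prime[2] (σ≡base X₁) (σ≡base X₂))
      (abscissae-unit prime[2] {base} (base-integral prime[2]))
      (subst (Ord≥ 2 1) (sym u≡0) (Local.0-ord prime[2] 1))
    instance _ = ℚ.≢-nonZero u≢0
    i = ℚ.1/ u
    inverse : u * i ≡ 1ℚ
    inverse = trans (sym (*-unseal u i)) (ℚ.*-inverseʳ u)

  -- The Somos 5 relation

  module _ {Ψ : ℤ → U.Expr} (isΨ : IsTranslatedDivision Ψ) where

    open Division isΨ

    -- Because Ψ₁ Ψ₀ = 1, the first Somos 5 relation can be solved for its second coefficient
    -- without division; as a universal expression it is p-integral at every p-integral
    -- specialization.
    Jᵁ : U.Expr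
    Jᵁ = shifted 5 U.* shifted 0 U.- U.β₂ U.x₁ U.y₁ U.* (shifted 4 U.* shifted 1)

    -- The defect of the relation is a universal expression, hence p-adically continuous. It
    -- vanishes at perturbed specializations arbitrarily close to `c`, and so at `c`.
    h-somos₅ : ∀ {p} → Prime p → p ≢ 2 → ∀ {c} → IntegralAt p c → IsSomos₅ (B c) (⟦ c ⟧ Jᵁ) (h c)
    h-somos₅ {p} p-prime p≢2 {c} oc n = zero-difference (ord-∞ λ k → ord-≤ (ℕ.n≤1+n k) (vanishes k))
      where
      open Local p-prime
      defect : U.Expr
      defect = shifted (5 ℕ.+ n) U.* shifted n U.-
        (U.β₂ U.x₁ U.y₁ U.* (shifted (4 ℕ.+ n) U.* shifted (1 ℕ.+ n)) U.+ Jᵁ U.*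
          (shifted (3 ℕ.+ n) U.* shifted (2 ℕ.+ n)))
      zero-difference : ∀ {x y} → x - y ≡ 0ℚ → x ≡ y
      zero-difference {x} {y} e = trans (eq x y) (trans (cong (_+ y) e) (+-identityˡ y))
        where
        eq : ∀ x y → x ≡ (x - y) + y
        eq = solve 2 (λ x y → x := (x :- y) :+ y) refl
      perturbed : ∀ {c′} → c′ ≡ base at 2 ^ 1 → ⟦ c′ ⟧ defect ≡ 0ℚ
      perturbed {c′} e = trans
        (cong (_- y) (somos₄⇒somos₅ {A c′} {B c′} {⟦ c′ ⟧ Jᵁ} {h c′} (h-somos₄ c′) nonzero initial n))
        (-‿inverseʳ y)
        where
        y = B c′ * (h c′ (4 ℕ.+ n) * h c′ (1 ℕ.+ n)) + ⟦ c′ ⟧ Jᵁ * (h c′ (3 ℕ.+ n) * h c′ (2 ℕ.+ n))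
        -- Modulo 2 each term agrees with its value at `base`, which is a unit.
        nonzero : ∀ n → h c′ n ≢ 0ℚ
        nonzero n h≡0 = unit-≡ prime[2] (⟦⟧-≡ prime[2] {1} {c′} {base} (base-integral prime[2]) e (shifted n))
          (unit-from-inverse prime[2] (ev-integral prime[2] (base-integral prime[2]) (shifted n))
            (base-unit isΨ n))
          (subst (Ord≥ 2 1) (sym h≡0) (Local.0-ord prime[2] 1))
        -- The factor `1ℚ * 1ℚ` is Ψ₁ Ψ₀, left out of `Jᵁ` and restored here.
        eq : ∀ x y → x ≡ y + (x - y) * (1ℚ * 1ℚ)
        eq = solve 2 (λ x y → x := y :+ (x :- y) :* (con 1ℚ :* con 1ℚ)) refl
        initial : h c′ 5 * h c′ 0 ≡ B c′ * (h c′ 4 * h c′ 1) + ⟦ c′ ⟧ Jᵁ * (h c′ 3 * h c′ 2)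
        initial = trans (eq _ _) (cong₂ (λ s t → B c′ * (h c′ 4 * h c′ 1) + ⟦ c′ ⟧ Jᵁ * (s * t)) (sym (h₃ c′))
          (sym (h₂ c′)))
      vanishes : ∀ k → Ord≥ p (suc k) (⟦ c ⟧ defect)
      vanishes k =
        let c′ , e , e₂ = perturb p-prime p≢2 {c} oc k in
        ≡-ord p-prime (≡-sym p-prime (⟦⟧-≡ p-prime {suc k} {c′} {c} oc e defect))
          (subst (Ord≥ p (suc k)) (sym (perturbed {c′} e₂)) (0-ord (suc k)))

  -- Eventual periodicity

  m∣n! : ∀ {m n} → 0 ℕ.< m → m ℕ.≤ n → m ℕ.∣ n !
  m∣n! {suc m} _ m≤n = ℕ.∣-trans (ℕ.m∣m*n (m !)) (ℕ.m≤n⇒m!∣n! m≤n)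

  module _ (_~_ : ℕ → ℕ → Set) (~-refl : ∀ {n} → n ~ n) (~-trans : ∀ {l m n} → l ~ m → m ~ n → l ~ n) where

    iterate-period : ∀ {n₀ d} → (∀ m → n₀ ℕ.≤ m → (m ℕ.+ d) ~ m) → ∀ t m → n₀ ℕ.≤ m → (m ℕ.+ t ℕ.* d) ~ m
    iterate-period per zero    m n₀≤m = subst (_~ m) (sym (ℕ.+-identityʳ m)) ~-refl
    iterate-period {d = d} per (suc t) m n₀≤m = subst (_~ m) (ℕ.+-assoc m d (t ℕ.* d))
      (~-trans (iterate-period per t (m ℕ.+ d) (ℕ.≤-trans n₀≤m (ℕ.m≤m+n m d))) (per m n₀≤m))

    -- The repetition found by pigeonhole depends on the sequence, but its preperiod and its length
    -- are at most N, so `N !` is a period from N on whatever the sequence is.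
    eventually-periodic : ∀ N (code : ℕ → Fin N) → (∀ {m n} → code m ≡ code n → m ~ n) →
      (∀ {m n} → m ~ n → suc m ~ suc n) → ∀ m → N ℕ.≤ m → (m ℕ.+ N !) ~ m
    eventually-periodic N code decode shift m N≤m
      with i , j , i<j , eq ← Fin.pigeonhole (ℕ.n<1+n N) (λ i → code (toℕ i))
      = subst (λ t → (m ℕ.+ t) ~ m) (sym (ℕ._∣_.equality d∣N!))
          (iterate-period per (ℕ.quotient d∣N!) m (ℕ.≤-trans (ℕ.≤-pred (Fin.toℕ<n i)) N≤m))
      where
      d = toℕ j ℕ.∸ toℕ i
      d∣N! : d ℕ.∣ N !
      d∣N! = m∣n! (ℕ.m<n⇒0<n∸m i<j) (ℕ.≤-trans (ℕ.m∸n≤m (toℕ j) (toℕ i)) (ℕ.≤-pred (Fin.toℕ<n j)))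
      shifts : ∀ s → (s ℕ.+ toℕ j) ~ (s ℕ.+ toℕ i)
      shifts zero    = decode (sym eq)
      shifts (suc s) = shift (shifts s)
      per : ∀ m → toℕ i ℕ.≤ m → (m ℕ.+ d) ~ m
      per m i≤m = subst₂ _~_
        (begin
          (m ℕ.∸ toℕ i) ℕ.+ toℕ j                ≡⟨ cong ((m ℕ.∸ toℕ i) ℕ.+_) (ℕ.m+[n∸m]≡n (ℕ.<⇒≤ i<j)) ⟨
          (m ℕ.∸ toℕ i) ℕ.+ (toℕ i ℕ.+ d)        ≡⟨ ℕ.+-assoc (m ℕ.∸ toℕ i) (toℕ i) d ⟨
          (m ℕ.∸ toℕ i) ℕ.+ toℕ i ℕ.+ d          ≡⟨ cong (ℕ._+ d) (ℕ.m∸n+n≡m i≤m) ⟩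
          m ℕ.+ d                                ∎)
        (ℕ.m∸n+n≡m i≤m) (shifts (m ℕ.∸ toℕ i))
        where open ≡-Reasoning

  -- Linearised recurrences and periods modulo prime powers

  -- The Somos relations linearised at g and solved for the leading term.
  module _ (p : ℕ) (A B J : ℚ) (g δ : ℕ → ℚ) where

    IsTangent₄ IsTangent₅ : Set
    IsTangent₄ = ∀ n → δ (4 ℕ.+ n) * g n ≡
      A * (δ (3 ℕ.+ n) * g (1 ℕ.+ n) + g (3 ℕ.+ n) * δ (1 ℕ.+ n))
        - B * (δ (2 ℕ.+ n) * g (2 ℕ.+ n) + g (2 ℕ.+ n) * δ (2 ℕ.+ n)) - g (4 ℕ.+ n) * δ n [mod p ^ 1 ]
    IsTangent₅ = ∀ n → δ (5 ℕ.+ n) * g n ≡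
      B * (δ (4 ℕ.+ n) * g (1 ℕ.+ n) + g (4 ℕ.+ n) * δ (1 ℕ.+ n))
        + J * (δ (3 ℕ.+ n) * g (2 ℕ.+ n) + g (3 ℕ.+ n) * δ (2 ℕ.+ n)) - g (5 ℕ.+ n) * δ n [mod p ^ 1 ]

  module Dynamics {p : ℕ} (p-prime : Prime p) where

    open Local p-prime

    residueℤ : ℤ → Fin p
    residueℤ z = fromℕ< (ℤ.n%ℕd<d z p)

    residueℤ-≡ : ∀ z z′ → residueℤ z ≡ residueℤ z′ → ι z ≡ ι z′ [mod p ^ 1 ]
    residueℤ-≡ z z′ eq = subst (Ord≥ p 1) (begin
        ι (q ℤ.- q′) * π 1
          ≡⟨ cong (λ t → ι (q ℤ.- q′) * ι (+ t)) (ℕ.*-identityʳ p) ⟩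
        ι (q ℤ.- q′) * ι (+ p)                          ≡⟨ cong (_* ι (+ p)) (ι-- q q′) ⟩
        (ι q - ι q′) * ι (+ p)                          ≡⟨ regroup (ι q) (ι q′) (ι (+ p)) (ι (+ r)) ⟩
        (ι (+ r) + ι q * ι (+ p)) - (ι (+ r) + ι q′ * ι (+ p))
          ≡⟨ cong (λ t → (ι (+ r) + ι q * ι (+ p)) - (ι (+ t) + ι q′ * ι (+ p))) r≡ ⟩
        (ι (+ r) + ι q * ι (+ p)) - (ι (+ r′) + ι q′ * ι (+ p))  ≡⟨ cong₂ _-_ (division z) (division z′) ⟨
        ι z - ι z′                                      ∎)
      (ord-*ˡ (ι-integral (q ℤ.- q′)) (π-ord 1))
      where
      open ≡-Reasoning
      q  = z ℤ./ℕ p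
      q′ = z′ ℤ./ℕ p
      r  = z ℤ.%ℕ p
      r′ = z′ ℤ.%ℕ p
      r≡ : r ≡ r′
      r≡ = trans (sym (Fin.toℕ-fromℕ< (ℤ.n%ℕd<d z p))) (trans (cong toℕ eq) (Fin.toℕ-fromℕ< (ℤ.n%ℕd<d z′ p)))
      division : ∀ z → ι z ≡ ι (+ (z ℤ.%ℕ p)) + ι (z ℤ./ℕ p) * ι (+ p)
      division z = trans (cong ι (ℤ.a≡a%ℕn+[a/ℕn]*n z p))
        (trans (ι-+ _ _) (cong (λ t → ι (+ (z ℤ.%ℕ p)) + t) (ι-* (z ℤ./ℕ p) (+ p))))
      regroup : ∀ q q′ p r → (q - q′) * p ≡ (r + q * p) - (r + q′ * p)
      regroup = solve 4 (λ q q′ p r → (q :- q′) :* p := (r :+ q :* p) :- (r :+ q′ :* p)) refl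

    residue𝔽 : ∀ {x} → Ord≥ p 0 x → Fin p
    residue𝔽 ox = residueℤ (proj₁ (approximate ox 1))

    residue𝔽-≡ : ∀ {x y} (ox : Ord≥ p 0 x) (oy : Ord≥ p 0 y) → residue𝔽 ox ≡ residue𝔽 oy → x ≡ y [mod p ^ 1 ]
    residue𝔽-≡ {x} {y} ox oy eq =
      ≡-trans p-prime (proj₂ (approximate ox 1)) (≡-trans p-prime (residueℤ-≡ z z′ eq)
        (≡-sym p-prime (proj₂ (approximate oy 1))))
      where
      z  = proj₁ (approximate ox 1)
      z′ = proj₁ (approximate oy 1)

    infix 4 _≃_
    -- Integrality is carried along because multiplying congruences requires it.
    _≃_ : ℚ → ℚ → Set
    x ≃ y = Ord≥ p 0 x × Ord≥ p 0 y × (x ≡ y [mod p ^ 1 ])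

    ≃-refl : ∀ {x} → Ord≥ p 0 x → x ≃ x
    ≃-refl ox = ox , ox , ≡-refl p-prime

    ≃-+ : ∀ {x x′ y y′} → x ≃ x′ → y ≃ y′ → x + y ≃ x′ + y′
    ≃-+ (ox , ox′ , e) (oy , oy′ , f) = ord-+ ox oy , ord-+ ox′ oy′ , ≡-+ p-prime e f

    ≃-- : ∀ {x x′ y y′} → x ≃ x′ → y ≃ y′ → x - y ≃ x′ - y′
    ≃-- (ox , ox′ , e) (oy , oy′ , f) = ord-- ox oy , ord-- ox′ oy′ , ≡-- p-prime e f

    ≃-* : ∀ {x x′ y y′} → x ≃ x′ → y ≃ y′ → x * y ≃ x′ * y′
    ≃-* (ox , ox′ , e) (oy , oy′ , f) = ord-*ʳ ox oy , ord-*ʳ ox′ oy′ , ≡-* p-prime ox oy′ e f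

    -- Linear equations with congruent data have congruent solutions once the leading coefficient is
    -- a unit; this turns a recurrence into a rule for the next term.
    ≃-solve : ∀ {x x′ u u′ r r′} → Ord≥ p 0 x → Ord≥ p 0 x′ → ¬ Ord≥ p 1 u →
              u ≃ u′ → r ≃ r′ → x * u ≡ r [mod p ^ 1 ] → x′ * u′ ≡ r′ [mod p ^ 1 ] → x ≃ x′
    ≃-solve {x} {x′} {u} {u′} {r} {r′} ox ox′ ¬ou (ou , _ , u≡) (_ , _ , r≡) e e′ = ox , ox′ ,
      unit-cancelˡ ou ¬ou (ord-- ox ox′)
        (subst (Ord≥ p 1) (eq x x′ u u′ r r′)
          (ord-+ (ord-+ e r≡) (ord-+ (ord-neg e′) (ord-neg (ord-*ˡ ox′ u≡)))))
      where
      eq : ∀ x x′ u u′ r r′ → ((x * u - r) + (r - r′)) + (- (x′ * u′ - r′) + - (x′ * (u - u′))) ≡ u * (x - x′)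
      eq = solve 6 (λ x x′ u u′ r r′ → ((x :* u :- r) :+ (r :- r′)) :+
        (:- (x′ :* u′ :- r′) :+ :- (x′ :* (u :- u′))) := u :* (x :- x′)) refl

    exact : ∀ {k x y} → x ≡ y → x ≡ y [mod p ^ k ]
    exact {k} {x} refl = ≡-refl p-prime

    NoAdjacentZeros : (ℕ → ℚ) → Set
    NoAdjacentZeros g = ∀ n → ¬ Ord≥ p 1 (g n) ⊎ ¬ Ord≥ p 1 (g (1 ℕ.+ n))

    -- The number of pairs of windows of length 5 modulo p.
    windows : ℕ
    windows = (p ℕ.* p) ℕ.^ 5

    period : ℕ → ℕ
    period k = windows ! ℕ.* p ℕ.^ k

    module _ {A B J : ℚ} (oA : Ord≥ p 0 A) (oB : Ord≥ p 0 B) (oJ : Ord≥ p 0 J) where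

      -- Modulo p, g + ε δ with ε² = 0 satisfies both Somos relations: the pair is a single sequence
      -- over the dual numbers of 𝔽ₚ.
      module Tangent {g δ : ℕ → ℚ} (og : ∀ n → Ord≥ p 0 (g n)) (oδ : ∀ n → Ord≥ p 0 (δ n))
               (s₄ : IsSomos₄ A B g) (s₅ : IsSomos₅ B J g) (nz : NoAdjacentZeros g)
               (t₄ : IsTangent₄ p A B J g δ) (t₅ : IsTangent₅ p A B J g δ) where

        Same : ℕ → ℕ → ℕ → Set
        Same j m n = (g (j ℕ.+ m) ≃ g (j ℕ.+ n)) × (δ (j ℕ.+ m) ≃ δ (j ℕ.+ n))

        SameWindow : ℕ → ℕ → Set
        SameWindow m n = Same 0 m n × Same 1 m n × Same 2 m n × Same 3 m n × Same 4 m n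

        -- If g m is a unit, the Somos 5 relation at m gives the term of index 5 + m; if g (1 + m)
        -- is a unit, the Somos 4 relation at 1 + m gives the same term. The linearised relations
        -- have the same leading coefficients, so they settle δ in the same way.
        next : ∀ {m n} → SameWindow m n → SameWindow (suc m) (suc n)
        next {m} {n} ((g₀ , d₀) , s₁@(g₁ , d₁) , s₂@(g₂ , d₂) , s₃@(g₃ , d₃) , s₄′@(g₄ , d₄)) =
          s₁ , s₂ , s₃ , s₄′ , new (nz m)
          where
          A≃ : A ≃ A
          A≃ = ≃-refl oA
          B≃ : B ≃ B
          B≃ = ≃-refl oB
          J≃ : J ≃ J
          J≃ = ≃-refl oJ
          new : ¬ Ord≥ p 1 (g m) ⊎ ¬ Ord≥ p 1 (g (1 ℕ.+ m)) → Same 5 m n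
          new (inj₂ ¬o) = g₅ , ≃-solve (oδ _) (oδ _) ¬o g₁
              (≃-- (≃-- (≃-* A≃ (≃-+ (≃-* d₄ g₂) (≃-* g₄ d₂))) (≃-* B≃ (≃-+ (≃-* d₃ g₃) (≃-* g₃ d₃))))
                (≃-* g₅ d₁))
              (t₄ (1 ℕ.+ m)) (t₄ (1 ℕ.+ n))
            where
            g₅ : g (5 ℕ.+ m) ≃ g (5 ℕ.+ n)
            g₅ = ≃-solve (og _) (og _) ¬o g₁ (≃-- (≃-* A≃ (≃-* g₄ g₂)) (≃-* B≃ (≃-* g₃ g₃)))
                   (exact (s₄ (1 ℕ.+ m))) (exact (s₄ (1 ℕ.+ n)))
          new (inj₁ ¬o) = g₅ , ≃-solve (oδ _) (oδ _) ¬o g₀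
              (≃-- (≃-+ (≃-* B≃ (≃-+ (≃-* d₄ g₁) (≃-* g₄ d₁))) (≃-* J≃ (≃-+ (≃-* d₃ g₂) (≃-* g₃ d₂))))
                (≃-* g₅ d₀))
              (t₅ m) (t₅ n)
            where
            g₅ : g (5 ℕ.+ m) ≃ g (5 ℕ.+ n)
            g₅ = ≃-solve (og _) (og _) ¬o g₀ (≃-+ (≃-* B≃ (≃-* g₄ g₁)) (≃-* J≃ (≃-* g₃ g₂)))
                   (exact (s₅ m)) (exact (s₅ n))

        letter : ℕ → Fin (p ℕ.* p)
        letter n = combine (residue𝔽 (og n)) (residue𝔽 (oδ n))

        letter-≃ : ∀ {m n} → letter m ≡ letter n → (g m ≃ g n) × (δ m ≃ δ n)
        letter-≃ {m} {n} eq with e , f ← Fin.combine-injective (residue𝔽 (og m)) (residue𝔽 (oδ m))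
          (residue𝔽 (og n)) (residue𝔽 (oδ n)) eq
          = (og m , og n , residue𝔽-≡ (og m) (og n) e) , (oδ m , oδ n , residue𝔽-≡ (oδ m) (oδ n) f)

        code : ℕ → Fin windows
        code n = funToFin {5} (λ i → letter (toℕ i ℕ.+ n))

        decode : ∀ {m n} → code m ≡ code n → SameWindow m n
        decode {m} {n} eq = at (# 0) , at (# 1) , at (# 2) , at (# 3) , at (# 4)
          where
          at : ∀ i → (g (toℕ i ℕ.+ m) ≃ g (toℕ i ℕ.+ n)) × (δ (toℕ i ℕ.+ m) ≃ δ (toℕ i ℕ.+ n))
          at i = letter-≃ (trans (sym (Fin.finToFun-funToFin {5} (λ i → letter (toℕ i ℕ.+ m)) i))
            (trans (cong (λ (c : Fin windows) → finToFun {p ℕ.* p} {5} c i) eq)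
              (Fin.finToFun-funToFin {5} (λ i → letter (toℕ i ℕ.+ n)) i)))

        same-trans : ∀ {x y z} → x ≃ y → y ≃ z → x ≃ z
        same-trans (ox , _ , e) (_ , oz , f) = ox , oz , ≡-trans p-prime e f

        letters-trans : ∀ {w w′ x x′ y y′} → (w ≃ x) × (w′ ≃ x′) → (x ≃ y) × (x′ ≃ y′) → (w ≃ y) × (w′ ≃ y′)
        letters-trans (a , b) (c , d) = same-trans a c , same-trans b d

        window-trans : ∀ {l m n} → SameWindow l m → SameWindow m n → SameWindow l n
        window-trans (a₀ , a₁ , a₂ , a₃ , a₄) (b₀ , b₁ , b₂ , b₃ , b₄) =
          letters-trans a₀ b₀ , letters-trans a₁ b₁ , letters-trans a₂ b₂ , letters-trans a₃ b₃ ,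
            letters-trans a₄ b₄

        window-period : ∀ t m → windows ℕ.≤ m → SameWindow (m ℕ.+ t ℕ.* windows !) m
        window-period = iterate-period SameWindow (decode refl) window-trans
          (eventually-periodic SameWindow (decode refl) window-trans windows code decode next)

        period-g : ∀ t m → windows ℕ.≤ m → g (m ℕ.+ t ℕ.* windows !) ≡ g m [mod p ^ 1 ]
        period-g t m N≤m = proj₂ (proj₂ (proj₁ (proj₁ (window-period t m N≤m))))

        period-δ : ∀ t m → windows ℕ.≤ m → δ (m ℕ.+ t ℕ.* windows !) ≡ δ m [mod p ^ 1 ]
        period-δ t m N≤m = proj₂ (proj₂ (proj₂ (proj₁ (window-period t m N≤m))))

  private
    expand : ∀ q x x′ y y′ → (x + q * x′) * (y + q * y′) ≡ x * y + q * (x′ * y + x * y′) + q * (q * (x′ * y′))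
    expand = solve 5 (λ q x x′ y y′ → (x :+ q :* x′) :* (y :+ q :* y′) :=
      x :* y :+ q :* (x′ :* y :+ x :* y′) :+ q :* (q :* (x′ :* y′))) refl

    -- A perturbation by a multiple of q preserves the relation xy = C uv + D wz, hence its
    -- first-order part up to a multiple of q.
    first-order : ∀ C D q {x x′ y y′ u u′ v v′ w w′ z z′} → q ≢ 0ℚ →
      x * y ≡ C * (u * v) + D * (w * z) →
      (x + q * x′) * (y + q * y′) ≡ C * ((u + q * u′) * (v + q * v′)) + D * ((w + q * w′) * (z + q * z′)) →
      x′ * y - (C * (u′ * v + u * v′) + D * (w′ * z + w * z′) - x * y′)
        ≡ q * (C * (u′ * v′) + D * (w′ * z′) - x′ * y′)
    first-order C D q {x} {x′} {y} {y′} {u} {u′} {v} {v′} {w} {w′} {z} {z′} q≢0 e e′ = *-cancelˡ q q≢0 (begin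
      q * (x′ * y - (L - x * y′))
        ≡⟨ eq₁ q (x * y) (x′ * y) (x * y′) (q * (q * (x′ * y′))) L ⟩
      (x * y + q * (x′ * y + x * y′) + q * (q * (x′ * y′))) - x * y - q * L - q * (q * (x′ * y′))
        ≡⟨ cong₂ (λ s t → s - t - q * L - q * (q * (x′ * y′))) (trans (sym (expand q x x′ y y′)) (trans e′
             (cong₂ (λ s t → C * s + D * t) (expand q u u′ v v′) (expand q w w′ z z′)))) e ⟩
      (C * (u * v + q * (u′ * v + u * v′) + q * (q * (u′ * v′))) + D *
        (w * z + q * (w′ * z + w * z′) + q * (q * (w′ * z′))))
        - (C * (u * v) + D * (w * z)) - q * L - q * (q * (x′ * y′))
        ≡⟨ eq₂ C D q (u * v) (u′ * v + u * v′) (u′ * v′) (w * z) (w′ * z + w * z′) (w′ * z′) (x′ * y′) ⟩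
      q * (q * (C * (u′ * v′) + D * (w′ * z′) - x′ * y′)) ∎)
      where
      open ≡-Reasoning
      L = C * (u′ * v + u * v′) + D * (w′ * z + w * z′)
      eq₁ : ∀ q a b c s L → q * (b - (L - c)) ≡ (a + q * (b + c) + s) - a - q * L - s
      eq₁ = solve 6 (λ q a b c s L → q :* (b :- (L :- c)) := (a :+ q :* (b :+ c) :+ s) :- a :- q :* L :- s) refl
      eq₂ : ∀ C D q a b c a′ b′ c′ d →
        (C * (a + q * b + q * (q * c)) + D * (a′ + q * b′ + q * (q * c′))) - (C * a + D * a′) - q *
          (C * b + D * b′) - q * (q * d)
        ≡ q * (q * (C * c + D * c′ - d))
      eq₂ = solve 10 (λ C D q a b c a′ b′ c′ d →
        (C :* (a :+ q :* b :+ q :* (q :* c)) :+ D :* (a′ :+ q :* b′ :+ q :* (q :* c′))) :- (C :* a :+ D :* a′)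
          :- q :* (C :* b :+ D :* b′) :- q :* (q :* d)
        := q :* (q :* (C :* c :+ D :* c′ :- d))) refl

  neg-* : ∀ B x → - (B * x) ≡ - B * x
  neg-* = solve 2 (λ B x → :- (B :* x) := (:- B) :* x) refl

  private
    zero₄ : ∀ A B g₀ g₁ g₂ g₃ g₄ → 0ℚ * g₀ ≡ A * (0ℚ * g₁ + g₃ * 0ℚ) - B * (0ℚ * g₂ + g₂ * 0ℚ) - g₄ * 0ℚ
    zero₄ = solve 7 (λ A B g₀ g₁ g₂ g₃ g₄ → con 0ℚ :* g₀ :=
      A :* (con 0ℚ :* g₁ :+ g₃ :* con 0ℚ) :- B :* (con 0ℚ :* g₂ :+ g₂ :* con 0ℚ) :- g₄ :* con 0ℚ) refl
    zero₅ : ∀ B J g₀ g₁ g₂ g₃ g₄ g₅ → 0ℚ * g₀ ≡ B * (0ℚ * g₁ + g₄ * 0ℚ) + J * (0ℚ * g₂ + g₃ * 0ℚ) - g₅ * 0ℚ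
    zero₅ = solve 8 (λ B J g₀ g₁ g₂ g₃ g₄ g₅ → con 0ℚ :* g₀ :=
      B :* (con 0ℚ :* g₁ :+ g₄ :* con 0ℚ) :+ J :* (con 0ℚ :* g₂ :+ g₃ :* con 0ℚ) :- g₅ :* con 0ℚ) refl

  module _ {p : ℕ} (p-prime : Prime p) where

    open Local p-prime
    open Dynamics p-prime

    module _ {A B J : ℚ} (oA : Ord≥ p 0 A) (oB : Ord≥ p 0 B) (oJ : Ord≥ p 0 J) where

      -- The two relations differ by pᵏ⁺¹ times the linear part and by quadratic terms divisible by
      -- p²ᵏ⁺²; after division by pᵏ⁺¹ the quadratic terms still vanish modulo p. The sign of B is
      -- moved inside to fit `first-order`.
      perturbation-tangent₄ : ∀ k {g δ} → (∀ n → Ord≥ p 0 (δ n)) →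
        IsSomos₄ A B g → IsSomos₄ A B (λ n → g n + π (suc k) * δ n) → IsTangent₄ p A B J g δ
      perturbation-tangent₄ k {g} {δ} oδ s s′ n = subst (Ord≥ p 1)
        (sym (trans (cong (λ t → δ (4 ℕ.+ n) * g n -
          (A * (δ (3 ℕ.+ n) * g (1 ℕ.+ n) + g (3 ℕ.+ n) * δ (1 ℕ.+ n)) + t - g (4 ℕ.+ n) * δ n))
                (neg-* B _))
          (first-order A (- B) (π (suc k)) (π≢0 (suc k))
            (trans (s n) (cong (λ t → A * (g (3 ℕ.+ n) * g (1 ℕ.+ n)) + t) (neg-* B _)))
            (trans (s′ n) (cong (λ t →
              A * ((g (3 ℕ.+ n) + π (suc k) * δ (3 ℕ.+ n)) * (g (1 ℕ.+ n) + π (suc k) * δ (1 ℕ.+ n))) + t)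
              (neg-* B _))))))
        (ord-*ʳ (ord-≤ {1} {suc k} (ℕ.s≤s ℕ.z≤n) (π-ord (suc k)))
          (ord-- (ord-+ (ord-*ʳ oA (ord-*ʳ (oδ _) (oδ _))) (ord-*ʳ (ord-neg oB) (ord-*ʳ (oδ _) (oδ _))))
            (ord-*ʳ (oδ _) (oδ _))))

      perturbation-tangent₅ : ∀ k {g δ} → (∀ n → Ord≥ p 0 (δ n)) →
        IsSomos₅ B J g → IsSomos₅ B J (λ n → g n + π (suc k) * δ n) → IsTangent₅ p A B J g δ
      perturbation-tangent₅ k {g} {δ} oδ s s′ n = subst (Ord≥ p 1)
        (sym (first-order B J (π (suc k)) (π≢0 (suc k)) (s n) (s′ n)))
        (ord-*ʳ (ord-≤ {1} {suc k} (ℕ.s≤s ℕ.z≤n) (π-ord (suc k)))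
          (ord-- (ord-+ (ord-*ʳ oB (ord-*ʳ (oδ _) (oδ _))) (ord-*ʳ oJ (ord-*ʳ (oδ _) (oδ _))))
            (ord-*ʳ (oδ _) (oδ _))))

      module _ {g : ℕ → ℚ} (og : ∀ n → Ord≥ p 0 (g n))
               (s₄ : IsSomos₄ A B g) (s₅ : IsSomos₅ B J g) (nz : NoAdjacentZeros g) where

        -- If T is a period modulo pᵏ then δ n = (g (n + T) - g n) / pᵏ is itself T-periodic
        -- modulo p, so p steps of length T add up to pᵏ p δ n.
        lift-period : ∀ k T n₀ → windows ! ℕ.∣ T → (∀ m → n₀ ℕ.≤ m → g (m ℕ.+ T) ≡ g m [mod p ^ suc k ]) →
          ∀ m → windows ℕ.+ n₀ ℕ.≤ m → g (m ℕ.+ p ℕ.* T) ≡ g m [mod p ^ suc (suc k) ]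
        lift-period k T n₀ (ℕ.divides t T≡) per m N+n₀≤m =
          subst (λ j → g (j ℕ.+ p ℕ.* T) ≡ g j [mod p ^ suc (suc k) ]) (ℕ.m∸n+n≡m (ℕ.m+n≤o⇒n≤o windows N+n₀≤m))
            (subst (λ x → x ≡ G l [mod p ^ suc (suc k) ]) (cong g (shift-comm l (p ℕ.* T)))
              (≡-trans p-prime (steps p)
                (subst (Ord≥ p (suc (suc k))) (drop (G l) (ι (+ p) * (q * δ l)))
                  (subst (λ x → Ord≥ p (suc (suc k)) x)
                    (trans (cong (_* δ l) (π-suc (suc k))) (*-assoc (ι (+ p)) q (δ l)))
                    (ord-*ʳ (π-ord (suc (suc k))) (oδ l))))))
          where
          q = π (suc k)
          -- The tail from n₀ on, where the congruence holds at every index, so that δ is defined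
          -- everywhere.
          G : ℕ → ℚ
          G n = g (n ℕ.+ n₀)
          l = m ℕ.∸ n₀
          N≤l : windows ℕ.≤ l
          N≤l = subst (ℕ._≤ l) (ℕ.m+n∸n≡m windows n₀) (ℕ.∸-monoˡ-≤ n₀ N+n₀≤m)
          shift-comm : ∀ n t → n ℕ.+ t ℕ.+ n₀ ≡ n ℕ.+ n₀ ℕ.+ t
          shift-comm n t = trans (ℕ.+-assoc n t n₀)
            (trans (cong (n ℕ.+_) (ℕ.+-comm t n₀)) (sym (ℕ.+-assoc n n₀ t)))
          difference : ∀ n → Ord≥ p (suc k) (G (n ℕ.+ T) - G n)
          difference n = subst (λ j → g j ≡ G n [mod p ^ suc k ]) (sym (shift-comm n T))
            (per (n ℕ.+ n₀) (ℕ.m≤n+m n₀ n))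
          δ : ℕ → ℚ
          δ n = proj₁ (ord-quotient (difference n))
          oδ : ∀ n → Ord≥ p 0 (δ n)
          oδ n = proj₁ (proj₂ (ord-quotient (difference n)))
          G-step : ∀ n → G (n ℕ.+ T) ≡ G n + q * δ n
          G-step n = trans (recover (G (n ℕ.+ T)) (G n))
            (cong (λ t → G n + t) (proj₂ (proj₂ (ord-quotient (difference n)))))
            where
            recover : ∀ x y → x ≡ y + (x - y)
            recover = solve 2 (λ x y → x := y :+ (x :- y)) refl
          shifted₄ : IsSomos₄ A B (λ n → G n + q * δ n)
          shifted₄ n = subst₂ _≡_
            (cong₂ _*_ (G-step (4 ℕ.+ n)) (G-step n))
            (cong₂ (λ a b → A * a - B * b) (cong₂ _*_ (G-step (3 ℕ.+ n)) (G-step (1 ℕ.+ n)))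
              (cong₂ _*_ (G-step (2 ℕ.+ n)) (G-step (2 ℕ.+ n))))
            (s₄ (n ℕ.+ T ℕ.+ n₀))
          shifted₅ : IsSomos₅ B J (λ n → G n + q * δ n)
          shifted₅ n = subst₂ _≡_
            (cong₂ _*_ (G-step (5 ℕ.+ n)) (G-step n))
            (cong₂ (λ a b → B * a + J * b) (cong₂ _*_ (G-step (4 ℕ.+ n)) (G-step (1 ℕ.+ n)))
              (cong₂ _*_ (G-step (3 ℕ.+ n)) (G-step (2 ℕ.+ n))))
            (s₅ (n ℕ.+ T ℕ.+ n₀))
          open Tangent oA oB oJ {G} {δ} (λ n → og (n ℕ.+ n₀)) oδ (λ n → s₄ (n ℕ.+ n₀)) (λ n → s₅ (n ℕ.+ n₀))
            (λ n → nz (n ℕ.+ n₀))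
            (perturbation-tangent₄ k oδ (λ n → s₄ (n ℕ.+ n₀)) shifted₄)
            (perturbation-tangent₅ k oδ (λ n → s₅ (n ℕ.+ n₀)) shifted₅)
            using (period-δ)
          drop : ∀ x y → y ≡ x + y - x
          drop = solve 2 (λ x y → y := x :+ y :- x) refl
          δ-step : ∀ j → δ (l ℕ.+ j ℕ.* T) ≡ δ l [mod p ^ 1 ]
          δ-step j = subst (λ s → δ (l ℕ.+ s) ≡ δ l [mod p ^ 1 ])
            (trans (ℕ.*-assoc j t (windows !)) (cong (j ℕ.*_) (sym T≡)))
            (period-δ (j ℕ.* t) l N≤l)
          steps : ∀ j → G (l ℕ.+ j ℕ.* T) ≡ G l + ι (+ j) * (q * δ l) [mod p ^ suc (suc k) ]
          steps zero    = exact
            (trans (cong G (ℕ.+-identityʳ l))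
            (sym (trans (cong (λ t → G l + t * (q * δ l)) ι-0) (vanish (G l) (q * δ l)))))
            where
            vanish : ∀ x y → x + 0ℚ * y ≡ x
            vanish = solve 2 (λ x y → x :+ con 0ℚ :* y := x) refl
          steps (suc j) = ≡-trans p-prime
            (exact (trans (cong G (trans (cong (l ℕ.+_) (ℕ.+-comm T (j ℕ.* T)))
              (sym (ℕ.+-assoc l (j ℕ.* T) T)))) (G-step (l ℕ.+ j ℕ.* T))))
            (≡-trans p-prime (≡-+ p-prime (steps j) scaled)
              (exact (trans (collect (G l) (ι (+ j)) (q * δ l)) (cong (λ t → G l + t * (q * δ l)) ι-suc))))
            where
            scaled : q * δ (l ℕ.+ j ℕ.* T) ≡ q * δ l [mod p ^ suc (suc k) ]
            scaled = subst₂ (λ e x → Ord≥ p e x) (ℕ.+-comm (suc k) 1) (distrib q (δ (l ℕ.+ j ℕ.* T)) (δ l))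
              (ord-π* {1} {suc k} (δ-step j))
              where
              distrib : ∀ q x y → q * (x - y) ≡ q * x - q * y
              distrib = solve 3 (λ q x y → q :* (x :- y) := q :* x :- q :* y) refl
            collect : ∀ x j y → x + j * y + y ≡ x + (1ℚ + j) * y
            collect = solve 3 (λ x j y → x :+ j :* y :+ y := x :+ (con 1ℚ :+ j) :* y) refl
            ι-suc : 1ℚ + ι (+ j) ≡ ι (+ suc j)
            ι-suc = sym (trans (ι-+ 1ℤ (+ j)) (cong (_+ ι (+ j)) ι-1))

        somos-period : ∀ k → ∃[ n₀ ] ∀ m → n₀ ℕ.≤ m → g (m ℕ.+ period k) ≡ g m [mod p ^ suc k ]
        somos-period zero    = windows , λ m N≤m → subst (λ t → g (m ℕ.+ t) ≡ g m [mod p ^ 1 ])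
          (ℕ.*-comm 1 (windows !)) (period-g 1 m N≤m)
          where
          -- At the lowest level no earlier period supplies differences; δ = 0 solves the linearised
          -- relations and leaves the windows of g alone.
          open Tangent oA oB oJ {g} {λ _ → 0ℚ} og (λ _ → 0-ord 0) s₄ s₅ nz
            (λ n → exact (zero₄ A B (g n) (g (1 ℕ.+ n)) (g (2 ℕ.+ n)) (g (3 ℕ.+ n)) (g (4 ℕ.+ n))))
            (λ n → exact (zero₅ B J (g n) (g (1 ℕ.+ n)) (g (2 ℕ.+ n)) (g (3 ℕ.+ n)) (g (4 ℕ.+ n))
              (g (5 ℕ.+ n))))
            using (period-g)
        somos-period (suc k) =
          let n₀ , per = somos-period k in
          windows ℕ.+ n₀ , λ m le → subst (λ t → g (m ℕ.+ t) ≡ g m [mod p ^ suc (suc k) ])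
            (period-suc p (windows !) (p ℕ.^ k))
            (lift-period k (period k) n₀ (ℕ.m∣m*n (p ℕ.^ k)) per m le)
          where
          period-suc : ∀ p w q → p ℕ.* (w ℕ.* q) ≡ w ℕ.* (p ℕ.* q)
          period-suc p w q = trans (sym (ℕ.*-assoc p w q))
            (trans (cong (ℕ._* q) (ℕ.*-comm p w)) (ℕ.*-assoc w p q))

  -- Limits along m qⁱ

  %-≡⇒∣∸ : ∀ m n d .{{_ : ℕ.NonZero d}} → m ℕ.% d ≡ n ℕ.% d → d ℕ.∣ n ℕ.∸ m
  %-≡⇒∣∸ m n d eq = ℕ.divides (n ℕ./ d ℕ.∸ m ℕ./ d) (begin
    n ℕ.∸ m
      ≡⟨ cong₂ ℕ._∸_ (ℕ.m≡m%n+[m/n]*n n d) (ℕ.m≡m%n+[m/n]*n m d) ⟩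
    (n ℕ.% d ℕ.+ n ℕ./ d ℕ.* d) ℕ.∸ (m ℕ.% d ℕ.+ m ℕ./ d ℕ.* d)
      ≡⟨ cong (λ r → (n ℕ.% d ℕ.+ n ℕ./ d ℕ.* d) ℕ.∸ (r ℕ.+ m ℕ./ d ℕ.* d)) eq ⟩
    (n ℕ.% d ℕ.+ n ℕ./ d ℕ.* d) ℕ.∸ (n ℕ.% d ℕ.+ m ℕ./ d ℕ.* d)
      ≡⟨ ℕ.[m+n]∸[m+o]≡n∸o (n ℕ.% d) (n ℕ./ d ℕ.* d) (m ℕ./ d ℕ.* d) ⟩
    n ℕ./ d ℕ.* d ℕ.∸ m ℕ./ d ℕ.* d
      ≡⟨ ℕ.*-distribʳ-∸ d (n ℕ./ d) (m ℕ./ d) ⟨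
    (n ℕ./ d ℕ.∸ m ℕ./ d) ℕ.* d                                          ∎)
    where open ≡-Reasoning

  -- Two of the powers p⁰, ..., pᵀ agree modulo T, and the smaller one factors out of their
  -- difference. The factor pᵃ absorbs the part of T that is not prime to p.
  power-congruence : ∀ p T .{{_ : ℕ.NonZero T}} → ∃[ a ] ∃[ N ] N ℕ.≥ 1 × T ℕ.∣ p ℕ.^ a ℕ.* (p ℕ.^ N ℕ.∸ 1)
  power-congruence p T
    with i , j , i<j , eq ← Fin.pigeonhole (ℕ.n<1+n T) (λ i → fromℕ< (ℕ.m%n<n (p ℕ.^ toℕ i) T))
    = toℕ i , N , ℕ.m<n⇒0<n∸m i<j , subst (T ℕ.∣_) difference
        (%-≡⇒∣∸ (p ℕ.^ toℕ i) (p ℕ.^ toℕ j) T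
          (trans (sym (Fin.toℕ-fromℕ< _)) (trans (cong toℕ eq) (Fin.toℕ-fromℕ< _))))
    where
    N = toℕ j ℕ.∸ toℕ i
    difference : p ℕ.^ toℕ j ℕ.∸ p ℕ.^ toℕ i ≡ p ℕ.^ toℕ i ℕ.* (p ℕ.^ N ℕ.∸ 1)
    difference = begin
      p ℕ.^ toℕ j ℕ.∸ p ℕ.^ toℕ i
        ≡⟨ cong (λ s → p ℕ.^ s ℕ.∸ p ℕ.^ toℕ i) (ℕ.m+[n∸m]≡n (ℕ.<⇒≤ i<j)) ⟨
      p ℕ.^ (toℕ i ℕ.+ N) ℕ.∸ p ℕ.^ toℕ i
        ≡⟨ cong₂ ℕ._∸_ (ℕ.^-distribˡ-+-* p (toℕ i) N) (sym (ℕ.*-identityʳ (p ℕ.^ toℕ i))) ⟩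
      p ℕ.^ toℕ i ℕ.* p ℕ.^ N ℕ.∸ p ℕ.^ toℕ i ℕ.* 1    ≡⟨ ℕ.*-distribˡ-∸ (p ℕ.^ toℕ i) (p ℕ.^ N) 1 ⟨
      p ℕ.^ toℕ i ℕ.* (p ℕ.^ N ℕ.∸ 1)                  ∎
      where open ≡-Reasoning

  module Limit {p : ℕ} (p-prime : Prime p) where

    open Local p-prime

    -- Congruence of consecutive terms suffices because congruence modulo pᵏ is transitive; the
    -- residue modulo pᵏ is that of a single late term.
    cauchy⇒converges : ∀ {w : ℕ → ℚ} → (∀ i → Ord≥ p 0 (w i)) →
      (∀ k → ∃[ i₀ ] ∀ i → i₀ ℕ.≤ i → w (suc i) ≡ w i [mod p ^ k ]) → ∃[ ℓ ] Converges p w ℓ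
    cauchy⇒converges {w} ow cauchy = ℓ , λ k → i₀ k , λ i i₀≤i →
        subst (Ord≥ p k) (sym (bridge (w i) (r k))) (to-residue k i i₀≤i)
      where
      i₀ : ℕ → ℕ
      i₀ k = proj₁ (cauchy k)
      r : ℕ → ℤ
      r k = proj₁ (approximate (ow (i₀ k)) k)
      constant : ∀ k s → w (s ℕ.+ i₀ k) ≡ w (i₀ k) [mod p ^ k ]
      constant k zero    = ≡-refl p-prime
      constant k (suc s) = ≡-trans p-prime (proj₂ (cauchy k) (s ℕ.+ i₀ k) (ℕ.m≤n+m (i₀ k) s)) (constant k s)
      to-residue : ∀ k i → i₀ k ℕ.≤ i → w i ≡ ι (r k) [mod p ^ k ]
      to-residue k i i₀≤i = ≡-trans p-prime
        (subst (λ j → w j ≡ w (i₀ k) [mod p ^ k ]) (ℕ.m∸n+n≡m i₀≤i) (constant k (i ℕ.∸ i₀ k)))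
        (proj₂ (approximate (ow (i₀ k)) k))
      -- Both residues are compared with a term late enough for both moduli.
      coherence : ∀ k → ι (r (suc k)) ≡ ι (r k) [mod p ^ k ]
      coherence k = ≡-trans p-prime
        (≡-sym p-prime (ord-≤ (ℕ.n≤1+n k) (to-residue (suc k) i (ℕ.m≤n⊔m (i₀ k) (i₀ (suc k))))))
        (to-residue k i (ℕ.m≤m⊔n (i₀ k) (i₀ (suc k))))
        where i = i₀ k ℕ.⊔ i₀ (suc k)
      bridge : ∀ x z → x ℚ.- z ℚ./ 1 ≡ x - ι z
      bridge x z = trans (cong (λ t → x ℚ.- t) (sym (ι-/1 z)))
        (trans (+-unseal x (ℚ.- ι z)) (cong (λ t → x + t) (neg-unseal (ι z))))
      ℓ : ℤₚ p
      ℓ = record { residue = r ; coherent = λ k → ord-ι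
        (subst (Ord≥ p k) (sym (ι-- (r (suc k)) (r k))) (coherence k)) }

    periodic⇒converges : ∀ {w : ℕ → ℚ} → (∀ i → Ord≥ p 0 (w i)) → ∀ T .{{_ : ℕ.NonZero T}} →
      (∀ k → ∃[ n₀ ] ∀ m → n₀ ℕ.≤ m → w (m ℕ.+ T ℕ.* p ℕ.^ k) ≡ w m [mod p ^ k ]) →
      ∃[ N ] (N ℕ.≥ 1 × (∀ m → m ℕ.≥ 1 → ∃[ ℓ ] Converges p (λ i → w (m ℕ.* (p ℕ.^ N) ℕ.^ i)) ℓ))
    periodic⇒converges {w} ow T per with power-congruence p T
    ... | a , N , N≥1 , ℕ.divides c a-divides = N , N≥1 , λ m m≥1 → cauchy⇒converges (λ i → ow _) (cauchy m m≥1)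
      where
      q = p ℕ.^ N
      1<q : 1 ℕ.< q
      1<q = ℕ.≤-trans 1<p (subst (ℕ._≤ q) (ℕ.*-identityʳ p) (ℕ.^-monoʳ-≤ p N≥1))
      module _ (m : ℕ) (m≥1 : m ℕ.≥ 1) where
        i≤mqⁱ : ∀ i → i ℕ.≤ m ℕ.* q ℕ.^ i
        i≤mqⁱ i = ℕ.≤-trans (ℕ.<⇒≤ (n<m^n 1<q i)) (subst (ℕ._≤ m ℕ.* q ℕ.^ i) (ℕ.*-identityˡ _)
          (ℕ.*-monoˡ-≤ (q ℕ.^ i) m≥1))
        jump : ∀ k i → a ℕ.+ k ℕ.≤ i → ∃[ t ] m ℕ.* q ℕ.^ suc i ≡ m ℕ.* q ℕ.^ i ℕ.+ t ℕ.* (T ℕ.* p ℕ.^ k)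
        -- From qⁱ = pᵃ pᵏ e and pᵃ (q - 1) = c T: the difference m qⁱ (q - 1) equals m e c times T
        -- pᵏ.
        jump k i a+k≤i = m ℕ.* e ℕ.* c , (begin
            m ℕ.* (q ℕ.* qⁱ)
              ≡⟨ cong (λ s → m ℕ.* (s ℕ.* qⁱ)) (ℕ.m+[n∸m]≡n (ℕ.<⇒≤ 1<q)) ⟨
            m ℕ.* ((1 ℕ.+ (q ℕ.∸ 1)) ℕ.* qⁱ)
              ≡⟨ cong (λ s → m ℕ.* (qⁱ ℕ.+ (q ℕ.∸ 1) ℕ.* s)) qⁱ≡ ⟩
            m ℕ.* (qⁱ ℕ.+ (q ℕ.∸ 1) ℕ.* (pᵃ ℕ.* pᵏ ℕ.* e))         ≡⟨ eq₁ m qⁱ (q ℕ.∸ 1) pᵃ pᵏ e ⟩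
            m ℕ.* qⁱ ℕ.+ m ℕ.* e ℕ.* (pᵃ ℕ.* (q ℕ.∸ 1) ℕ.* pᵏ)
              ≡⟨ cong (λ s → m ℕ.* qⁱ ℕ.+ m ℕ.* e ℕ.* (s ℕ.* pᵏ)) a-divides ⟩
            m ℕ.* qⁱ ℕ.+ m ℕ.* e ℕ.* (c ℕ.* T ℕ.* pᵏ)              ≡⟨ eq₂ m qⁱ e c T pᵏ ⟩
            m ℕ.* qⁱ ℕ.+ m ℕ.* e ℕ.* c ℕ.* (T ℕ.* pᵏ)              ∎)
          where
          open ≡-Reasoning
          open Data.Nat.Solver.+-*-Solver using () renaming
            (solve to solveℕ; _:=_ to _≔_; _:+_ to _⊕_; _:*_ to _⊗_)
          qⁱ pᵃ pᵏ e : ℕ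
          qⁱ = q ℕ.^ i
          pᵃ = p ℕ.^ a
          pᵏ = p ℕ.^ k
          e  = p ℕ.^ (N ℕ.* i ℕ.∸ (a ℕ.+ k))
          a+k≤Ni : a ℕ.+ k ℕ.≤ N ℕ.* i
          a+k≤Ni = ℕ.≤-trans a+k≤i (subst (ℕ._≤ N ℕ.* i) (ℕ.*-identityˡ i) (ℕ.*-monoˡ-≤ i N≥1))
          qⁱ≡ : qⁱ ≡ pᵃ ℕ.* pᵏ ℕ.* e
          qⁱ≡ = begin
            (p ℕ.^ N) ℕ.^ i                                      ≡⟨ ℕ.^-*-assoc p N i ⟩
            p ℕ.^ (N ℕ.* i)                                      ≡⟨ cong (p ℕ.^_) (ℕ.m+[n∸m]≡n a+k≤Ni) ⟨
            p ℕ.^ (a ℕ.+ k ℕ.+ (N ℕ.* i ℕ.∸ (a ℕ.+ k)))          ≡⟨ ℕ.^-distribˡ-+-* p (a ℕ.+ k) _ ⟩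
            p ℕ.^ (a ℕ.+ k) ℕ.* e                                ≡⟨ cong (ℕ._* e) (ℕ.^-distribˡ-+-* p a k) ⟩
            pᵃ ℕ.* pᵏ ℕ.* e                                      ∎
          eq₁ : ∀ m x y u v e → m ℕ.* (x ℕ.+ y ℕ.* (u ℕ.* v ℕ.* e)) ≡ m ℕ.* x ℕ.+ m ℕ.* e ℕ.* (u ℕ.* y ℕ.* v)
          eq₁ = solveℕ 6 (λ m x y u v e → m ⊗ (x ⊕ y ⊗ (u ⊗ v ⊗ e)) ≔ m ⊗ x ⊕ m ⊗ e ⊗ (u ⊗ y ⊗ v)) refl
          eq₂ : ∀ m x e c t v → m ℕ.* x ℕ.+ m ℕ.* e ℕ.* (c ℕ.* t ℕ.* v)
            ≡ m ℕ.* x ℕ.+ m ℕ.* e ℕ.* c ℕ.* (t ℕ.* v)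
          eq₂ = solveℕ 6 (λ m x e c t v → m ⊗ x ⊕ m ⊗ e ⊗ (c ⊗ t ⊗ v) ≔ m ⊗ x ⊕ m ⊗ e ⊗ c ⊗ (t ⊗ v)) refl
        cauchy : ∀ k → ∃[ i₀ ] ∀ i → i₀ ℕ.≤ i → w (m ℕ.* q ℕ.^ suc i) ≡ w (m ℕ.* q ℕ.^ i) [mod p ^ k ]
        -- The summand a + k makes pᵃ⁺ᵏ divide qⁱ, and n₀ puts m qⁱ, which is at least i, beyond the
        -- preperiod.
        cauchy k = n₀ ℕ.+ (a ℕ.+ k) , λ i i₀≤i →
          let t , eq = jump k i (ℕ.≤-trans (ℕ.m≤n+m (a ℕ.+ k) n₀) i₀≤i) in
          subst (λ n → w n ≡ w (m ℕ.* q ℕ.^ i) [mod p ^ k ]) (sym eq)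
            (iterate-period (λ x y → w x ≡ w y [mod p ^ k ]) (≡-refl p-prime) (≡-trans p-prime)
              (proj₂ (per k)) t (m ℕ.* q ℕ.^ i) (ℕ.≤-trans (ℕ.≤-trans (ℕ.m≤m+n n₀ (a ℕ.+ k)) i₀≤i) (i≤mqⁱ i)))
          where n₀ = proj₁ (per k)

  -- The chord-tangent law modulo p

  -- With solver syntax as a raw ring, the definitions for Weierstrass cubics themselves generate
  -- the identity to be checked.
  polynomials : ℕ → RawRing 0ℓ 0ℓ
  polynomials n = record
    { Carrier = Polynomial n ; _≈_ = _≡_ ; _+_ = _:+_ ; _*_ = _:*_ ; -_ = :-_ ; 0# = con 0ℚ ; 1# = con 1ℚ }

  numerator = TangentNumerator.numerator rawRing

  -- (x(2P) - x(P)) β₁(P)² = - β₂(P) on the curve.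
  duplication : ∀ (E : Weierstrass ℚ) x y → let open Weierstrass E; N = numerator E x y; D = W.β₁ E x y in
    W.lhs E x y ≡ W.rhs E x y →
    N * N + a₁ * (N * D) - (a₂ + x + x + x) * (D * D) ≡ - W.β₂ E x y
  duplication E@(weierstrass a₁ a₂ a₃ a₄ a₆) x y on =
    trans (identity a₁ a₂ a₃ a₄ a₆ x y) (trans
      (cong (λ t → - (W.b₂ E + c x) * (t - W.rhs E x y) - W.β₂ E x y) on)
      (cancel (W.b₂ E + c x) (W.rhs E x y) (W.β₂ E x y)))
    where
    -- This is 12 x. The left side of the formula has y²-coefficient -(b₂ + 12 x), which forces the
    -- cofactor of the curve equation.
    c : ℚ → ℚ
    c x = (x + x + x) + (x + x + x) + (x + x + x) + (x + x + x)
    cancel : ∀ b r β → - b * (r - r) - β ≡ - β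
    cancel = solve 3 (λ b r β → (:- b) :* (r :- r) :- β := :- β) refl
    identity : ∀ a₁ a₂ a₃ a₄ a₆ x y → let E = weierstrass a₁ a₂ a₃ a₄ a₆; N = numerator E x y; D = W.β₁ E x y in
      N * N + a₁ * (N * D) - (a₂ + x + x + x) * (D * D) ≡
      - (W.b₂ E + c x) * (W.lhs E x y - W.rhs E x y) - W.β₂ E x y
    identity = solve 7 (λ a₁ a₂ a₃ a₄ a₆ x y →
      let E = weierstrass a₁ a₂ a₃ a₄ a₆
          module P = WeierstrassPolynomials (polynomials 7) E
          N = TangentNumerator.numerator (polynomials 7) E x y
          D = P.β₁ x y
          c = (x :+ x :+ x) :+ (x :+ x :+ x) :+ (x :+ x :+ x) :+ (x :+ x :+ x)
      in N :* N :+ a₁ :* (N :* D) :- (a₂ :+ x :+ x :+ x) :* (D :* D)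
         := (:- (P.b₂ :+ c)) :* (P.lhs x y :- P.rhs x y) :- P.β₂ x y) refl

  module _ {p : ℕ} (p-prime : Prime p) where

    open Local p-prime

    -- With slope N z, the difference x(2P) - x(P) is z² times the left side of the duplication
    -- formula, up to a multiple of D z - 1. Here z inverts D only modulo p, so D z cannot be
    -- replaced by 1 outright.
    tangent-fixes-x : ∀ {a₁ a₂ x N D z} → Ord≥ p 0 a₁ → Ord≥ p 0 a₂ → Ord≥ p 0 x → Ord≥ p 0 N → Ord≥ p 0 D →
      Ord≥ p 0 z →
      D * z ≡ 1ℚ [mod p ^ 1 ] → Ord≥ p 1 (N * N + a₁ * (N * D) - (a₂ + x + x + x) * (D * D)) →
      (N * z) * ((N * z) * 1ℚ) + a₁ * (N * z) - a₂ - x - x ≡ x [mod p ^ 1 ]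
    tangent-fixes-x {a₁} {a₂} {x} {N} {D} {z} oa₁ oa₂ ox oN oD oz Dz≡1 o =
      subst (Ord≥ p 1) (eq a₁ a₂ x N D z)
        (ord-- (ord-*ˡ (ord-*ʳ oz oz) o)
          (ord-*ʳ Dz≡1 (ord-- (ord-*ʳ oa₁ (ord-*ʳ oN oz))
            (ord-*ʳ (ord-+ (ord-+ (ord-+ oa₂ ox) ox) ox) (ord-+ 1-integral (ord-*ʳ oD oz))))))
      where
      eq : ∀ a₁ a₂ x N D z →
        (z * z) * (N * N + a₁ * (N * D) - (a₂ + x + x + x) * (D * D))
          - (D * z - 1ℚ) * (a₁ * (N * z) - (a₂ + x + x + x) * (1ℚ + D * z))
        ≡ (N * z) * ((N * z) * 1ℚ) + a₁ * (N * z) - a₂ - x - x - x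
      eq = solve 6 (λ a₁ a₂ x N D z →
        (z :* z) :* (N :* N :+ a₁ :* (N :* D) :- (a₂ :+ x :+ x :+ x) :* (D :* D))
          :- (D :* z :- con 1ℚ) :* (a₁ :* (N :* z) :- (a₂ :+ x :+ x :+ x) :* (con 1ℚ :+ D :* z))
        := (N :* z) :* ((N :* z) :* con 1ℚ) :+ a₁ :* (N :* z) :- a₂ :- x :- x :- x) refl

    -- If the third abscissa x₃ were integral, u (u (x₃ + a₂ + x₁ + x₂) - a₁ t) = t² would be
    -- divisible by p. So a chord whose slope t / u has a pole at p leads to a point reducing to 𝒪.
    steep-chord : ∀ {a₁ a₂ x₁ x₂ t u z} → Ord≥ p 0 a₁ → Ord≥ p 0 a₂ → Ord≥ p 0 x₁ → Ord≥ p 0 x₂ → Ord≥ p 0 t →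
      ¬ Ord≥ p 1 t → Ord≥ p 1 u → u * z ≡ 1ℚ →
      ¬ Ord≥ p 0 ((t * z) * ((t * z) * 1ℚ) + a₁ * (t * z) - a₂ - x₁ - x₂)
    steep-chord {a₁} {a₂} {x₁} {x₂} {t} {u} {z} oa₁ oa₂ ox₁ ox₂ ot ¬ot ou uz≡1 ox₃ =
      unit-* ot ¬ot ot ¬ot (subst (Ord≥ p 1) (begin
        u * (u * (x₃ + a₂ + x₁ + x₂) - a₁ * t)
          ≡⟨ eq₁ a₁ a₂ x₁ x₂ t u z ⟩
        t * t * ((u * z) * (u * z)) + a₁ * t * u * (u * z - 1ℚ)
          ≡⟨ cong (λ s → t * t * (s * s) + a₁ * t * u * (s - 1ℚ)) uz≡1 ⟩
        t * t * (1ℚ * 1ℚ) + a₁ * t * u * (1ℚ - 1ℚ)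
          ≡⟨ eq₂ a₁ t u ⟩
        t * t ∎)
        (ord-*ʳ ou (ord-- (ord-*ʳ (ord⇒integral ou) (ord-+ (ord-+ (ord-+ ox₃ oa₂) ox₁) ox₂)) (ord-*ʳ oa₁ ot))))
      where
      open ≡-Reasoning
      x₃ = (t * z) * ((t * z) * 1ℚ) + a₁ * (t * z) - a₂ - x₁ - x₂
      eq₁ : ∀ a₁ a₂ x₁ x₂ t u z →
        u * (u * ((t * z) * ((t * z) * 1ℚ) + a₁ * (t * z) - a₂ - x₁ - x₂ + a₂ + x₁ + x₂) - a₁ * t) ≡
        t * t * ((u * z) * (u * z)) + a₁ * t * u * (u * z - 1ℚ)
      eq₁ = solve 7 (λ a₁ a₂ x₁ x₂ t u z →
        u :* (u :* ((t :* z) :* ((t :* z) :* con 1ℚ) :+ a₁ :* (t :* z) :- a₂ :- x₁ :- x₂ :+ a₂ :+ x₁ :+ x₂) :-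
          a₁ :* t) :=
        t :* t :* ((u :* z) :* (u :* z)) :+ a₁ :* t :* u :* (u :* z :- con 1ℚ)) refl
      eq₂ : ∀ a₁ t u → t * t * (1ℚ * 1ℚ) + a₁ * t * u * (1ℚ - 1ℚ) ≡ t * t
      eq₂ = solve 3 (λ a₁ t u → t :* t :* (con 1ℚ :* con 1ℚ) :+ a₁ :* t :* u :* (con 1ℚ :- con 1ℚ) := t :* t)
        refl

  module Gℚ = GroupLawProperties ℚ.heytingField (λ x y → ¬? (x ℚ.≟ y))

  reciprocal : ∀ {u} → u ≢ 0ℚ → u * u ⁻¹ℚ ≡ 1ℚ
  reciprocal {u} u≢0 = trans (sym (*-unseal u (u ⁻¹ℚ)))
    (trans (cong (ℚ._* (u ⁻¹ℚ)) (sym (ℚ.+-identityʳ u))) (Gℚ.inverseʳ u≢0))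

  module ReductionProperties {p : ℕ} (p-prime : Prime p) (E : Weierstrass ℚ) (integral-E : IntegralCoefficients p E) where

    open Local p-prime
    open Reduction p-prime E integral-E
    open Weierstrass E
    open IntegralCoefficients integral-E
    module G = GroupLawProperties (𝔽.heytingField p-prime) (𝔽._#?_ p-prime)

    reduce-affine : ∀ {x y} → reduce ⟨ x , y ⟩ ≢ 𝒪 →
                    ∃[ ox ] ∃[ oy ] reduce ⟨ x , y ⟩ ≡ ⟨ (x , ox) , (y , oy) ⟩
    reduce-affine {x} {y} ≢𝒪 with ord≥? p 0 x | ord≥? p 0 y
    ... | yes ox | yes oy = ox , oy , refl
    ... | yes _  | no _   = ⊥-elim (≢𝒪 refl)
    ... | no _   | yes _  = ⊥-elim (≢𝒪 refl)
    ... | no _   | no _   = ⊥-elim (≢𝒪 refl)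

    reduce-nonintegral : ∀ {x y} → ¬ Ord≥ p 0 x → reduce ⟨ x , y ⟩ ≡ 𝒪
    reduce-nonintegral {x} {y} ¬ox with ord≥? p 0 x | ord≥? p 0 y
    ... | yes ox | _      = ⊥-elim (¬ox ox)
    ... | no _   | yes _  = refl
    ... | no _   | no _   = refl

    private
      -- `y + (y + 0ℚ)` is what `2 · y` unfolds to, and the final `- 0ℚ` comes from congruence to
      -- `0#`.
      doubled : ∀ a₁ a₃ x y → (y + (y + 0ℚ)) + a₁ * x + a₃ ≡ y + y + a₁ * x + a₃ - 0ℚ
      doubled = solve 4 (λ a₁ a₃ x y → (y :+ (y :+ con 0ℚ)) :+ a₁ :* x :+ a₃ :=
        y :+ y :+ a₁ :* x :+ a₃ :- con 0ℚ) refl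

      reflected : ∀ a₁ a₃ x y s x₃ → - (s * (x₃ - x))
        ≡ y + (- (s * (x₃ - x) + y) - a₁ * x₃ - a₃) + a₁ * x₃ + a₃ - 0ℚ
      reflected = solve 6 (λ a₁ a₃ x y s x₃ → :- (s :* (x₃ :- x)) :=
        y :+ (:- (s :* (x₃ :- x) :+ y) :- a₁ :* x₃ :- a₃) :+ a₁ :* x₃ :+ a₃ :- con 0ℚ) refl

      minus-0 : ∀ x → x - 0ℚ ≡ x
      minus-0 = solve 1 (λ x → x :- con 0ℚ := x) refl

    module _ {x y : ℚ} (ox : Ord≥ p 0 x) (oy : Ord≥ p 0 y) where

      private
        X Y : ℤ₍ p ₎
        X = x , ox
        Y = y , oy

      opaque
        unfolding _+_

        -- β₁ is the difference of the ordinates of P and -P; if p divided it, these points would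
        -- coincide modulo p and 2 P would be 𝒪.
        order>2⇒β₁-unit : ∀ {r} → G.HasOrder Ẽ ⟨ X , Y ⟩ r → 2 ℕ.< r → ¬ Ord≥ p 1 (W.β₁ E x y)
        order>2⇒β₁-unit (_ , _ , minimal) 2<r o = minimal 2 (ℕ.s≤s ℕ.z≤n) 2<r
          (G.add-opposite Ẽ {X} {Y} {X} {Y} (≡-refl p-prime {1} {x}) (subst (Ord≥ p 1) (doubled a₁ a₃ x y) o))

        -- By the duplication formula, p dividing β₂ forces x(2P) ≡ x(P). The tangent then meets the
        -- cubic a third time at P itself, so P is a flex modulo p: 2 P = -P and 3 P = 𝒪.
        order>3⇒β₂-unit : W.lhs E x y ≡ W.rhs E x y →
                          ∀ {r} → G.HasOrder Ẽ ⟨ X , Y ⟩ r → 3 ℕ.< r → ¬ Ord≥ p 1 (W.β₂ E x y)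
        order>3⇒β₂-unit on ord@(_ , _ , minimal) 3<r o = minimal 3 (ℕ.s≤s ℕ.z≤n) 3<r
          (trans (cong (G.add Ẽ ⟨ X , Y ⟩) (G.double-tangent Ẽ {X} {Y} (≡-refl p-prime {1} {x}) s#0))
                 (G.add-opposite Ẽ {X} {Y} {X₃} {Y₃} (≡-sym p-prime {1} {x₃} {x} x₃≡x)
                   (subst (Ord≥ p 1) (reflected a₁ a₃ x y s x₃) (ord-neg (ord-*ˡ (integral S) x₃≡x)))))
          where
          ¬oβ₁ : ¬ Ord≥ p 1 (W.β₁ E x y)
          ¬oβ₁ = order>2⇒β₁-unit ord (ℕ.<-trans (ℕ.n<1+n 2) 3<r)
          s#0 : ¬ Ord≥ p 1 (y + y + a₁ * x + a₃ - 0ℚ)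
          s#0 os = ¬oβ₁ (subst (Ord≥ p 1) (sym (doubled a₁ a₃ x y)) os)
          module F = WeierstrassPolynomials (fieldRawRing (𝔽.heytingField p-prime)) Ẽ
          D N Z S X₃ Y₃ : ℤ₍ p ₎
          D = F.β₁ X Y
          N = TangentNumerator.numerator (fieldRawRing (𝔽.heytingField p-prime)) Ẽ X Y
          Z = D G.⁻¹
          S = G.tangent Ẽ X Y
          X₃ = G.x-third Ẽ S X X
          Y₃ = G.y-third Ẽ S X Y X
          s x₃ z : ℚ
          s = value S
          x₃ = value X₃
          z = value Z
          Dz≡1 : W.β₁ E x y * z ≡ 1ℚ [mod p ^ 1 ]
          Dz≡1 = subst (λ d → d * z ≡ 1ℚ [mod p ^ 1 ]) (minus-0 (W.β₁ E x y))
            (G.inverseʳ {D} (λ D≈0 → ¬oβ₁ (subst (Ord≥ p 1) (minus-0 (W.β₁ E x y)) D≈0)))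
          x₃≡x : x₃ ≡ x [mod p ^ 1 ]
          x₃≡x = tangent-fixes-x p-prime {a₁} {a₂} {x} {numerator E x y} {W.β₁ E x y} {z}
            a₁∈ a₂∈ ox (integral N) (integral D) (integral Z) Dz≡1
            (subst (Ord≥ p 1) (sym (duplication E x y on)) (ord-neg o))

    private
      integral-domain : ∀ {x y} → x * y ≡ 0ℚ → x ≡ 0ℚ ⊎ y ≡ 0ℚ
      integral-domain {x} {y} xy≡0 with x ℚ.≟ 0ℚ
      ... | yes x≡0 = inj₁ x≡0
      ... | no  x≢0 = inj₂ (*-cancelˡ x x≢0 (trans xy≡0 (sym (zeroʳ x))))

      difference-zero : ∀ {x y} → x - y ≡ 0ℚ → x ≡ y
      difference-zero {x} {y} e = trans (eq x y) (trans (cong (_+ y) e) (+-identityˡ y))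
        where
        eq : ∀ x y → x ≡ (x - y) + y
        eq = solve 2 (λ x y → x := (x :- y) :+ y) refl

      -- Two points of the curve with the same abscissa are equal or opposite.
      conjugate : ∀ {x y₁ y₂} → W.lhs E x y₁ ≡ W.rhs E x y₁ → W.lhs E x y₂ ≡ W.rhs E x y₂ →
                  (y₁ - y₂) * (y₂ + y₁ + a₁ * x + a₃) ≡ 0ℚ
      conjugate {x} {y₁} {y₂} on₁ on₂ = trans (eq a₁ a₃ x y₁ y₂)
        (trans (cong (_- W.lhs E x y₂) (trans on₁ (sym on₂))) (-‿inverseʳ _))
        where
        eq : ∀ a₁ a₃ x y₁ y₂ → (y₁ - y₂) * (y₂ + y₁ + a₁ * x + a₃) ≡
          (y₁ * (y₁ * 1ℚ) + a₁ * x * y₁ + a₃ * y₁) - (y₂ * (y₂ * 1ℚ) + a₁ * x * y₂ + a₃ * y₂)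
        eq = solve 5 (λ a₁ a₃ x y₁ y₂ → (y₁ :- y₂) :* (y₂ :+ y₁ :+ a₁ :* x :+ a₃) :=
          (y₁ :* (y₁ :* con 1ℚ) :+ a₁ :* x :* y₁ :+ a₃ :* y₁) :-
            (y₂ :* (y₂ :* con 1ℚ) :+ a₁ :* x :* y₂ :+ a₃ :* y₂)) refl

      opposite : ∀ a₁ a₃ x y → y + (- y - a₁ * x - a₃) + a₁ * x + a₃ ≡ 0ℚ
      opposite = solve 4 (λ a₁ a₃ x y → y :+ (:- y :- a₁ :* x :- a₃) :+ a₁ :* x :+ a₃ := con 0ℚ) refl

      β₁-split : ∀ a₁ a₃ x y₁ y₂ → (y₁ - y₂) - ((- y₁ - a₁ * x - a₃) - y₂) ≡ (y₁ + (y₁ + 0ℚ)) + a₁ * x + a₃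
      β₁-split = solve 5 (λ a₁ a₃ x y₁ y₂ → (y₁ :- y₂) :- ((:- y₁ :- a₁ :* x :- a₃) :- y₂) :=
        (y₁ :+ (y₁ :+ con 0ℚ)) :+ a₁ :* x :+ a₃) refl

    module _ {x₁ y₁ x₂ y₂ : ℚ} (ox₁ : Ord≥ p 0 x₁) (oy₁ : Ord≥ p 0 y₁) (ox₂ : Ord≥ p 0 x₂) (oy₂ : Ord≥ p 0 y₂) where

      opaque
        unfolding _+_

        chord-reduces-to-𝒪 : ∀ {y} → Ord≥ p 0 y → x₂ ≢ x₁ → Ord≥ p 1 (x₁ - x₂) → ¬ Ord≥ p 1 (y - y₂) →
                             reduce (addℚ E ⟨ x₂ , y₂ ⟩ ⟨ x₁ , y ⟩) ≡ 𝒪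
        chord-reduces-to-𝒪 {y} oy x₂≢x₁ ou ¬ot =
          trans (cong reduce (Gℚ.add-chord E {x₂} {y₂} {x₁} {y} x₂≢x₁))
            (reduce-nonintegral (steep-chord p-prime {a₁} {a₂} {x₂} {x₁} {y - y₂} {x₁ - x₂} {(x₁ - x₂) ⁻¹ℚ}
              a₁∈ a₂∈ ox₂ ox₁ (ord-- oy oy₂) ¬ot ou (reciprocal λ u≡0 → x₂≢x₁ (sym (difference-zero u≡0)))))

        same-abscissa : x₂ ≡ x₁ → W.lhs E x₁ y₁ ≡ W.rhs E x₁ y₁ → W.lhs E x₂ y₂ ≡ W.rhs E x₂ y₂ →
          addℚ E ⟨ x₂ , y₂ ⟩ ⟨ x₁ , y₁ ⟩ ≡ 𝒪 ⊎ addℚ E ⟨ x₂ , y₂ ⟩ (negℚ E ⟨ x₁ , y₁ ⟩) ≡ 𝒪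
        same-abscissa x₂≡x₁ on₁ on₂ =
          by-cases (integral-domain {y₁ - y₂} {y₂ + y₁ + a₁ * x₁ + a₃} (conjugate {x₁} {y₁} {y₂} on₁
            (subst (λ x → W.lhs E x y₂ ≡ W.rhs E x y₂) x₂≡x₁ on₂)))
          where
          by-cases : y₁ - y₂ ≡ 0ℚ ⊎ y₂ + y₁ + a₁ * x₁ + a₃ ≡ 0ℚ →
            addℚ E ⟨ x₂ , y₂ ⟩ ⟨ x₁ , y₁ ⟩ ≡ 𝒪 ⊎ addℚ E ⟨ x₂ , y₂ ⟩ (negℚ E ⟨ x₁ , y₁ ⟩) ≡ 𝒪
          by-cases (inj₁ e)   = inj₂ (Gℚ.add-opposite E {x₂} {y₂} {x₁} {(- y₁) - a₁ * x₁ - a₃} x₂≡x₁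
            (subst (λ y → y₂ + (- y - a₁ * x₁ - a₃) + a₁ * x₁ + a₃ ≡ 0ℚ) (sym (difference-zero {y₁} {y₂} e))
              (opposite a₁ a₃ x₁ y₂)))
          by-cases (inj₂ s≡0) = inj₁ (Gℚ.add-opposite E {x₂} {y₂} {x₁} {y₁} x₂≡x₁ s≡0)

        -- Suppose p divides x₁ - x₂. Equal abscissae mean P₂ = P₁ or P₂ = -P₁, so P₂ - P₁ or P₂ +
        -- P₁ is 𝒪. Otherwise the ordinates of P₁ and -P₁ differ modulo p, as β₁ is a unit, so y₂
        -- differs from one of them; the chord to that point is steep and the corresponding sum
        -- reduces to 𝒪.
        distinct-abscissae : W.lhs E x₁ y₁ ≡ W.rhs E x₁ y₁ → W.lhs E x₂ y₂ ≡ W.rhs E x₂ y₂ →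
          ¬ Ord≥ p 1 (W.β₁ E x₁ y₁) →
          NonzeroMod (addℚ E ⟨ x₂ , y₂ ⟩ ⟨ x₁ , y₁ ⟩) → NonzeroMod (addℚ E ⟨ x₂ , y₂ ⟩ (negℚ E ⟨ x₁ , y₁ ⟩)) →
          ¬ Ord≥ p 1 (x₁ - x₂)
        distinct-abscissae on₁ on₂ ¬oβ₁ nz₊ nz₋ ou =
          by-cases (x₂ ℚ.≟ x₁) (ord≥? p 1 (y₁ - y₂)) (ord≥? p 1 ((- y₁ - a₁ * x₁ - a₃) - y₂))
          where
          equal : addℚ E ⟨ x₂ , y₂ ⟩ ⟨ x₁ , y₁ ⟩ ≡ 𝒪 ⊎ addℚ E ⟨ x₂ , y₂ ⟩ (negℚ E ⟨ x₁ , y₁ ⟩) ≡ 𝒪 → ⊥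
          equal (inj₁ e) = nz₊ (cong reduce e)
          equal (inj₂ e) = nz₋ (cong reduce e)
          by-cases : Dec (x₂ ≡ x₁) → Dec (Ord≥ p 1 (y₁ - y₂)) → Dec (Ord≥ p 1 ((- y₁ - a₁ * x₁ - a₃) - y₂)) → ⊥
          by-cases (yes x₂≡x₁) _ _ = equal (same-abscissa x₂≡x₁ on₁ on₂)
          by-cases (no x₂≢x₁) (no ¬o) _ = nz₊ (chord-reduces-to-𝒪 oy₁ x₂≢x₁ ou ¬o)
          by-cases (no x₂≢x₁) (yes _) (no ¬o) = nz₋ (chord-reduces-to-𝒪
            (ord-- (ord-- (ord-neg oy₁) (ord-*ʳ a₁∈ ox₁)) a₃∈) x₂≢x₁ ou ¬o)
          by-cases (no x₂≢x₁) (yes o) (yes o′) = ¬oβ₁ (subst (Ord≥ p 1) (β₁-split a₁ a₃ x₁ y₁ y₂) (ord-- o o′))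

  -- Somos sequences multiplied by a geometric progression

  private
    step₄ : ∀ α a A B h₀ h₁ h₂ h₃ h₄ → h₄ * h₀ ≡ A * (h₃ * h₁) - B * (h₂ * h₂) →
      (α * (α * (α * (α * a))) * h₄) * (a * h₀) ≡
      A * ((α * (α * (α * a)) * h₃) * (α * a * h₁)) - B * ((α * (α * a) * h₂) * (α * (α * a) * h₂))
    step₄ α a A B h₀ h₁ h₂ h₃ h₄ e = trans (eq₁ α a h₀ h₄)
      (trans (cong (λ t → α * α * α * α * a * a * t) e) (eq₂ α a A B h₁ h₂ h₃))
      where
      eq₁ : ∀ α a h₀ h₄ → (α * (α * (α * (α * a))) * h₄) * (a * h₀) ≡ α * α * α * α * a * a * (h₄ * h₀)
      eq₁ = solve 4 (λ α a h₀ h₄ → (α :* (α :* (α :* (α :* a))) :* h₄) :* (a :* h₀) :=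
        α :* α :* α :* α :* a :* a :* (h₄ :* h₀)) refl
      eq₂ : ∀ α a A B h₁ h₂ h₃ → α * α * α * α * a * a * (A * (h₃ * h₁) - B * (h₂ * h₂)) ≡
        A * ((α * (α * (α * a)) * h₃) * (α * a * h₁)) - B * ((α * (α * a) * h₂) * (α * (α * a) * h₂))
      eq₂ = solve 7 (λ α a A B h₁ h₂ h₃ → α :* α :* α :* α :* a :* a :* (A :* (h₃ :* h₁) :- B :* (h₂ :* h₂)) :=
        A :* ((α :* (α :* (α :* a)) :* h₃) :* (α :* a :* h₁)) :- B :*
          ((α :* (α :* a) :* h₂) :* (α :* (α :* a) :* h₂))) refl

    step₅ : ∀ α a B J h₀ h₁ h₂ h₃ h₄ h₅ → h₅ * h₀ ≡ B * (h₄ * h₁) + J * (h₃ * h₂) →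
      (α * (α * (α * (α * (α * a)))) * h₅) * (a * h₀) ≡
      B * ((α * (α * (α * (α * a))) * h₄) * (α * a * h₁)) + J * ((α * (α * (α * a)) * h₃) * (α * (α * a) * h₂))
    step₅ α a B J h₀ h₁ h₂ h₃ h₄ h₅ e = trans (eq₁ α a h₀ h₅)
      (trans (cong (λ t → α * α * α * α * α * a * a * t) e) (eq₂ α a B J h₁ h₂ h₃ h₄))
      where
      eq₁ : ∀ α a h₀ h₅ → (α * (α * (α * (α * (α * a)))) * h₅) * (a * h₀)
        ≡ α * α * α * α * α * a * a * (h₅ * h₀)
      eq₁ = solve 4 (λ α a h₀ h₅ → (α :* (α :* (α :* (α :* (α :* a)))) :* h₅) :* (a :* h₀) :=
        α :* α :* α :* α :* α :* a :* a :* (h₅ :* h₀)) refl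
      eq₂ : ∀ α a B J h₁ h₂ h₃ h₄ → α * α * α * α * α * a * a * (B * (h₄ * h₁) + J * (h₃ * h₂)) ≡
        B * ((α * (α * (α * (α * a))) * h₄) * (α * a * h₁)) + J *
          ((α * (α * (α * a)) * h₃) * (α * (α * a) * h₂))
      eq₂ = solve 8 (λ α a B J h₁ h₂ h₃ h₄ → α :* α :* α :* α :* α :* a :* a :*
        (B :* (h₄ :* h₁) :+ J :* (h₃ :* h₂)) :=
        B :* ((α :* (α :* (α :* (α :* a))) :* h₄) :* (α :* a :* h₁)) :+ J :*
          ((α :* (α :* (α :* a)) :* h₃) :* (α :* (α :* a) :* h₂))) refl

  -- In each product of the relation the indices add up to 2 n + 4, so every term acquires the same
  -- power of α.
  geometric-somos₄ : ∀ α {A B h} → IsSomos₄ A B h → IsSomos₄ A B (λ n → α ^ n * h n)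
  geometric-somos₄ α {A} {B} {h} s n = step₄ α (α ^ n) A B (h n) (h (1 ℕ.+ n)) (h (2 ℕ.+ n)) (h (3 ℕ.+ n))
    (h (4 ℕ.+ n)) (s n)

  geometric-somos₅ : ∀ α {B J h} → IsSomos₅ B J h → IsSomos₅ B J (λ n → α ^ n * h n)
  geometric-somos₅ α {B} {J} {h} s n =
    step₅ α (α ^ n) B J (h n) (h (1 ℕ.+ n)) (h (2 ℕ.+ n)) (h (3 ℕ.+ n)) (h (4 ℕ.+ n)) (h (5 ℕ.+ n)) (s n)

  module _ {p : ℕ} (p-prime : Prime p) where

    open Local p-prime
    open Dynamics p-prime using (NoAdjacentZeros)

    -- Adjacent zeros modulo p would propagate down to h 2.
    no-adjacent-zeros : ∀ {A B h} → (∀ n → Ord≥ p 0 (h n)) → Ord≥ p 0 A → Ord≥ p 0 B → ¬ Ord≥ p 1 B →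
      IsSomos₄ A B h → ¬ Ord≥ p 1 (h 2) → NoAdjacentZeros (λ n → h (2 ℕ.+ n))
    no-adjacent-zeros {A} {B} {h} oh oA oB ¬oB s ¬oh₂ n =
      by-cases (ord≥? p 1 (h (2 ℕ.+ n))) (ord≥? p 1 (h (3 ℕ.+ n)))
      where
      isolate : ∀ x y z → x ≡ y - z → y - x ≡ z
      isolate x y z refl = eq y z
        where
        eq : ∀ y z → y - (y - z) ≡ z
        eq = solve 2 (λ y z → y :- (y :- z) := z) refl
      not-both : ∀ n → Ord≥ p 1 (h (2 ℕ.+ n)) → Ord≥ p 1 (h (3 ℕ.+ n)) → ⊥
      not-both zero    o₂ _ = ¬oh₂ o₂
      not-both (suc n) o₃ o₄ = contradict (ord≥? p 1 (h (2 ℕ.+ n)))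
        where
        square : Ord≥ p 1 (B * (h (2 ℕ.+ n) * h (2 ℕ.+ n)))
        square = subst (Ord≥ p 1) (isolate _ _ _ (s n))
          (ord-- (ord-*ˡ oA (ord-*ʳ o₃ (oh _))) (ord-*ʳ o₄ (oh _)))
        contradict : Dec (Ord≥ p 1 (h (2 ℕ.+ n))) → ⊥
        contradict (yes o₂) = not-both n o₂ o₃
        contradict (no ¬o₂) = unit-* oB ¬oB (ord-*ʳ (oh _) (oh _)) (unit-* (oh _) ¬o₂ (oh _) ¬o₂) square
      by-cases : Dec (Ord≥ p 1 (h (2 ℕ.+ n))) → Dec (Ord≥ p 1 (h (3 ℕ.+ n))) →
                 ¬ Ord≥ p 1 (h (2 ℕ.+ n)) ⊎ ¬ Ord≥ p 1 (h (3 ℕ.+ n))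
      by-cases (no ¬o) _       = inj₁ ¬o
      by-cases (yes _) (no ¬o) = inj₂ ¬o
      by-cases (yes o) (yes o′) = ⊥-elim (not-both n o o′)

    unit-^ : ∀ {α} → Ord≥ p 0 α → ¬ Ord≥ p 1 α → ∀ n → ¬ Ord≥ p 1 (α ^ n)
    unit-^ oα ¬oα zero    = 1-unit
    unit-^ oα ¬oα (suc n) = unit-* oα ¬oα (ord-^ oα n) (unit-^ oα ¬oα n)

    nonunit-^ : ∀ {α} → Ord≥ p 1 α → ∀ n → Ord≥ p n (α ^ n)
    nonunit-^ oα zero    = 1-integral
    nonunit-^ oα (suc n) = ord-step oα (nonunit-^ oα n)

    module _ {α β A B J : ℚ} {h : ℕ → ℚ} (oα : Ord≥ p 0 α) (oβ : Ord≥ p 0 β)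
             (oA : Ord≥ p 0 A) (oB : Ord≥ p 0 B) (¬oB : ¬ Ord≥ p 1 B) (oJ : Ord≥ p 0 J)
             (oh : ∀ n → Ord≥ p 0 (h n)) (¬oh₂ : ¬ Ord≥ p 1 (h 2)) (s₄ : IsSomos₄ A B h) (s₅ : IsSomos₅ B J h) where

      private
        w : ℕ → ℚ
        w n = β * (α ^ n * h (2 ℕ.+ n))

        ow : ∀ n → Ord≥ p 0 (w n)
        ow n = ord-*ʳ oβ (ord-*ʳ (ord-^ oα n) (oh _))

        ConvergesAlongPowers : Set
        ConvergesAlongPowers =
          ∃[ N ] (N ℕ.≥ 1 × (∀ m → m ℕ.≥ 1 → ∃[ ℓ ] Converges p (λ i → w (m ℕ.* (p ℕ.^ N) ℕ.^ i)) ℓ))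

        nonunit-case : Ord≥ p 1 α → ConvergesAlongPowers
        -- The terms tend to 0, so already 1 can serve as the period T.
        nonunit-case o = Limit.periodic⇒converges p-prime {w} ow 1 λ k → k , λ m k≤m →
          ord-- (small (ℕ.≤-trans k≤m (ℕ.m≤m+n m _))) (small k≤m)
          where
          small : ∀ {k m} → k ℕ.≤ m → Ord≥ p k (w m)
          small {k} {m} k≤m = ord-*ˡ oβ (ord-*ʳ (ord-≤ k≤m (nonunit-^ o m)) (oh _))

        unit-case : ¬ Ord≥ p 1 α → ConvergesAlongPowers
        unit-case ¬o = Limit.periodic⇒converges p-prime {w} ow (Dynamics.windows p-prime !)
          {{Dynamics.windows p-prime ℕ.!≢0}} λ k →
          let n₀ , per = somos-period p-prime oA oB oJ {g} (λ n → ord-*ʳ (ord-^ oα n) (oh _))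
                           (geometric-somos₄ α {A} {B} {h′} (λ n → s₄ (2 ℕ.+ n)))
                           (geometric-somos₅ α {B} {J} {h′} (λ n → s₅ (2 ℕ.+ n))) nz k in
          n₀ , λ m n₀≤m → ≡-* p-prime oβ (ord-*ʳ (ord-^ oα m) (oh _)) (≡-refl p-prime)
            (ord-≤ (ℕ.n≤1+n k) (per m n₀≤m))
          where
          h′ g : ℕ → ℚ
          h′ n = h (2 ℕ.+ n)
          -- β is kept outside: it may be divisible by p, and then all terms would vanish modulo p.
          g n = α ^ n * h′ n
          nz : NoAdjacentZeros g
          nz n = times (no-adjacent-zeros {A} {B} {h} oh oA oB ¬oB s₄ ¬oh₂ n)
            where
            times : ¬ Ord≥ p 1 (h′ n) ⊎ ¬ Ord≥ p 1 (h′ (1 ℕ.+ n)) → ¬ Ord≥ p 1 (g n) ⊎ ¬ Ord≥ p 1 (g (1 ℕ.+ n))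
            times (inj₁ ¬oh) = inj₁ (unit-* (ord-^ oα n) (unit-^ oα ¬o n) (oh _) ¬oh)
            times (inj₂ ¬oh) = inj₂ (unit-* (ord-^ oα (1 ℕ.+ n)) (unit-^ oα ¬o (1 ℕ.+ n)) (oh _) ¬oh)

      somos-converges : ConvergesAlongPowers
      somos-converges = by-cases (ord≥? p 1 α)
        where
        by-cases : Dec (Ord≥ p 1 α) → ConvergesAlongPowers
        by-cases (yes o) = nonunit-case o
        by-cases (no ¬o) = unit-case ¬o

  -- From translated division polynomials to the given sequence

  evaluate-unseal : ∀ {ρ ρ′} → (∀ g → ρ g ≡ ρ′ g) → ∀ s → evaluate ℚ-rawRing ρ s ≡ ev ρ′ s
  evaluate-unseal e (U.gen g) = e g
  evaluate-unseal e U.0#      = refl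
  evaluate-unseal e U.1#      = refl
  evaluate-unseal e (s U.+ t) = trans (+-unseal _ _) (cong₂ _+_ (evaluate-unseal e s) (evaluate-unseal e t))
  evaluate-unseal e (s U.* t) = trans (*-unseal _ _) (cong₂ _*_ (evaluate-unseal e s) (evaluate-unseal e t))
  evaluate-unseal e (U.- s)   = trans (neg-unseal _) (cong -_ (evaluate-unseal e s))

  specialize-unseal : ∀ E x₁ y₁ x₂ y₂ s →
    specialize E x₁ y₁ x₂ y₂ s ≡ ev (assignment rawRing E x₁ y₁ x₂ y₂ ((x₁ ℚ.- x₂) ⁻¹ℚ)) s
  specialize-unseal E x₁ y₁ x₂ y₂ = evaluate-unseal λ where
    A₁ → refl
    A₂ → refl
    A₃ → refl
    A₄ → refl
    A₆ → refl
    X₁ → refl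
    Y₁ → refl
    X₂ → refl
    Y₂ → refl
    [X₁-X₂]⁻¹ → refl

  opaque
    unfolding _+_

    onCurve-unseal : ∀ E {x y} → OnCurveℚ E ⟨ x , y ⟩ → W.lhs E x y ≡ W.rhs E x y
    onCurve-unseal E on = on

  translated-division-converges : ∀ {Ψ} → IsTranslatedDivision Ψ →
    ∀ {α β} (w : ℕ → ℚ) E {x₁ y₁ x₂ y₂} → OnCurveℚ E ⟨ x₁ , y₁ ⟩ → OnCurveℚ E ⟨ x₂ , y₂ ⟩ →
    (∀ n → n ℕ.≥ 1 → w n ≡ (α ^ℚ n) ℚ.* β ℚ.* specialize E x₁ y₁ x₂ y₂ (Ψ (+ n))) →
    ∀ {p} (p-prime : Prime p) → p ≢ 2 → (integral-E : IntegralCoefficients p E) →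
    let open Reduction p-prime E integral-E; P₁ = ⟨ x₁ , y₁ ⟩; P₂ = ⟨ x₂ , y₂ ⟩ in
    NonzeroMod P₁ → NonzeroMod P₂ → NonzeroMod (addℚ E P₂ P₁) → NonzeroMod (addℚ E P₂ (negℚ E P₁)) →
    ∀ {r} → HasOrderMod P₁ r → r ℕ.> 3 → Ord≥ p 0 α → Ord≥ p 0 β →
    ∃[ N ] (N ℕ.≥ 1 × (∀ m → m ℕ.≥ 1 → ∃[ ℓ ] Converges p (λ i → w (m ℕ.* (p ℕ.^ N) ℕ.^ i)) ℓ))
  translated-division-converges {Ψ} isΨ {α} {β} w E {x₁} {y₁} {x₂} {y₂} on₁ on₂ values {p} p-prime p≢2
    integral-E
      nz₁ nz₂ nz₊ nz₋ {r} order r>3 oα oβ =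
    let N , N≥1 , limit = converges in
    N , N≥1 , λ m m≥1 → let ℓ , lim = limit m m≥1 in
      ℓ , λ k → proj₁ (lim k) , λ i i₀≤i → subst (λ x → Ord≥ p k (x ℚ.- residue ℓ k ℚ./ 1))
        (sym (w≡ (m≥1⇒ m≥1 N i))) (proj₂ (lim k) i i₀≤i)
    where
    open Local p-prime
    open Reduction p-prime E integral-E
    open ReductionProperties p-prime E integral-E
    module I = IntegralCoefficients integral-E
    affine₁ = reduce-affine nz₁
    affine₂ = reduce-affine nz₂
    ox₁ : Ord≥ p 0 x₁
    ox₁ = proj₁ affine₁
    oy₁ : Ord≥ p 0 y₁
    oy₁ = proj₁ (proj₂ affine₁)
    ox₂ : Ord≥ p 0 x₂
    ox₂ = proj₁ affine₂
    oy₂ : Ord≥ p 0 y₂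
    oy₂ = proj₁ (proj₂ affine₂)
    order′ : G.HasOrder Ẽ ⟨ (x₁ , ox₁) , (y₁ , oy₁) ⟩ r
    order′ = subst (λ P → G.HasOrder Ẽ P r) (proj₂ (proj₂ affine₁)) order
    e₁ : W.lhs E x₁ y₁ ≡ W.rhs E x₁ y₁
    e₁ = onCurve-unseal E on₁
    e₂ : W.lhs E x₂ y₂ ≡ W.rhs E x₂ y₂
    e₂ = onCurve-unseal E on₂
    ¬ou : ¬ Ord≥ p 1 (x₁ - x₂)
    ¬ou = distinct-abscissae ox₁ oy₁ ox₂ oy₂ e₁ e₂
      (order>2⇒β₁-unit ox₁ oy₁ order′ (ℕ.<-trans (ℕ.n<1+n 2) r>3)) nz₊ nz₋
    i : ℚ
    i = (x₁ ℚ.- x₂) ⁻¹ℚ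
    inverse : (x₁ - x₂) * i ≡ 1ℚ
    inverse = subst (λ u → (x₁ - x₂) * u ⁻¹ℚ ≡ 1ℚ)
      (sym (trans (+-unseal x₁ (ℚ.- x₂)) (cong (λ t → x₁ + t) (neg-unseal x₂))))
      (reciprocal λ u≡0 → ¬ou (subst (Ord≥ p 1) (sym u≡0) (0-ord 1)))
    c : Specialization
    c = record { E = E ; x₁ = x₁ ; y₁ = y₁ ; x₂ = x₂ ; y₂ = y₂ ; i = i ; equation₁ = e₁ ; equation₂ =
      e₂ ; inverse = inverse }
    oc : IntegralAt p c
    oc A₁ = I.a₁∈
    oc A₂ = I.a₂∈
    oc A₃ = I.a₃∈
    oc A₄ = I.a₄∈
    oc A₆ = I.a₆∈
    oc X₁ = ox₁
    oc Y₁ = oy₁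
    oc X₂ = ox₂
    oc Y₂ = oy₂
    oc [X₁-X₂]⁻¹ = reciprocal-integral (ord-- ox₁ ox₂) ¬ou inverse
    module D = Division isΨ
    o⟦⟧ : ∀ s → Ord≥ p 0 (Specialization.⟦_⟧ c s)
    o⟦⟧ = ev-integral p-prime oc
    converges : ∃[ N ] (N ℕ.≥ 1 × (∀ m → m ℕ.≥ 1 →
      ∃[ ℓ ] Converges p (λ i → β * (α ^ (m ℕ.* (p ℕ.^ N) ℕ.^ i) * D.h c (2 ℕ.+ m ℕ.* (p ℕ.^ N) ℕ.^ i))) ℓ))
    converges = somos-converges p-prime {α} {β} {D.A c} {D.B c} {Specialization.⟦_⟧ c (Jᵁ isΨ)} {D.h c} oα oβ
      (o⟦⟧ (U.β₁ U.x₁ U.y₁ U.^ 2)) (o⟦⟧ (U.β₂ U.x₁ U.y₁)) (order>3⇒β₂-unit ox₁ oy₁ e₁ order′ r>3)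
        (o⟦⟧ (Jᵁ isΨ)) (λ n → o⟦⟧ (D.shifted n))
      (subst (λ x → ¬ Ord≥ p 1 x) (sym (D.h₂ c)) 1-unit) (D.h-somos₄ c) (h-somos₅ isΨ p-prime p≢2 {c} oc)
    w≡ : ∀ {n} → n ℕ.≥ 1 → w n ≡ β * (α ^ n * D.h c (2 ℕ.+ n))
    w≡ {n} n≥1 = trans (values n n≥1) (begin
      (α ^ℚ n) ℚ.* β ℚ.* specialize E x₁ y₁ x₂ y₂ (Ψ (+ n))
        ≡⟨ *-unseal _ _ ⟩
      ((α ^ℚ n) ℚ.* β) * specialize E x₁ y₁ x₂ y₂ (Ψ (+ n))
        ≡⟨ cong₂ _*_ (trans (*-unseal (α ^ℚ n) β) (cong (_* β) (^-unseal α n)))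
          (specialize-unseal E x₁ y₁ x₂ y₂ (Ψ (+ n))) ⟩
      (α ^ n * β) * D.h c (2 ℕ.+ n)
        ≡⟨ trans (cong (_* D.h c (2 ℕ.+ n)) (*-comm (α ^ n) β)) (*-assoc β (α ^ n) (D.h c (2 ℕ.+ n))) ⟩
      β * (α ^ n * D.h c (2 ℕ.+ n)) ∎)
      where open ≡-Reasoning
    -- The formula for w in terms of Ψ is given at positive indices only.
    m≥1⇒ : ∀ {m} → m ℕ.≥ 1 → ∀ N i → m ℕ.* (p ℕ.^ N) ℕ.^ i ℕ.≥ 1
    m≥1⇒ m≥1 N i = ℕ.*-mono-≤ m≥1 (ℕ.m^n>0 (p ℕ.^ N) {{ℕ.m^n≢0 p N}} i)

open import Data.Nat using (_*_; _^_; _≥_; _>_)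
open import Data.Rational using (NonZero; _÷_)

theorem1p4 : (W : ℕ → ℚ) (τ₁ τ₂ : ℚ) → IsSomos4 W τ₁ τ₂ → τ₁ ≢ 0ℚ → .{{_ : NonZero (W 0)}} →
    (Ψ : ℤ → Universal.Expr) → IsTranslatedDivision Ψ →
    (E : Weierstrass ℚ) (P₁ P₂ : Point ℚ) → IsAssociated Ψ W E P₁ P₂ →
    (p : ℕ) (p-prime : Prime p) → p ≢ 2 →
    (integral-E : IntegralCoefficients p E) →
    let open Reduction p-prime E integral-E in
    NonsingularMod P₁ → NonsingularMod P₂ →
    NonzeroMod P₁ → NonzeroMod P₂ →
    NonzeroMod (addℚ E P₂ P₁) → NonzeroMod (addℚ E P₂ (negℚ E P₁)) →
    (r : ℕ) → HasOrderMod P₁ r → r > 3 →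
    Ord≥ p 0 (W 1 ÷ W 0) → Ord≥ p 0 (W 0) →
    ∃[ N ] (N ≥ 1 × (∀ m → m ≥ 1 → ∃[ ℓ ] Converges p (λ i → W (m * (p ^ N) ^ i)) ℓ))
theorem1p4 W _ _ _ _ Ψ isΨ E P₁ P₂
  record { P₁∈E = on₁ ; P₂∈E = on₂ ; P₁-affine = refl ; P₂-affine = refl ; values = values }
  p p-prime p≢2 integral-E _ _ nz₁ nz₂ nz₊ nz₋ r order r>3 oα oβ =
  SomosConvergence.translated-division-converges isΨ W E on₁ on₂ values p-prime p≢2 integral-E nz₁ nz₂ nz₊ nz₋
    order r>3 oα oβ
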